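{- Let $d>1$ be a squarefree integer and let $m,n$ be integers with $m^2-dn^2=-4$. Let $p$ be a prime with $p=x^2+3dy^2$, where $x,y$ are integers with $3\nmid y$ and $x\equiv y\pmod 3$. Then modulo $p$, $$\Big(\frac{m+n\sqrt d}{2}\Big)^{\frac{p-1}{3}}\equiv \begin{cases} 1 & \text{if } m\equiv 0,\pm4\pmod 9,\\ \frac12\Big(-1+\big(\frac{mn/3}{3}\big)\frac{x}{dy}\sqrt d\Big) & \text{if } m\equiv\pm3\pmod 9,\\ \frac12\Big(-1-\big(\frac{mn}{3}\big)\frac{x}{dy}\sqrt d\Big) & \text{if } m\equiv\pm1\pmod 9,\\ \frac12\Big(-1+\big(\frac{mn}{3}\big)\frac{x}{dy}\sqrt d\Big) & \text{if } m\equiv\pm2\pmod 9,\end{cases}$$ where $\big(\frac{\cdot}{3}\big)$ is the Legendre symbol.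
   Context: For such a prime $p$, $d$ is a nonzero square modulo $p$. In the congruence, $\sqrt d$ is interpreted as an integer $s$ with $s^2\equiv d\pmod p$, the same choice of $s$ being used on both sides (the congruence holds for either choice), and the denominators $2$ and $dy$, which are prime to $p$, are inverted modulo $p$. -}

module Defs where

open import Data.Bool using (if_then_else_)
open import Data.Fin using (Fin; toℕ)
open import Data.Fin.Properties using (any?)
open import Data.Integer using (ℤ; +_; _-_; _*_; ∣_∣; 0ℤ; 1ℤ; -1ℤ)
open import Data.Integer.Divisibility.Signed using (_∣_; _∣?_)
open import Data.Nat using (ℕ)
open import Data.Product using (∃)
open import Relation.Binary.PropositionalEquality using (_≡_)
open import Relation.Nullary using (Dec; does)

Squarefree : ℤ → Set
Squarefree d = ∀ (k : ℤ) → k * k ∣ d → ∣ k ∣ ≡ 1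

infix 4 _≡_[mod_] _≡?_[mod_]

_≡_[mod_] : ℤ → ℤ → ℕ → Set
a ≡ b [mod q ] = + q ∣ a - b

_≡?_[mod_] : ∀ (a b : ℤ) (q : ℕ) → Dec (a ≡ b [mod q ])
a ≡? b [mod q ] = + q ∣? a - b

-- Inverses modulo q are specified relationally: any integer representing
-- the inverse of a residue class is admissible.
_IsInverseOf_[mod_] : ℤ → ℤ → ℕ → Set
u IsInverseOf a [mod q ] = a * u ≡ 1ℤ [mod q ]

-- It suffices to look for square roots among the residues 0, …, q - 1.
IsSquareMod : ℕ → ℤ → Set
IsSquareMod q a = ∃ λ (k : Fin q) → + toℕ k * + toℕ k ≡ a [mod q ]

isSquareMod? : ∀ (q : ℕ) (a : ℤ) → Dec (IsSquareMod q a)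
isSquareMod? q a = any? λ k → + toℕ k * + toℕ k ≡? a [mod q ]

-- The Legendre symbol (a / q); meaningful when q is an odd prime.
legendre : ℤ → ℕ → ℤ
legendre a q =
  if does (+ q ∣? a) then 0ℤ
  else if does (isSquareMod? q a) then 1ℤ
  else -1ℤ

{-# OPTIONS --safe #-}

-- Put ω = e^(2πi/3) and ε = (m + n √d) / 2.  Since ε ε̄ = -1 and √d = x / (y √-3) modulo p,
-- ε² is congruent to γ / γ̄ for an Eisenstein integer γ proportional to n x + m y √-3, of norm
-- u² p - 3 v² where n : 2 y = u : v in lowest terms.  Up to an integer factor and a power of ω,
-- γ is a product of Jacobi sums of cubic characters, and the Gauss sums of these characters give
-- the rational cubic reciprocity law (γ / p)₃ (γ̄ / p)₃⁻¹ = (p / γ)₃.  As u² p ≡ 3 v² modulo the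
-- norm of γ, the right hand side is determined by the symbols of 3, u and v.  Those of u and v
-- follow from reciprocity again, γ being proportional to its conjugate modulo the primes
-- dividing u or v; that of 3 is the supplementary law, proved for a Jacobi sum A + 3 B ω
-- from the symbols of A and A + 3 B in the same way.
module Submission where

open import Defs
open import Algebra.Bundles using (CommutativeRing)
import Algebra.Properties.CommutativeSemiring.Binomial as Binomial
import Algebra.Properties.CommutativeSemiring.Exp as CommSemiringExp
import Algebra.Properties.Ring as RingProperties
import Algebra.Properties.Semiring.Exp as SemiringExp
import Algebra.Properties.Semiring.Mult as SemiringMult
import Algebra.Properties.Semiring.Sum as SemiringSum
open import Data.Bool using (true; false; if_then_else_)
open import Data.Empty using (⊥)
open import Data.Fin using (Fin; zero; suc; toℕ; fromℕ<; inject₁; fromℕ)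
import Data.Fin.Permutation as Perm
import Data.Fin.Properties as Fin
open import Data.Integer as ℤ
  using (ℤ; +_; -[1+_]; -_; _+_; _-_; _*_; _^_; _<_; _/_; _%_; ∣_∣; 0ℤ; 1ℤ; -1ℤ)
open import Data.Integer.Divisibility.Signed
  using (_∣_; _∣?_; divides; ∣ᵤ⇒∣; ∣⇒∣ᵤ; ∣-trans; ∣-refl; ∣m∣n⇒∣m+n; ∣m⇒∣-m; ∣m∣n⇒∣m-n;
         ∣n⇒∣m*n; ∣m⇒∣m*n; 0∣⇒≡0; *-cancelˡ-∣)
open import Data.Integer.DivMod
  using (_%ℕ_; _/ℕ_; n%ℕd<d; a≡a%ℕn+[a/ℕn]*n; n%d<d; a≡a%n+[a/n]*n)
import Data.Integer.Properties as ℤ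
open import Data.Integer.Tactic.RingSolver using (solve-∀)
open import Data.List using ([]; _∷_)
open import Data.List.Relation.Unary.All using (All; []; _∷_)
open import Data.Maybe using (just; nothing)
open import Data.Nat as ℕ using (ℕ; zero; suc; NonZero; _∸_) renaming (_/_ to _÷_)
open import Data.Nat.Combinatorics using (_C_; nCn≡1; nC1≡n; nCk≡nC[n∸k]; nCk+nC[k+1]≡[n+1]C[k+1])
import Data.Nat.Divisibility as ℕ
import Data.Nat.DivMod as ℕ
open import Data.Nat.GCD using (gcd; gcd[m,n]∣m; gcd[m,n]∣n; gcd-greatest)
open import Data.Nat.ListAction using (product)
open import Data.Nat.Primality
  using (Prime; ¬prime[0]; ¬prime[1]; prime[2]; prime?; prime⇒nonZero; prime⇒irreducible; euclidsLemma)
open import Data.Nat.Primality.Factorisation using (PrimeFactorisation; factorise)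
import Data.Nat.Properties as ℕ
open import Data.Nat.Tactic.RingSolver using () renaming (solve-∀ to solveℕ-∀)
open import Data.Product using (∃-syntax; _×_; _,_; proj₁; proj₂)
import Data.Sum as Sum
open import Data.Sum using (_⊎_; inj₁; inj₂)
open import Function using (_∘_)
open import Level using (0ℓ)
open import Relation.Binary.Core using (Rel)
open import Relation.Binary.PropositionalEquality
  using (_≡_; _≢_; refl; sym; trans; cong; cong₂; subst; isEquivalence; module ≡-Reasoning)
import Relation.Binary.Reasoning.Setoid as SetoidReasoning
open import Relation.Binary.Structures using (IsEquivalence)
open import Relation.Nullary using (¬_; Dec; does; yes; no; contradiction)
open import Relation.Nullary.Decidable using (from-yes; from-no; dec-true; dec-false; _⊎-dec_)
import Tactic.RingSolver as TR
open import Tactic.RingSolver.Core.AlmostCommutativeRing using (AlmostCommutativeRing; fromCommutativeRing)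

-- Congruences and Eisenstein integers

-- Gauss sums call for an ℓ-th root of unity; the generic one is used, in the group ring of ℤ/ℓ over
-- 𝔼/q. The price is zero divisors: the Gauss sum `g` is not invertible and g ḡ is not the scalar ℓ.
-- Identities are therefore kept multiplied by `g`, and scalars are recovered from the coefficient
-- at 1. Cubic symbols are recorded by exponents modulo 3, but their values are given as three times
-- the exponent modulo 9. The reason is the function n ↦ 1 - n²: for m and n prime to 3, (1 - m²) (1
-- - n²) ≡ 0 modulo 9, so it turns products into sums modulo 9. This is how the residue of m modulo
-- 9 enters the result. Reciprocity only involves quotients (γ / q)₃ (γ̄ / q)₃⁻¹, in which rational
-- factors cancel. Hence γ can be taken apart one rational prime ℓ at a time: either ℓ itself is
-- pulled out, or a Jacobi sum of norm ℓ.

module _ (R : CommutativeRing 0ℓ 0ℓ) where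

  private module R = CommutativeRing R

  -- Carrier and operations stay the same and only equality is coarsened, so each ring law transfers
  -- along `emb`. Elements of ℤ and of `ℤ/ q`, or of `𝔼` and of `𝔼/ q`, are then literally the same
  -- terms.
  quotient : ∀ (_∼_ : Rel R.Carrier 0ℓ) → IsEquivalence _∼_ → (∀ {a b} → a R.≈ b → a ∼ b) →
    (∀ {a b c d} → a ∼ b → c ∼ d → (a R.+ c) ∼ (b R.+ d)) →
    (∀ {a b c d} → a ∼ b → c ∼ d → (a R.* c) ∼ (b R.* d)) →
    (∀ {a b} → a ∼ b → (R.- a) ∼ (R.- b)) → CommutativeRing 0ℓ 0ℓ
  quotient _∼_ isEq emb +c *c -c = record
    { Carrier = R.Carrier ; _≈_ = _∼_ ; _+_ = R._+_ ; _*_ = R._*_ ; -_ = R.-_ ; 0# = R.0# ; 1# = R.1#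
    ; isCommutativeRing = record
      { isRing = record
        { +-isAbelianGroup = record
          { isGroup = record
            { isMonoid = record
              { isSemigroup = record
                { isMagma = record { isEquivalence = isEq ; ∙-cong = +c }
                ; assoc = λ x y z → emb (R.+-assoc x y z) }
              ; identity = emb ∘ proj₁ R.+-identity , emb ∘ proj₂ R.+-identity }
            ; inverse = emb ∘ proj₁ R.-‿inverse , emb ∘ proj₂ R.-‿inverse
            ; ⁻¹-cong = -c }
          ; comm = λ x y → emb (R.+-comm x y) }
        ; *-cong = *c
        ; *-assoc = λ x y z → emb (R.*-assoc x y z)
        ; *-identity = emb ∘ proj₁ R.*-identity , emb ∘ proj₂ R.*-identity
        ; distrib = (λ x y z → emb (proj₁ R.distrib x y z)) , (λ x y z → emb (proj₂ R.distrib x y z)) }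
      ; *-comm = λ x y → emb (R.*-comm x y) } }

∣-resp : ∀ {q a b} → a ≡ b → q ∣ a → q ∣ b
∣-resp {q} eq = subst (q ∣_) eq

infix 4 _≋_⟨_⟩

record _≋_⟨_⟩ (a b : ℤ) (q : ℕ) : Set where
  constructor mod
  field
    unmod : + q ∣ a - b
open _≋_⟨_⟩ public

module _ {q : ℕ} where

  ≡⇒≋ : ∀ {a b} → a ≡ b → a ≋ b ⟨ q ⟩
  ≡⇒≋ {a} refl = mod (divides 0ℤ (ℤ.+-inverseʳ a))

  ≋-refl : ∀ {a} → a ≋ a ⟨ q ⟩
  ≋-refl = ≡⇒≋ refl

  ≋-sym : ∀ {a b} → a ≋ b ⟨ q ⟩ → b ≋ a ⟨ q ⟩
  ≋-sym {a} {b} (mod h) = mod (∣-resp (lem a b) (∣m⇒∣-m h))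
    where
    lem : ∀ a b → - (a - b) ≡ b - a
    lem = solve-∀

  ≋-trans : ∀ {a b c} → a ≋ b ⟨ q ⟩ → b ≋ c ⟨ q ⟩ → a ≋ c ⟨ q ⟩
  ≋-trans {a} {b} {c} (mod h) (mod k) = mod (∣-resp (lem a b c) (∣m∣n⇒∣m+n h k))
    where
    lem : ∀ a b c → a - b + (b - c) ≡ a - c
    lem = solve-∀

  ≋-+ : ∀ {a b c d} → a ≋ b ⟨ q ⟩ → c ≋ d ⟨ q ⟩ → a + c ≋ b + d ⟨ q ⟩
  ≋-+ {a} {b} {c} {d} (mod h) (mod k) = mod (∣-resp (lem a b c d) (∣m∣n⇒∣m+n h k))
    where
    lem : ∀ a b c d → a - b + (c - d) ≡ a + c - (b + d)
    lem = solve-∀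

  ≋-* : ∀ {a b c d} → a ≋ b ⟨ q ⟩ → c ≋ d ⟨ q ⟩ → a * c ≋ b * d ⟨ q ⟩
  ≋-* {a} {b} {c} {d} (mod h) (mod k) = mod (∣-resp (lem a b c d) (∣m∣n⇒∣m+n (∣n⇒∣m*n c h) (∣n⇒∣m*n b k)))
    where
    lem : ∀ a b c d → c * (a - b) + b * (c - d) ≡ a * c - b * d
    lem = solve-∀

  ≋-neg : ∀ {a b} → a ≋ b ⟨ q ⟩ → - a ≋ - b ⟨ q ⟩
  ≋-neg {a} {b} (mod h) = mod (∣-resp (lem a b) (∣m⇒∣-m h))
    where
    lem : ∀ a b → - (a - b) ≡ - a - (- b)
    lem = solve-∀

  ≋-+ˡ : ∀ c {a b} → a ≋ b ⟨ q ⟩ → c + a ≋ c + b ⟨ q ⟩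
  ≋-+ˡ c = ≋-+ {c} {c} ≋-refl

  ≋-+ʳ : ∀ c {a b} → a ≋ b ⟨ q ⟩ → a + c ≋ b + c ⟨ q ⟩
  ≋-+ʳ c h = ≋-+ h (≋-refl {c})

  ≋-*ˡ : ∀ c {a b} → a ≋ b ⟨ q ⟩ → c * a ≋ c * b ⟨ q ⟩
  ≋-*ˡ c = ≋-* {c} {c} ≋-refl

  ≋-*ʳ : ∀ c {a b} → a ≋ b ⟨ q ⟩ → a * c ≋ b * c ⟨ q ⟩
  ≋-*ʳ c h = ≋-* h (≋-refl {c})

  ≋-isEquivalence : IsEquivalence (_≋_⟨ q ⟩)
  ≋-isEquivalence = record { refl = ≋-refl ; sym = ≋-sym ; trans = ≋-trans }

  ∣⇒≋0 : ∀ {a} → + q ∣ a → a ≋ 0ℤ ⟨ q ⟩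
  ∣⇒≋0 {a} h = mod (∣-resp (sym (ℤ.+-identityʳ a)) h)

  ≋0⇒∣ : ∀ {a} → a ≋ 0ℤ ⟨ q ⟩ → + q ∣ a
  ≋0⇒∣ {a} (mod h) = ∣-resp (ℤ.+-identityʳ a) h

  ≋-∣ : ∀ {a b} → a ≋ b ⟨ q ⟩ → + q ∣ b → + q ∣ a
  ≋-∣ h k = ≋0⇒∣ (≋-trans h (∣⇒≋0 k))

≋0⇒≡ : ∀ {a b} → a ≋ b ⟨ 0 ⟩ → a ≡ b
≋0⇒≡ (mod h) = ℤ.i-j≡0⇒i≡j _ _ (0∣⇒≡0 h)

ℤ/ : ℕ → CommutativeRing 0ℓ 0ℓ
ℤ/ q = quotient ℤ.+-*-commutativeRing (_≋_⟨ q ⟩) ≋-isEquivalence ≡⇒≋ ≋-+ ≋-* ≋-neg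

-- Eisenstein integers a + b ω, where ω² = - 1 - ω.
record 𝔼 : Set where
  constructor ⟪_,_⟫
  field
    re im : ℤ
open 𝔼 public

infixl 7 _⊗_
infixl 6 _⊕_
infix  8 ⊖_
infixr 8 _^ᴱ_

_⊕_ _⊗_ : 𝔼 → 𝔼 → 𝔼
⟪ a , b ⟫ ⊕ ⟪ c , d ⟫ = ⟪ a + c , b + d ⟫
⟪ a , b ⟫ ⊗ ⟪ c , d ⟫ = ⟪ a * c - b * d , a * d + b * c - b * d ⟫

⊖_ conj : 𝔼 → 𝔼
⊖ ⟪ a , b ⟫ = ⟪ - a , - b ⟫
conj ⟪ a , b ⟫ = ⟪ a - b , - b ⟫

ι : ℤ → 𝔼
ι a = ⟪ a , 0ℤ ⟫

0ᴱ 1ᴱ : 𝔼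
0ᴱ = ι 0ℤ
1ᴱ = ι 1ℤ

norm : 𝔼 → ℤ
norm ⟪ a , b ⟫ = a * a - a * b + b * b

_^ᴱ_ : 𝔼 → ℕ → 𝔼
x ^ᴱ zero  = 1ᴱ
x ^ᴱ suc n = x ⊗ x ^ᴱ n

𝔼-ring : CommutativeRing 0ℓ 0ℓ
𝔼-ring = record
  { Carrier = 𝔼 ; _≈_ = _≡_ ; _+_ = _⊕_ ; _*_ = _⊗_ ; -_ = ⊖_ ; 0# = 0ᴱ ; 1# = 1ᴱ
  ; isCommutativeRing = record
    { isRing = record
      { +-isAbelianGroup = record
        { isGroup = record
          { isMonoid = record
            { isSemigroup = record
              { isMagma = record { isEquivalence = isEquivalence ; ∙-cong = cong₂ _⊕_ }
              ; assoc = λ { ⟪ a , b ⟫ ⟪ c , d ⟫ ⟪ e , f ⟫ → cong₂ ⟪_,_⟫ (ℤ.+-assoc a c e) (ℤ.+-assoc b d f) } }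
            ; identity = (λ { ⟪ a , b ⟫ → cong₂ ⟪_,_⟫ (ℤ.+-identityˡ a) (ℤ.+-identityˡ b) })
                       , (λ { ⟪ a , b ⟫ → cong₂ ⟪_,_⟫ (ℤ.+-identityʳ a) (ℤ.+-identityʳ b) }) }
          ; inverse = (λ { ⟪ a , b ⟫ → cong₂ ⟪_,_⟫ (ℤ.+-inverseˡ a) (ℤ.+-inverseˡ b) })
                    , (λ { ⟪ a , b ⟫ → cong₂ ⟪_,_⟫ (ℤ.+-inverseʳ a) (ℤ.+-inverseʳ b) })
          ; ⁻¹-cong = cong ⊖_ }
        ; comm = λ { ⟪ a , b ⟫ ⟪ c , d ⟫ → cong₂ ⟪_,_⟫ (ℤ.+-comm a c) (ℤ.+-comm b d) } }
      ; *-cong = cong₂ _⊗_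
      ; *-assoc = λ { ⟪ a , b ⟫ ⟪ c , d ⟫ ⟪ e , f ⟫ → cong₂ ⟪_,_⟫ (assoc₁ a b c d e f) (assoc₂ a b c d e f) }
      ; *-identity = (λ { ⟪ a , b ⟫ → cong₂ ⟪_,_⟫ (idˡ₁ a b) (idˡ₂ a b) })
                   , (λ { ⟪ a , b ⟫ → cong₂ ⟪_,_⟫ (idʳ₁ a b) (idʳ₂ a b) })
      ; distrib = (λ { ⟪ a , b ⟫ ⟪ c , d ⟫ ⟪ e , f ⟫ → cong₂ ⟪_,_⟫ (distˡ₁ a b c d e f) (distˡ₂ a b c d e f) })
                , (λ { ⟪ a , b ⟫ ⟪ c , d ⟫ ⟪ e , f ⟫ → cong₂ ⟪_,_⟫ (distʳ₁ a b c d e f) (distʳ₂ a b c d e f) }) }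
    ; *-comm = λ { ⟪ a , b ⟫ ⟪ c , d ⟫ → cong₂ ⟪_,_⟫ (comm₁ a b c d) (comm₂ a b c d) } } }
  where
  assoc₁ : ∀ a b c d e f → (a * c - b * d) * e - (a * d + b * c - b * d) * f ≡ a * (c * e - d * f) - b * (c * f + d * e - d * f)
  assoc₁ = solve-∀
  assoc₂ : ∀ a b c d e f → (a * c - b * d) * f + (a * d + b * c - b * d) * e - (a * d + b * c - b * d) * f
           ≡ a * (c * f + d * e - d * f) + b * (c * e - d * f) - b * (c * f + d * e - d * f)
  assoc₂ = solve-∀
  idˡ₁ : ∀ a b → 1ℤ * a - 0ℤ * b ≡ a
  idˡ₁ = solve-∀
  idˡ₂ : ∀ a b → 1ℤ * b + 0ℤ * a - 0ℤ * b ≡ b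
  idˡ₂ = solve-∀
  idʳ₁ : ∀ a b → a * 1ℤ - b * 0ℤ ≡ a
  idʳ₁ = solve-∀
  idʳ₂ : ∀ a b → a * 0ℤ + b * 1ℤ - b * 0ℤ ≡ b
  idʳ₂ = solve-∀
  distˡ₁ : ∀ a b c d e f → a * (c + e) - b * (d + f) ≡ a * c - b * d + (a * e - b * f)
  distˡ₁ = solve-∀
  distˡ₂ : ∀ a b c d e f → a * (d + f) + b * (c + e) - b * (d + f) ≡ a * d + b * c - b * d + (a * f + b * e - b * f)
  distˡ₂ = solve-∀
  distʳ₁ : ∀ a b c d e f → (c + e) * a - (d + f) * b ≡ c * a - d * b + (e * a - f * b)
  distʳ₁ = solve-∀
  distʳ₂ : ∀ a b c d e f → (c + e) * b + (d + f) * a - (d + f) * b ≡ c * b + d * a - d * b + (e * b + f * a - f * b)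
  distʳ₂ = solve-∀
  comm₁ : ∀ a b c d → a * c - b * d ≡ c * a - d * b
  comm₁ = solve-∀
  comm₂ : ∀ a b c d → a * d + b * c - b * d ≡ c * b + d * a - d * b
  comm₂ = solve-∀

open CommutativeRing 𝔼-ring public using ()
  renaming (*-identityˡ to ⊗-identityˡ; *-identityʳ to ⊗-identityʳ; *-assoc to ⊗-assoc; *-comm to ⊗-comm;
            zeroˡ to ⊗-zeroˡ; zeroʳ to ⊗-zeroʳ)

infix 4 _≋ᴱ_⟨_⟩
record _≋ᴱ_⟨_⟩ (x y : 𝔼) (q : ℕ) : Set where
  constructor modᴱ
  field
    re≋ : re x ≋ re y ⟨ q ⟩
    im≋ : im x ≋ im y ⟨ q ⟩
open _≋ᴱ_⟨_⟩ public

module _ {q : ℕ} where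

  ≡⇒≋ᴱ : ∀ {x y} → x ≡ y → x ≋ᴱ y ⟨ q ⟩
  ≡⇒≋ᴱ refl = modᴱ ≋-refl ≋-refl

  ≋ᴱ-isEquivalence : IsEquivalence (_≋ᴱ_⟨ q ⟩)
  ≋ᴱ-isEquivalence = record
    { refl  = ≡⇒≋ᴱ refl
    ; sym   = λ (modᴱ h k) → modᴱ (≋-sym h) (≋-sym k)
    ; trans = λ (modᴱ h k) (modᴱ h′ k′) → modᴱ (≋-trans h h′) (≋-trans k k′) }

  ≋ᴱ-⊕ : ∀ {x y z w} → x ≋ᴱ y ⟨ q ⟩ → z ≋ᴱ w ⟨ q ⟩ → x ⊕ z ≋ᴱ y ⊕ w ⟨ q ⟩
  ≋ᴱ-⊕ (modᴱ h k) (modᴱ h′ k′) = modᴱ (≋-+ h h′) (≋-+ k k′)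

  ≋ᴱ-⊗ : ∀ {x y z w} → x ≋ᴱ y ⟨ q ⟩ → z ≋ᴱ w ⟨ q ⟩ → x ⊗ z ≋ᴱ y ⊗ w ⟨ q ⟩
  ≋ᴱ-⊗ (modᴱ h k) (modᴱ h′ k′) =
    modᴱ (≋-+ (≋-* h h′) (≋-neg (≋-* k k′))) (≋-+ (≋-+ (≋-* h k′) (≋-* k h′)) (≋-neg (≋-* k k′)))

  ≋ᴱ-⊖ : ∀ {x y} → x ≋ᴱ y ⟨ q ⟩ → ⊖ x ≋ᴱ ⊖ y ⟨ q ⟩
  ≋ᴱ-⊖ (modᴱ h k) = modᴱ (≋-neg h) (≋-neg k)

  conj-≋ : ∀ {x y} → x ≋ᴱ y ⟨ q ⟩ → conj x ≋ᴱ conj y ⟨ q ⟩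
  conj-≋ (modᴱ h k) = modᴱ (≋-+ h (≋-neg k)) (≋-neg k)

≋ᴱ0⇒≡ : ∀ {x y} → x ≋ᴱ y ⟨ 0 ⟩ → x ≡ y
≋ᴱ0⇒≡ (modᴱ h k) = cong₂ ⟪_,_⟫ (≋0⇒≡ h) (≋0⇒≡ k)

𝔼/ : ℕ → CommutativeRing 0ℓ 0ℓ
𝔼/ q = quotient 𝔼-ring (_≋ᴱ_⟨ q ⟩) ≋ᴱ-isEquivalence ≡⇒≋ᴱ ≋ᴱ-⊕ ≋ᴱ-⊗ ≋ᴱ-⊖

𝔼-solver : AlmostCommutativeRing 0ℓ 0ℓ
𝔼-solver = fromCommutativeRing 𝔼-ring λ { ⟪ + 0 , + 0 ⟫ → just refl ; _ → nothing }

⊗-interchange : ∀ x y z w → x ⊗ y ⊗ (z ⊗ w) ≡ x ⊗ z ⊗ (y ⊗ w)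
⊗-interchange = TR.solve-∀ 𝔼-solver

⊗-swap : ∀ x y z → x ⊗ (y ⊗ z) ≡ y ⊗ (x ⊗ z)
⊗-swap = TR.solve-∀ 𝔼-solver

norm-⊗ : ∀ x y → norm (x ⊗ y) ≡ norm x * norm y
norm-⊗ ⟪ a , b ⟫ ⟪ c , d ⟫ = lem a b c d
  where
  lem : ∀ a b c d → (a * c - b * d) * (a * c - b * d) - (a * c - b * d) * (a * d + b * c - b * d)
      + (a * d + b * c - b * d) * (a * d + b * c - b * d) ≡ (a * a - a * b + b * b) * (c * c - c * d + d * d)
  lem = solve-∀

conj-⊗ : ∀ x y → conj (x ⊗ y) ≡ conj x ⊗ conj y
conj-⊗ ⟪ a , b ⟫ ⟪ c , d ⟫ = cong₂ ⟪_,_⟫ (lem₁ a b c d) (lem₂ a b c d)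
  where
  lem₁ : ∀ a b c d → a * c - b * d - (a * d + b * c - b * d) ≡ (a - b) * (c - d) - (- b) * (- d)
  lem₁ = solve-∀
  lem₂ : ∀ a b c d → - (a * d + b * c - b * d) ≡ (a - b) * (- d) + (- b) * (c - d) - (- b) * (- d)
  lem₂ = solve-∀

conj-⊕ : ∀ x y → conj (x ⊕ y) ≡ conj x ⊕ conj y
conj-⊕ ⟪ a , b ⟫ ⟪ c , d ⟫ = cong₂ ⟪_,_⟫ (lem a b c d) (ℤ.neg-distrib-+ b d)
  where
  lem : ∀ a b c d → a + c - (b + d) ≡ a - b + (c - d)
  lem = solve-∀

conj-conj : ∀ x → conj (conj x) ≡ x
conj-conj ⟪ a , b ⟫ = cong₂ ⟪_,_⟫ (lem a b) (ℤ.neg-involutive b)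
  where
  lem : ∀ a b → a - b - (- b) ≡ a
  lem = solve-∀

⊗-conj : ∀ x → x ⊗ conj x ≡ ι (norm x)
⊗-conj ⟪ a , b ⟫ = cong₂ ⟪_,_⟫ (lem₁ a b) (lem₂ a b)
  where
  lem₁ : ∀ a b → a * (a - b) - b * (- b) ≡ a * a - a * b + b * b
  lem₁ = solve-∀
  lem₂ : ∀ a b → a * (- b) + b * (a - b) - b * (- b) ≡ 0ℤ
  lem₂ = solve-∀

⊗-ι : ∀ c x → ι c ⊗ x ≡ ⟪ c * re x , c * im x ⟫
⊗-ι c ⟪ a , b ⟫ = cong₂ ⟪_,_⟫ (lem₁ a b c) (lem₂ a b c)
  where
  lem₁ : ∀ a b c → c * a - 0ℤ * b ≡ c * a
  lem₁ = solve-∀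
  lem₂ : ∀ a b c → c * b + 0ℤ * a - 0ℤ * b ≡ c * b
  lem₂ = solve-∀

-- The Frobenius endomorphism

[1+k]*[1+n]C[1+k] : ∀ n k → suc k ℕ.* (suc n C suc k) ≡ suc n ℕ.* (n C k)
[1+k]*[1+n]C[1+k] n zero = trans (ℕ.*-identityˡ _) (trans (nC1≡n (suc n)) (sym (trans (cong (suc n ℕ.*_) (nC0≡1 n)) (ℕ.*-identityʳ _))))
  where
  nC0≡1 : ∀ n → n C 0 ≡ 1
  nC0≡1 n = trans (nCk≡nC[n∸k] {0} {n} ℕ.z≤n) (nCn≡1 n)
[1+k]*[1+n]C[1+k] zero (suc k) = ℕ.*-zeroʳ (suc (suc k))
[1+k]*[1+n]C[1+k] (suc n) (suc k) = begin
  suc (suc k) ℕ.* (suc (suc n) C suc (suc k))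
    ≡⟨ cong (suc (suc k) ℕ.*_) (sym (nCk+nC[k+1]≡[n+1]C[k+1] (suc n) (suc k))) ⟩
  suc (suc k) ℕ.* ((suc n C suc k) ℕ.+ (suc n C suc (suc k)))
    ≡⟨ lem₁ k (suc n C suc k) _ ⟩
  (suc n C suc k) ℕ.+ suc k ℕ.* (suc n C suc k) ℕ.+ suc (suc k) ℕ.* (suc n C suc (suc k))
    ≡⟨ cong₂ (λ a b → (suc n C suc k) ℕ.+ a ℕ.+ b) ([1+k]*[1+n]C[1+k] n k) ([1+k]*[1+n]C[1+k] n (suc k)) ⟩
  (suc n C suc k) ℕ.+ suc n ℕ.* (n C k) ℕ.+ suc n ℕ.* (n C suc k)
    ≡⟨ lem₂ n (suc n C suc k) (n C k) (n C suc k) ⟩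
  (suc n C suc k) ℕ.+ suc n ℕ.* ((n C k) ℕ.+ (n C suc k))
    ≡⟨ cong (λ a → (suc n C suc k) ℕ.+ suc n ℕ.* a) (nCk+nC[k+1]≡[n+1]C[k+1] n k) ⟩
  suc (suc n) ℕ.* (suc n C suc k) ∎
  where
  open ≡-Reasoning
  lem₁ : ∀ k a b → suc (suc k) ℕ.* (a ℕ.+ b) ≡ a ℕ.+ suc k ℕ.* a ℕ.+ suc (suc k) ℕ.* b
  lem₁ = solveℕ-∀
  lem₂ : ∀ n a b c → a ℕ.+ suc n ℕ.* b ℕ.+ suc n ℕ.* c ≡ a ℕ.+ suc n ℕ.* (b ℕ.+ c)
  lem₂ = solveℕ-∀

-- q divides q C(q - 1, k) = (k + 1) C(q, k + 1), and k + 1 < q excludes the first factor.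
prime∣C : ∀ {q} → Prime q → ∀ k → suc k ℕ.< q → q ℕ.∣ q C suc k
prime∣C {suc q} pr k k<q with euclidsLemma (suc k) (suc q C suc k) pr
  (subst (suc q ℕ.∣_) (sym ([1+k]*[1+n]C[1+k] q k)) (ℕ.m∣m*n (q C k)))
... | inj₁ h = contradiction (ℕ.∣⇒≤ h) (ℕ.<⇒≱ k<q)
... | inj₂ h = h

HasCharacteristic : CommutativeRing 0ℓ 0ℓ → ℕ → Set
HasCharacteristic R q = SemiringMult._×_ semiring q 1# ≈ 0#
  where open CommutativeRing R using (semiring; 1#; 0#; _≈_)

module Frobenius (R : CommutativeRing 0ℓ 0ℓ) {q : ℕ} (q-prime : Prime q) (char : HasCharacteristic R q) where

  open CommutativeRing R hiding (refl; sym; trans; zero) renaming (_+_ to _+ᴿ_; _*_ to _*ᴿ_; -_ to -ᴿ_; _-_ to _-ᴿ_)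
  private module R = CommutativeRing R
  open SemiringMult semiring renaming (_×_ to _·_)
  open SemiringSum semiring using (sum; sum-init-last; sum-cong-≋; sum-replicate-zero)
  open SemiringExp semiring using () renaming (_^_ to _^ᴿ_)
  open SetoidReasoning setoid

  char-multiple : ∀ {n} x → q ℕ.∣ n → n · x ≈ 0#
  char-multiple {n} x (ℕ.divides m refl) = begin
    (m ℕ.* q) · x ≡⟨ cong (_· x) (ℕ.*-comm m q) ⟩
    (q ℕ.* m) · x ≈⟨ ×-assocˡ x q m ⟨
    q · (m · x) ≈⟨ ×-congʳ q (*-identityˡ _) ⟨
    q · (1# *ᴿ (m · x)) ≈⟨ ×-assoc-* q 1# _ ⟨
    (q · 1#) *ᴿ (m · x) ≈⟨ R.trans (*-congʳ char) (zeroˡ _) ⟩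
    0# ∎

  ^-distrib-+ : ∀ x y → (x +ᴿ y) ^ᴿ q ≈ x ^ᴿ q +ᴿ y ^ᴿ q
  ^-distrib-+ x y = go q-prime (λ k → prime∣C q-prime k) (λ {n} → char-multiple {n})
    where
    open Binomial commutativeSemiring using (binomialTerm; theorem)
    -- `q` is generalised so that it can be matched as `suc n`, the shape in which both end terms
    -- split off the binomial sum.
    go : ∀ {q} → Prime q → (∀ k → suc k ℕ.< q → q ℕ.∣ q C suc k) → (∀ {n} x → q ℕ.∣ n → n · x ≈ 0#) →
         (x +ᴿ y) ^ᴿ q ≈ x ^ᴿ q +ᴿ y ^ᴿ q
    go {zero} pr _ _ = contradiction pr ¬prime[0]
    go {suc n} pr ∣C char = begin
      (x +ᴿ y) ^ᴿ suc n ≈⟨ theorem (suc n) x y ⟩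
      t zero +ᴿ sum (t ∘ suc) ≈⟨ +-cong first (sum-init-last (t ∘ suc)) ⟩
      y ^ᴿ suc n +ᴿ (sum (t ∘ suc ∘ inject₁) +ᴿ t (suc (fromℕ n)))
        ≈⟨ +-congˡ (+-cong (R.trans (sum-cong-≋ middle) (sum-replicate-zero n)) last) ⟩
      y ^ᴿ suc n +ᴿ (0# +ᴿ x ^ᴿ suc n) ≈⟨ R.trans (+-congˡ (+-identityˡ _)) (+-comm _ _) ⟩
      x ^ᴿ suc n +ᴿ y ^ᴿ suc n ∎
      where
      t : Fin (suc (suc n)) → Carrier
      t = binomialTerm x y (suc n)
      first : t zero ≈ y ^ᴿ suc n
      first = R.trans (×-congˡ (trans (nCk≡nC[n∸k] {0} {suc n} ℕ.z≤n) (nCn≡1 (suc n)))) (R.trans (×-homo-1 _) (*-identityˡ _))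
      middle : ∀ i → t (suc (inject₁ i)) ≈ 0#
      middle i = char {suc n C suc (toℕ (inject₁ i))} _
        (subst (λ k → suc n ℕ.∣ suc n C suc k) (sym (Fin.toℕ-inject₁ i)) (∣C (toℕ i) (ℕ.s<s (Fin.toℕ<n i))))
      last : t (suc (fromℕ n)) ≈ x ^ᴿ suc n
      last = R.trans (R.reflexive (cong (λ k → (suc n C suc k) · (x ^ᴿ suc k *ᴿ y ^ᴿ (n ∸ k))) (Fin.toℕ-fromℕ n)))
        (R.trans (R.reflexive (cong₂ (λ c d → c · (x ^ᴿ suc n *ᴿ y ^ᴿ d)) (nCn≡1 (suc n)) (ℕ.n∸n≡0 n)))
        (R.trans (×-homo-1 _) (*-identityʳ _)))

  ^-distrib-sum : ∀ {n} (t : Fin n → Carrier) → sum t ^ᴿ q ≈ sum (λ i → t i ^ᴿ q)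
  ^-distrib-sum {zero} t = zero^ q-prime
    where
    zero^ : ∀ {q} → Prime q → 0# ^ᴿ q ≈ 0#
    zero^ {zero}  pr = contradiction pr ¬prime[0]
    zero^ {suc _} pr = zeroˡ _
  ^-distrib-sum {suc n} t = R.trans (^-distrib-+ _ _) (+-congˡ (^-distrib-sum (t ∘ suc)))

-- Sums over residues and the group ring

residue : ∀ (ℓ : ℕ) .{{_ : NonZero ℓ}} → ℤ → Fin ℓ
residue ℓ x = fromℕ< (n%ℕd<d x ℓ)

residue-≋ : ∀ ℓ .{{_ : NonZero ℓ}} x → + toℕ (residue ℓ x) ≋ x ⟨ ℓ ⟩
residue-≋ ℓ x = ≋-sym (mod (divides (x /ℕ ℓ) eq))
  where
  lem : ∀ r s → r + s - r ≡ s
  lem = solve-∀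
  eq : x - + toℕ (residue ℓ x) ≡ x /ℕ ℓ * + ℓ
  eq = trans (cong₂ (λ a b → a - + b) (a≡a%ℕn+[a/ℕn]*n x ℓ) (Fin.toℕ-fromℕ< (n%ℕd<d x ℓ))) (lem (+ (x %ℕ ℓ)) _)

toℕ-≋-injective : ∀ {ℓ} {i j : Fin ℓ} → + toℕ i ≋ + toℕ j ⟨ ℓ ⟩ → i ≡ j
toℕ-≋-injective {ℓ} {i} {j} (mod h) with ∣ + toℕ i - + toℕ j ∣ in eq | ∣⇒∣ᵤ h
... | zero  | _ = Fin.toℕ-injective (ℤ.+-injective (ℤ.i-j≡0⇒i≡j _ _ (ℤ.∣i∣≡0⇒i≡0 eq)))
... | suc k | d = contradiction (ℕ.∣⇒≤ d) (ℕ.<⇒≱ (subst (ℕ._< ℓ) eq bound))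
  where
  bound : ∣ + toℕ i - + toℕ j ∣ ℕ.< ℓ
  bound = ℕ.≤-<-trans (subst (λ z → ∣ z ∣ ℕ.≤ toℕ i ℕ.⊔ toℕ j) (sym (ℤ.m-n≡m⊖n (toℕ i) (toℕ j))) (ℤ.∣m⊝n∣≤m⊔n (toℕ i) (toℕ j)))
    (ℕ.⊔-lub (Fin.toℕ<n i) (Fin.toℕ<n j))

module ResidueSum (K : CommutativeRing 0ℓ 0ℓ) (ℓ : ℕ) {{nz : NonZero ℓ}} where

  open CommutativeRing K hiding (refl; sym; trans; zero) renaming (_+_ to _+ᴿ_; _*_ to _*ᴿ_; -_ to -ᴿ_; _-_ to _-ᴿ_)
  private module K = CommutativeRing K
  open SemiringSum semiring using (sum; sum-permute; sum-replicate-zero)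
  open SemiringSum semiring using (sum-cong-≋)

  sum-cong : ∀ {n} {f g : Fin n → Carrier} → (∀ i → f i ≈ g i) → sum f ≈ sum g
  sum-cong eq = sum-cong-≋ eq

  Periodic : (ℤ → Carrier) → Set
  Periodic h = ∀ {x y} → x ≋ y ⟨ ℓ ⟩ → h x ≈ h y

  Σ : (ℤ → Carrier) → Carrier
  Σ h = sum {ℓ} λ i → h (+ toℕ i)

  Σ-cong : ∀ {g h : ℤ → Carrier} → (∀ x → g x ≈ h x) → Σ g ≈ Σ h
  Σ-cong {g} {h} eq = sum-cong {ℓ} {λ i → g (+ toℕ i)} λ i → eq (+ toℕ i)

  Σ-reindex : ∀ {h} → Periodic h → ∀ (σ τ : ℤ → ℤ) →
    (∀ {x y} → x ≋ y ⟨ ℓ ⟩ → σ x ≋ σ y ⟨ ℓ ⟩) → (∀ {x y} → x ≋ y ⟨ ℓ ⟩ → τ x ≋ τ y ⟨ ℓ ⟩) →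
    (∀ x → σ (τ x) ≋ x ⟨ ℓ ⟩) → (∀ x → τ (σ x) ≋ x ⟨ ℓ ⟩) → Σ (h ∘ σ) ≈ Σ h
  Σ-reindex {h} per σ τ σ-cong τ-cong στ τσ = K.sym (K.trans
    (sum-permute (λ i → h (+ toℕ i)) (Perm.permutation f g (λ i → toℕ-≋-injective (inverse σ τ σ-cong στ i)) (λ i → toℕ-≋-injective (inverse τ σ τ-cong τσ i))))
    (sum-cong {ℓ} {λ i → h (+ toℕ (f i))} λ i → per (residue-≋ ℓ (σ (+ toℕ i)))))
    where
    f g : Fin ℓ → Fin ℓ
    f i = residue ℓ (σ (+ toℕ i))
    g i = residue ℓ (τ (+ toℕ i))
    inverse : ∀ (σ τ : ℤ → ℤ) → (∀ {x y} → x ≋ y ⟨ ℓ ⟩ → σ x ≋ σ y ⟨ ℓ ⟩) → (∀ x → σ (τ x) ≋ x ⟨ ℓ ⟩) →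
      ∀ i → + toℕ (residue ℓ (σ (+ toℕ (residue ℓ (τ (+ toℕ i)))))) ≋ + toℕ i ⟨ ℓ ⟩
    inverse σ τ σ-cong στ i = ≋-trans (residue-≋ ℓ _) (≋-trans (σ-cong (residue-≋ ℓ _)) (στ _))

  Σ-shift : ∀ {h} → Periodic h → ∀ c → Σ (λ x → h (x + c)) ≈ Σ h
  Σ-shift {h} per c = Σ-reindex {h} per (_+ c) (_- c) (≋-+ʳ c) (≋-+ʳ (- c))
    (λ x → ≡⇒≋ (lem₁ x c)) (λ x → ≡⇒≋ (lem₂ x c))
    where
    lem₁ : ∀ x c → x - c + c ≡ x
    lem₁ = solve-∀
    lem₂ : ∀ x c → x + c - c ≡ x
    lem₂ = solve-∀

  Σ-scale : ∀ {h} → Periodic h → ∀ {c d} → c * d ≋ 1ℤ ⟨ ℓ ⟩ → Σ (λ x → h (c * x)) ≈ Σ h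
  Σ-scale {h} per {c} {d} cd = Σ-reindex {h} per (c *_) (d *_) (≋-*ˡ c) (≋-*ˡ d)
    (λ x → ≋-trans (≡⇒≋ (lem₁ c d x)) (≋-trans (≋-*ʳ x cd) (≡⇒≋ (ℤ.*-identityˡ x))))
    (λ x → ≋-trans (≡⇒≋ (lem₂ c d x)) (≋-trans (≋-*ʳ x cd) (≡⇒≋ (ℤ.*-identityˡ x))))
    where
    lem₁ : ∀ c d x → c * (d * x) ≡ c * d * x
    lem₁ = solve-∀
    lem₂ : ∀ c d x → d * (c * x) ≡ c * d * x
    lem₂ = solve-∀

  δ : ℤ → Carrier
  δ x with + ℓ ∣? x
  ... | yes _ = 1#
  ... | no  _ = 0#

  δ-zero : ∀ {x} → + ℓ ∣ x → δ x ≈ 1#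
  δ-zero {x} h with + ℓ ∣? x
  ... | yes _ = K.refl
  ... | no ¬h = contradiction h ¬h

  δ-nonzero : ∀ {x} → ¬ (+ ℓ ∣ x) → δ x ≈ 0#
  δ-nonzero {x} ¬h with + ℓ ∣? x
  ... | yes h = contradiction h ¬h
  ... | no _  = K.refl

  δ-periodic : Periodic δ
  δ-periodic {x} {y} e with + ℓ ∣? y
  ... | yes h = δ-zero (≋-∣ e h)
  ... | no ¬h = δ-nonzero (¬h ∘ ≋-∣ (≋-sym e))

  Σ-δ : ∀ (h : ℤ → Carrier) → Σ (λ x → h x *ᴿ δ x) ≈ h 0ℤ
  Σ-δ h = go ℓ {{nz}} δ-zero δ-nonzero
    where
    go : ∀ n {{_ : NonZero n}} → (∀ {x} → + n ∣ x → δ x ≈ 1#) → (∀ {x} → ¬ (+ n ∣ x) → δ x ≈ 0#) →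
         sum {n} (λ i → h (+ toℕ i) *ᴿ δ (+ toℕ i)) ≈ h 0ℤ
    go (suc n) δ0 δ1 = K.trans (+-cong (K.trans (*-congˡ (δ0 (divides 0ℤ refl))) (*-identityʳ _))
      (K.trans (sum-cong {n} {λ i → h (+ toℕ (suc i)) *ᴿ δ (+ toℕ (suc i))} λ i → K.trans (*-congˡ (δ1 λ d → ℕ.<⇒≱ (ℕ.s<s (Fin.toℕ<n i)) (ℕ.∣⇒≤ (∣⇒∣ᵤ d)))) (zeroʳ _)) (sum-replicate-zero n)))
      (+-identityʳ _)

  Σ-δ-at : ∀ {h} → Periodic h → ∀ c → Σ (λ x → h x *ᴿ δ (x - c)) ≈ h c
  Σ-δ-at {h} per c = K.trans (K.sym (Σ-shift {λ x → h x *ᴿ δ (x - c)} (λ e → *-cong (per e) (δ-periodic (≋-+ʳ (- c) e))) c))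
    (K.trans (Σ-cong {λ x → h (x + c) *ᴿ δ (x + c - c)} λ x → *-congˡ {h (x + c)} (δ-periodic (≡⇒≋ (lem x c))))
    (K.trans (Σ-δ (λ x → h (x + c))) (K.reflexive (cong h (ℤ.+-identityˡ c)))))
    where
    lem : ∀ x c → x + c - c ≡ x
    lem = solve-∀

-- The group ring K[ℤ/ℓ], presented by expressions acting on ℓ-periodic functions
-- ℤ → K: T a translates by a, and two expressions are equal if they act equally.
module GroupRing (K : CommutativeRing 0ℓ 0ℓ) (ℓ : ℕ) {{nz : NonZero ℓ}} where

  open CommutativeRing K hiding (refl; sym; trans; zero) renaming (_+_ to _+ᴿ_; _*_ to _*ᴿ_; -_ to -ᴿ_; _-_ to _-ᴿ_)
  private module K = CommutativeRing K
  open SemiringSum semiring using (sum; *-distribˡ-sum; *-distribʳ-sum; ∑-comm)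
  open ResidueSum K ℓ

  infixl 6 _+ₒ_
  infixl 7 _*ₒ_
  infix  8 -ₒ_

  -- With syntactic expressions, associativity and right distributivity hold by computation and
  -- commutativity is a structural induction; arbitrary operators on functions would not commute.
  -- Convolution is then needed only to multiply the elements given by coefficients.
  data Op : Set where
    scalar  : Carrier → Op
    T       : ℤ → Op
    _+ₒ_ _*ₒ_ : Op → Op → Op
    -ₒ_     : Op → Op

  ⟦_⟧ : Op → (ℤ → Carrier) → (ℤ → Carrier)
  ⟦ scalar c ⟧ f x = c *ᴿ f x
  ⟦ T a ⟧ f x = f (x + a)
  ⟦ u +ₒ v ⟧ f x = ⟦ u ⟧ f x +ᴿ ⟦ v ⟧ f x
  ⟦ u *ₒ v ⟧ f x = ⟦ u ⟧ (⟦ v ⟧ f) x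
  ⟦ -ₒ u ⟧ f x = -ᴿ ⟦ u ⟧ f x

  ⟦⟧-cong : ∀ u {f g} → (∀ x → f x ≈ g x) → ∀ x → ⟦ u ⟧ f x ≈ ⟦ u ⟧ g x
  ⟦⟧-cong (scalar c) eq x = *-congˡ (eq x)
  ⟦⟧-cong (T a) eq x = eq (x + a)
  ⟦⟧-cong (u +ₒ v) eq x = +-cong (⟦⟧-cong u eq x) (⟦⟧-cong v eq x)
  ⟦⟧-cong (u *ₒ v) eq x = ⟦⟧-cong u (⟦⟧-cong v eq) x
  ⟦⟧-cong (-ₒ u) eq x = -‿cong (⟦⟧-cong u eq x)

  ⟦⟧-periodic : ∀ u {f} → Periodic f → Periodic (⟦ u ⟧ f)
  ⟦⟧-periodic (scalar c) per e = *-congˡ (per e)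
  ⟦⟧-periodic (T a) per e = per (≋-+ʳ a e)
  ⟦⟧-periodic (u +ₒ v) per e = +-cong (⟦⟧-periodic u per e) (⟦⟧-periodic v per e)
  ⟦⟧-periodic (u *ₒ v) per = ⟦⟧-periodic u (⟦⟧-periodic v per)
  ⟦⟧-periodic (-ₒ u) per e = -‿cong (⟦⟧-periodic u per e)

  private
    module RP = RingProperties ring

    +-interchange : ∀ a b c d → (a +ᴿ b) +ᴿ (c +ᴿ d) ≈ (a +ᴿ c) +ᴿ (b +ᴿ d)
    +-interchange a b c d = K.trans (+-assoc a b (c +ᴿ d)) (K.trans (+-congˡ (K.trans (K.sym (+-assoc b c d))
      (K.trans (+-congʳ (+-comm b c)) (+-assoc c b d)))) (K.sym (+-assoc a c (b +ᴿ d))))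

    *-swap : ∀ a b c → a *ᴿ (b *ᴿ c) ≈ b *ᴿ (a *ᴿ c)
    *-swap a b c = K.trans (K.sym (*-assoc a b c)) (K.trans (*-congʳ (*-comm a b)) (*-assoc b a c))

    neg-+ : ∀ a b → -ᴿ (a +ᴿ b) ≈ -ᴿ a +ᴿ -ᴿ b
    neg-+ a b = K.sym (RP.-‿+-comm a b)

  ⟦⟧-+ : ∀ u f g x → ⟦ u ⟧ (λ y → f y +ᴿ g y) x ≈ ⟦ u ⟧ f x +ᴿ ⟦ u ⟧ g x
  ⟦⟧-+ (scalar c) f g x = distribˡ c (f x) (g x)
  ⟦⟧-+ (T a) f g x = K.refl
  ⟦⟧-+ (u +ₒ v) f g x = K.trans (+-cong (⟦⟧-+ u f g x) (⟦⟧-+ v f g x)) (+-interchange _ _ _ _)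
  ⟦⟧-+ (u *ₒ v) f g x = K.trans (⟦⟧-cong u (⟦⟧-+ v f g) x) (⟦⟧-+ u (⟦ v ⟧ f) (⟦ v ⟧ g) x)
  ⟦⟧-+ (-ₒ u) f g x = K.trans (-‿cong (⟦⟧-+ u f g x)) (neg-+ _ _)

  ⟦⟧-* : ∀ u c f x → ⟦ u ⟧ (λ y → c *ᴿ f y) x ≈ c *ᴿ ⟦ u ⟧ f x
  ⟦⟧-* (scalar d) c f x = *-swap d c (f x)
  ⟦⟧-* (T a) c f x = K.refl
  ⟦⟧-* (u +ₒ v) c f x = K.trans (+-cong (⟦⟧-* u c f x) (⟦⟧-* v c f x)) (K.sym (distribˡ c _ _))
  ⟦⟧-* (u *ₒ v) c f x = K.trans (⟦⟧-cong u (⟦⟧-* v c f) x) (⟦⟧-* u c (⟦ v ⟧ f) x)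
  ⟦⟧-* (-ₒ u) c f x = K.trans (-‿cong (⟦⟧-* u c f x)) (RP.-‿distribʳ-* c _)

  ⟦⟧-neg : ∀ u f x → ⟦ u ⟧ (λ y → -ᴿ f y) x ≈ -ᴿ ⟦ u ⟧ f x
  ⟦⟧-neg (scalar c) f x = K.sym (RP.-‿distribʳ-* c (f x))
  ⟦⟧-neg (T a) f x = K.refl
  ⟦⟧-neg (u +ₒ v) f x = K.trans (+-cong (⟦⟧-neg u f x) (⟦⟧-neg v f x)) (RP.-‿+-comm _ _)
  ⟦⟧-neg (u *ₒ v) f x = K.trans (⟦⟧-cong u (⟦⟧-neg v f) x) (⟦⟧-neg u (⟦ v ⟧ f) x)
  ⟦⟧-neg (-ₒ u) f x = -‿cong (⟦⟧-neg u f x)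

  ⟦⟧-shift : ∀ u a f x → ⟦ u ⟧ (λ y → f (y + a)) x ≈ ⟦ u ⟧ f (x + a)
  ⟦⟧-shift (scalar c) a f x = K.refl
  ⟦⟧-shift (T b) a f x = K.reflexive (cong f (lem x a b))
    where
    lem : ∀ x a b → x + b + a ≡ x + a + b
    lem = solve-∀
  ⟦⟧-shift (u +ₒ v) a f x = +-cong (⟦⟧-shift u a f x) (⟦⟧-shift v a f x)
  ⟦⟧-shift (u *ₒ v) a f x = K.trans (⟦⟧-cong u (⟦⟧-shift v a f) x) (⟦⟧-shift u a (⟦ v ⟧ f) x)
  ⟦⟧-shift (-ₒ u) a f x = -‿cong (⟦⟧-shift u a f x)

  -- By induction on `u` it is enough to move a scalar or a translation past `v`, which is linearity
  -- and translation invariance.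
  ⟦⟧-comm : ∀ u v f x → ⟦ u ⟧ (⟦ v ⟧ f) x ≈ ⟦ v ⟧ (⟦ u ⟧ f) x
  ⟦⟧-comm (scalar c) v f x = K.sym (⟦⟧-* v c f x)
  ⟦⟧-comm (T a) v f x = K.sym (⟦⟧-shift v a f x)
  ⟦⟧-comm (u +ₒ u′) v f x = K.trans (+-cong (⟦⟧-comm u v f x) (⟦⟧-comm u′ v f x)) (K.sym (⟦⟧-+ v (⟦ u ⟧ f) (⟦ u′ ⟧ f) x))
  ⟦⟧-comm (u *ₒ u′) v f x = K.trans (⟦⟧-cong u (⟦⟧-comm u′ v f) x) (⟦⟧-comm u v (⟦ u′ ⟧ f) x)
  ⟦⟧-comm (-ₒ u) v f x = K.trans (-‿cong (⟦⟧-comm u v f x)) (K.sym (⟦⟧-neg v (⟦ u ⟧ f) x))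

  infix 4 _≈ₒ_
  record _≈ₒ_ (u v : Op) : Set where
    constructor act
    field
      unact : ∀ {f} → Periodic f → ∀ x → ⟦ u ⟧ f x ≈ ⟦ v ⟧ f x
  open _≈ₒ_

  Op-ring : CommutativeRing 0ℓ 0ℓ
  Op-ring = record
    { Carrier = Op ; _≈_ = _≈ₒ_ ; _+_ = _+ₒ_ ; _*_ = _*ₒ_ ; -_ = -ₒ_ ; 0# = scalar 0# ; 1# = T 0ℤ
    ; isCommutativeRing = record
      { isRing = record
        { +-isAbelianGroup = record
          { isGroup = record
            { isMonoid = record
              { isSemigroup = record
                { isMagma = record
                  { isEquivalence = record
                    { refl = act λ per x → K.refl
                    ; sym = λ h → act λ per x → K.sym (unact h per x)
                    ; trans = λ h k → act λ per x → K.trans (unact h per x) (unact k per x) }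
                  ; ∙-cong = λ h k → act λ per x → +-cong (unact h per x) (unact k per x) }
                ; assoc = λ u v w → act λ per x → +-assoc _ _ _ }
              ; identity = (λ u → act λ per x → K.trans (+-congʳ (zeroˡ _)) (+-identityˡ _))
                         , (λ u → act λ per x → K.trans (+-congˡ (zeroˡ _)) (+-identityʳ _)) }
            ; inverse = (λ u → act λ per x → K.trans (proj₁ -‿inverse _) (K.sym (zeroˡ _)))
                      , (λ u → act λ per x → K.trans (proj₂ -‿inverse _) (K.sym (zeroˡ _)))
            ; ⁻¹-cong = λ h → act λ per x → -‿cong (unact h per x) }
          ; comm = λ u v → act λ per x → +-comm _ _ }
        ; *-cong = λ {u} {u′} {v} {v′} h k → act λ per x →
            K.trans (unact h (⟦⟧-periodic v per) x) (⟦⟧-cong u′ (unact k per) x)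
        ; *-assoc = λ u v w → act λ per x → K.refl
        ; *-identity = (λ u → act λ {f} per x → ⟦⟧-periodic u per (≡⇒≋ (ℤ.+-identityʳ x)))
                     , (λ u → act λ {f} per x → ⟦⟧-cong u (λ y → per (≡⇒≋ (ℤ.+-identityʳ y))) x)
        ; distrib = (λ u v w → act λ {f} per x → ⟦⟧-+ u (⟦ v ⟧ f) (⟦ w ⟧ f) x)
                  , (λ u v w → act λ per x → K.refl) }
      ; *-comm = λ u v → act λ {f} per x → ⟦⟧-comm u v f x } }

  module O = CommutativeRing Op-ring
  open SemiringSum O.semiring using () renaming (sum to sumₒ; sum-cong-≋ to sumₒ-cong)
  open SemiringExp O.semiring using () renaming (_^_ to _^ₒ_; ^-congˡ to ^ₒ-congˡ)
  open SemiringExp semiring using () renaming (_^_ to _^ᴿ_)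

  element : (ℤ → Carrier) → Op
  element φ = sumₒ {ℓ} λ i → scalar (φ (+ toℕ i)) *ₒ T (+ toℕ i)

  ⟦sum⟧ : ∀ {n} (t : Fin n → Op) f x → ⟦ sumₒ t ⟧ f x ≈ sum (λ i → ⟦ t i ⟧ f x)
  ⟦sum⟧ {zero}  t f x = zeroˡ _
  ⟦sum⟧ {suc n} t f x = +-congˡ (⟦sum⟧ (t ∘ suc) f x)

  ⟦element⟧ : ∀ φ f x → ⟦ element φ ⟧ f x ≈ Σ (λ a → φ a *ᴿ f (x + a))
  ⟦element⟧ φ = ⟦sum⟧ {ℓ} (λ i → scalar (φ (+ toℕ i)) *ₒ T (+ toℕ i))

  element-cong : ∀ {φ ψ} → (∀ a → φ a ≈ ψ a) → element φ ≈ₒ element ψ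
  element-cong {φ} {ψ} eq = act λ {f} per x → K.trans (⟦element⟧ φ f x)
    (K.trans (Σ-cong {λ a → φ a *ᴿ f (x + a)} λ a → *-congʳ (eq a)) (K.sym (⟦element⟧ ψ f x)))

  -- The action on `δ`, evaluated at - c, reads off the coefficient at c.
  element-injective : ∀ {φ ψ} → Periodic φ → Periodic ψ → element φ ≈ₒ element ψ → ∀ c → φ c ≈ ψ c
  element-injective {φ} {ψ} perφ perψ eq c = K.trans (K.sym (value φ perφ)) (K.trans (unact eq δ-periodic (- c)) (value ψ perψ))
    where
    value : ∀ φ → Periodic φ → ⟦ element φ ⟧ δ (- c) ≈ φ c
    value φ per = K.trans (⟦element⟧ φ δ (- c))
      (K.trans (Σ-cong {λ a → φ a *ᴿ δ (- c + a)} λ a → *-congˡ (K.reflexive (cong δ (ℤ.+-comm (- c) a)))) (Σ-δ-at {φ} per c))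

  scalar-element : ∀ c φ → scalar c *ₒ element φ ≈ₒ element (λ a → c *ᴿ φ a)
  scalar-element c φ = act λ {f} per x → K.trans (*-congˡ (⟦element⟧ φ f x))
    (K.trans (*-distribˡ-sum {ℓ} c _) (K.trans (Σ-cong {λ a → c *ᴿ (φ a *ᴿ f (x + a))} λ a → K.sym (*-assoc c (φ a) _))
    (K.sym (⟦element⟧ (λ a → c *ᴿ φ a) f x))))

  _⋆_ : (ℤ → Carrier) → (ℤ → Carrier) → ℤ → Carrier
  (φ ⋆ ψ) c = Σ λ a → φ a *ᴿ ψ (c - a)

  element-* : ∀ φ ψ → Periodic ψ → element φ *ₒ element ψ ≈ₒ element (φ ⋆ ψ)
  element-* φ ψ perψ = act λ {f} per x → begin
    ⟦ element φ ⟧ (⟦ element ψ ⟧ f) x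
      ≈⟨ ⟦element⟧ φ (⟦ element ψ ⟧ f) x ⟩
    Σ (λ a → φ a *ᴿ ⟦ element ψ ⟧ f (x + a))
      ≈⟨ Σ-cong {λ a → φ a *ᴿ ⟦ element ψ ⟧ f (x + a)} (λ a → *-congˡ (inner per x a)) ⟩
    Σ (λ a → φ a *ᴿ Σ (λ c → ψ (c - a) *ᴿ f (x + c)))
      ≈⟨ Σ-cong {λ a → φ a *ᴿ Σ (λ c → ψ (c - a) *ᴿ f (x + c))} (λ a → K.trans (*-distribˡ-sum {ℓ} (φ a) _)
           (Σ-cong {λ c → φ a *ᴿ (ψ (c - a) *ᴿ f (x + c))} λ c → K.sym (*-assoc _ _ _))) ⟩
    Σ (λ a → Σ (λ c → φ a *ᴿ ψ (c - a) *ᴿ f (x + c)))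
      ≈⟨ ∑-comm {ℓ} {ℓ} (λ i j → φ (+ toℕ i) *ᴿ ψ (+ toℕ j - + toℕ i) *ᴿ f (x + + toℕ j)) ⟩
    Σ (λ c → Σ (λ a → φ a *ᴿ ψ (c - a) *ᴿ f (x + c)))
      ≈⟨ Σ-cong {λ c → (φ ⋆ ψ) c *ᴿ f (x + c)} (λ c → *-distribʳ-sum {ℓ} (f (x + c)) _) ⟨
    Σ (λ c → (φ ⋆ ψ) c *ᴿ f (x + c))
      ≈⟨ ⟦element⟧ (φ ⋆ ψ) f x ⟨
    ⟦ element (φ ⋆ ψ) ⟧ f x ∎
    where
    open SetoidReasoning setoid
    lem : ∀ x a c → x + a + (c - a) ≡ x + c
    lem = solve-∀
    inner : ∀ {f} → Periodic f → ∀ x a → ⟦ element ψ ⟧ f (x + a) ≈ Σ (λ c → ψ (c - a) *ᴿ f (x + c))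
    inner {f} per x a = K.trans (⟦element⟧ ψ f (x + a)) (K.trans
      (K.sym (Σ-shift {λ b → ψ b *ᴿ f (x + a + b)} (λ e → *-cong (perψ e) (per (≋-+ˡ (x + a) e))) (- a)))
      (Σ-cong {λ c → ψ (c - a) *ᴿ f (x + a + (c - a))} λ c → *-congˡ (K.reflexive (cong f (lem x a c)))))

  scalar-* : ∀ c d → scalar c *ₒ scalar d ≈ₒ scalar (c *ᴿ d)
  scalar-* c d = act λ per x → K.sym (*-assoc c d _)

  scalar-cong : ∀ {c d} → c ≈ d → scalar c ≈ₒ scalar d
  scalar-cong eq = act λ per x → *-congʳ eq

  scalar-1 : scalar 1# ≈ₒ T 0ℤ
  scalar-1 = act λ per x → K.trans (*-identityˡ _) (per (≡⇒≋ (sym (ℤ.+-identityʳ x))))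

  scalar-^ : ∀ c n → scalar c ^ₒ n ≈ₒ scalar (c ^ᴿ n)
  scalar-^ c zero    = O.sym scalar-1
  scalar-^ c (suc n) = O.trans (O.*-congˡ {scalar c} (scalar-^ c n)) (scalar-* c _)

  T-^ : ∀ a n → T a ^ₒ n ≈ₒ T (+ n * a)
  T-^ a zero    = act λ per x → K.refl
  T-^ a (suc n) = O.trans (O.*-congˡ {T a} (T-^ a n)) (act λ {f} per x → K.reflexive (cong f (lem x (+ n) a)))
    where
    lem : ∀ x n a → x + a + n * a ≡ x + (1ℤ + n) * a
    lem = solve-∀

  module _ {q : ℕ} (q-prime : Prime q) (char : HasCharacteristic K q) where

    private
      open SemiringMult O.semiring using () renaming (_×_ to _·ₒ_)
      open SemiringMult semiring using () renaming (_×_ to _·_)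

      ⟦·⟧ : ∀ n {f} → Periodic f → ∀ x → ⟦ n ·ₒ T 0ℤ ⟧ f x ≈ (n · 1#) *ᴿ f x
      ⟦·⟧ zero    per x = K.refl
      ⟦·⟧ (suc n) per x = K.trans (+-cong (K.trans (per (≡⇒≋ (ℤ.+-identityʳ x))) (K.sym (*-identityˡ _))) (⟦·⟧ n per x))
        (K.sym (distribʳ _ _ _))

      charₒ : HasCharacteristic Op-ring q
      charₒ = act λ per x → K.trans (⟦·⟧ q per x) (*-congʳ char)

      open Frobenius Op-ring q-prime charₒ using (^-distrib-sum)
      open CommSemiringExp O.commutativeSemiring using () renaming (^-distrib-* to ^ₒ-distrib-*)

    -- Frobenius is additive, raises coefficients to the power q and sends `T a` to `T (q a)`.
    -- Reindexing by the inverse `q′` of q modulo ℓ restores the form `element`.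
    element-^ : ∀ {φ} → Periodic φ → ∀ {q′} → + q * q′ ≋ 1ℤ ⟨ ℓ ⟩ → element φ ^ₒ q ≈ₒ element (λ a → φ (q′ * a) ^ᴿ q)
    element-^ {φ} perφ {q′} qq′ = O.trans (^-distrib-sum {ℓ} _) (O.trans
      (sumₒ-cong {ℓ} λ i → O.trans (^ₒ-distrib-* (scalar (φ (+ toℕ i))) (T (+ toℕ i)) q) (O.*-cong (scalar-^ _ q) (T-^ _ q)))
      (act λ {f} per x → K.trans (⟦sum⟧ {ℓ} (λ i → scalar (φ (+ toℕ i) ^ᴿ q) *ₒ T (+ q * + toℕ i)) f x) (K.trans
        (Σ-cong {λ a → φ a ^ᴿ q *ᴿ f (x + + q * a)} λ a → *-congʳ (^-congˡ q (perφ (back a))))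
        (K.trans (Σ-scale {λ a → φ (q′ * a) ^ᴿ q *ᴿ f (x + a)}
          (λ e → *-cong (^-congˡ q (perφ (≋-*ˡ q′ e))) (per (≋-+ˡ x e))) {+ q} {q′} qq′)
        (K.sym (⟦element⟧ (λ a → φ (q′ * a) ^ᴿ q) f x))))))
      where
      open SemiringExp semiring using (^-congˡ)
      lem : ∀ q q′ a → q′ * (q * a) ≡ q * q′ * a
      lem = solve-∀
      back : ∀ a → a ≋ q′ * (+ q * a) ⟨ ℓ ⟩
      back a = ≋-sym (≋-trans (≡⇒≋ (lem (+ q) q′ a)) (≋-trans (≋-*ʳ a qq′) (≡⇒≋ (ℤ.*-identityˡ a))))

-- Primes, powers of ω and power sums

module _ {q : ℕ} (q-prime : Prime q) where

  prime∣* : ∀ a b → + q ∣ a * b → (+ q ∣ a) ⊎ (+ q ∣ b)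
  prime∣* a b h with euclidsLemma ∣ a ∣ ∣ b ∣ q-prime (subst (q ℕ.∣_) (ℤ.∣i*j∣≡∣i∣*∣j∣ a b) (∣⇒∣ᵤ h))
  ... | inj₁ d = inj₁ (∣ᵤ⇒∣ d)
  ... | inj₂ d = inj₂ (∣ᵤ⇒∣ d)

  prime∣square : ∀ a → + q ∣ a * a → + q ∣ a
  prime∣square a h = Sum.reduce (prime∣* a a h)

  prime∤1 : ¬ (+ q ∣ 1ℤ)
  prime∤1 h = ¬prime[1] (subst Prime (ℕ.∣1⇒≡1 (∣⇒∣ᵤ h)) q-prime)

  ∤-* : ∀ {a b} → ¬ (+ q ∣ a) → ¬ (+ q ∣ b) → ¬ (+ q ∣ a * b)
  ∤-* {a} {b} na nb h with prime∣* a b h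
  ... | inj₁ d = na d
  ... | inj₂ d = nb d

  ≋-cancelˡ : ∀ {c} → ¬ (+ q ∣ c) → ∀ {a b} → c * a ≋ c * b ⟨ q ⟩ → a ≋ b ⟨ q ⟩
  ≋-cancelˡ {c} nc {a} {b} (mod h) with prime∣* c (a - b) (∣-resp (lem a b c) h)
    where
    lem : ∀ a b c → c * a - c * b ≡ c * (a - b)
    lem = solve-∀
  ... | inj₁ d = contradiction d nc
  ... | inj₂ d = mod d

prime∣prime : ∀ {p q} → Prime p → Prime q → + p ∣ + q → p ≡ q
prime∣prime pp pq h with prime⇒irreducible pq (∣⇒∣ᵤ h)
... | inj₁ refl = contradiction pp ¬prime[1]
... | inj₂ eq = eq

prime∤small : ∀ {q n} .{{_ : NonZero n}} → n ℕ.< q → ¬ (+ q ∣ + n)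
prime∤small n<q h = ℕ.<⇒≱ n<q (ℕ.∣⇒≤ (∣⇒∣ᵤ h))

prime[3] : Prime 3
prime[3] = from-yes (prime? 3)

*-^ : ∀ a b n → (a * b) ^ n ≡ a ^ n * b ^ n
*-^ a b zero    = refl
*-^ a b (suc n) = trans (cong (a * b *_) (*-^ a b n)) (lem a b (a ^ n) (b ^ n))
  where
  lem : ∀ a b c d → a * b * (c * d) ≡ a * c * (b * d)
  lem = solve-∀

1^ : ∀ n → 1ℤ ^ n ≡ 1ℤ
1^ zero    = refl
1^ (suc n) = trans (ℤ.*-identityˡ _) (1^ n)

≋-^ : ∀ {q a b} n → a ≋ b ⟨ q ⟩ → a ^ n ≋ b ^ n ⟨ q ⟩
≋-^ zero    h = ≋-refl
≋-^ (suc n) h = ≋-* h (≋-^ n h)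

∤-^ : ∀ {q} → Prime q → ∀ {a} → ¬ (+ q ∣ a) → ∀ n → ¬ (+ q ∣ a ^ n)
∤-^ q-prime na zero    = prime∤1 q-prime
∤-^ q-prime na (suc n) = ∤-* q-prime na (∤-^ q-prime na n)

ℤ/-char : ∀ q n → SemiringMult._×_ (CommutativeRing.semiring (ℤ/ q)) n 1ℤ ≡ + n
ℤ/-char q zero    = refl
ℤ/-char q (suc n) = cong (λ x → 1ℤ + x) (ℤ/-char q n)

q≋0 : ∀ {q} → + q ≋ 0ℤ ⟨ q ⟩
q≋0 {q} = ∣⇒≋0 ∣-refl

ℤ/-^ : ∀ q a n → SemiringExp._^_ (CommutativeRing.semiring (ℤ/ q)) a n ≡ a ^ n
ℤ/-^ q a zero    = refl
ℤ/-^ q a (suc n) = cong (a *_) (ℤ/-^ q a n)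

module _ {q : ℕ} (q-prime : Prime q) where

  private instance
    q≢0 : NonZero q
    q≢0 = prime⇒nonZero q-prime

  -- Additivity of Frobenius on ℤ/q gives (1 + n)^q ≡ 1 + n^q; induction then covers all residues.
  fermat : ∀ a → a ^ q ≋ a ⟨ q ⟩
  fermat a = ≋-trans (≋-^ q (≋-sym (residue-≋ q a))) (≋-trans (natural (toℕ (residue q a))) (residue-≋ q a))
    where
    open Frobenius (ℤ/ q) q-prime (≋-trans (≡⇒≋ (ℤ/-char q q)) q≋0)
    zero^ : ∀ {q} → Prime q → 0ℤ ^ q ≡ 0ℤ
    zero^ {zero}  pr = contradiction pr ¬prime[0]
    zero^ {suc n} pr = refl
    natural : ∀ n → (+ n) ^ q ≋ + n ⟨ q ⟩
    natural zero    = ≡⇒≋ (zero^ q-prime)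
    natural (suc n) = ≋-trans (≡⇒≋ (sym (ℤ/-^ q (+ suc n) q))) (≋-trans (^-distrib-+ 1ℤ (+ n))
      (≋-+ (≡⇒≋ (trans (ℤ/-^ q 1ℤ q) (1^ q))) (≋-trans (≡⇒≋ (ℤ/-^ q (+ n) q)) (natural n))))

  fermat-unit : ∀ {n} → q ≡ suc n → ∀ {a} → ¬ (+ q ∣ a) → a ^ n ≋ 1ℤ ⟨ q ⟩
  fermat-unit {n} eq {a} na = ≋-cancelˡ q-prime na
    (≋-trans (subst (λ m → a ^ m ≋ a ⟨ q ⟩) eq (fermat a)) (≡⇒≋ (sym (ℤ.*-identityʳ a))))

  inverse : ∀ {a} → ¬ (+ q ∣ a) → ∃[ b ] a * b ≋ 1ℤ ⟨ q ⟩
  inverse {a} na = go q refl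
    where
    go : ∀ n → q ≡ n → ∃[ b ] a * b ≋ 1ℤ ⟨ q ⟩
    go zero          eq = contradiction (subst Prime eq q-prime) ¬prime[0]
    go (suc zero)    eq = contradiction (subst Prime eq q-prime) ¬prime[1]
    go (suc (suc n)) eq = a ^ n , fermat-unit eq na

≋-idempotent : ∀ {x} → x ≋ x + x ⟨ 3 ⟩ → x ≋ 0ℤ ⟨ 3 ⟩
≋-idempotent {x} h = ≋-trans (≡⇒≋ (lem x)) (≋-trans (≋-+ʳ (- x) (≋-sym h)) (≡⇒≋ (ℤ.+-inverseʳ x)))
  where
  lem : ∀ x → x ≡ x + x - x
  lem = solve-∀

≋-halve : ∀ {x y} → x ≋ y + y ⟨ 3 ⟩ → x ≋ 0ℤ ⟨ 3 ⟩ → y ≋ 0ℤ ⟨ 3 ⟩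
≋-halve {x} {y} h k = ≋-cancelˡ prime[3] {+ 2} (from-no (+ 3 ∣? (+ 2))) (≋-trans (≡⇒≋ (lem y)) (≋-trans (≋-sym h) k))
  where
  lem : ∀ y → + 2 * y ≡ y + y
  lem = solve-∀

prime-mod-3 : ∀ {q} → Prime q → q ≢ 3 → (∃[ k ] q ≡ suc (3 ℕ.* k)) ⊎ (∃[ k ] suc q ≡ 3 ℕ.* k)
prime-mod-3 {q} q-prime q≢3 with ℕ._divMod_ q 3
... | ℕ.result k zero eq = contradiction (sym (prime∣prime prime[3] q-prime (∣ᵤ⇒∣ (ℕ.divides k eq)))) q≢3
... | ℕ.result k (suc zero) eq = inj₁ (k , trans eq (cong suc (ℕ.*-comm k 3)))
... | ℕ.result k (suc (suc zero)) eq = inj₂ (suc k , trans (cong suc eq) (ℕ.*-comm (suc k) 3))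

ωPow₃ : Fin 3 → 𝔼
ωPow₃ zero             = 1ᴱ
ωPow₃ (suc zero)       = ⟪ 0ℤ , 1ℤ ⟫
ωPow₃ (suc (suc zero)) = ⟪ -1ℤ , -1ℤ ⟫

W : ℤ → 𝔼
W z = ωPow₃ (residue 3 z)

residue-cong : ∀ {ℓ} .{{_ : NonZero ℓ}} {x y} → x ≋ y ⟨ ℓ ⟩ → residue ℓ x ≡ residue ℓ y
residue-cong {ℓ} {x} {y} h = toℕ-≋-injective (≋-trans (residue-≋ ℓ x) (≋-trans h (≋-sym (residue-≋ ℓ y))))

W-cong : ∀ {x y} → x ≋ y ⟨ 3 ⟩ → W x ≡ W y
W-cong h = cong ωPow₃ (residue-cong h)

W-toℕ : ∀ i → W (+ toℕ i) ≡ ωPow₃ i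
W-toℕ zero             = refl
W-toℕ (suc zero)       = refl
W-toℕ (suc (suc zero)) = refl

W-+ : ∀ x y → W (x + y) ≡ W x ⊗ W y
W-+ x y = trans (W-cong (≋-sym (≋-+ (residue-≋ 3 x) (residue-≋ 3 y)))) (table (residue 3 x) (residue 3 y))
  where
  table : ∀ i j → W (+ toℕ i + + toℕ j) ≡ ωPow₃ i ⊗ ωPow₃ j
  table zero zero = refl
  table zero (suc zero) = refl
  table zero (suc (suc zero)) = refl
  table (suc zero) zero = refl
  table (suc zero) (suc zero) = refl
  table (suc zero) (suc (suc zero)) = refl
  table (suc (suc zero)) zero = refl
  table (suc (suc zero)) (suc zero) = refl
  table (suc (suc zero)) (suc (suc zero)) = refl

W-neg : ∀ x → W (- x) ≡ conj (W x)
W-neg x = trans (W-cong (≋-sym (≋-neg (residue-≋ 3 x)))) (table (residue 3 x))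
  where
  table : ∀ i → W (- + toℕ i) ≡ conj (ωPow₃ i)
  table zero = refl
  table (suc zero) = refl
  table (suc (suc zero)) = refl

W-unit : ∀ x → W x ⊗ conj (W x) ≡ 1ᴱ
W-unit x = table (residue 3 x)
  where
  table : ∀ i → ωPow₃ i ⊗ conj (ωPow₃ i) ≡ 1ᴱ
  table zero = refl
  table (suc zero) = refl
  table (suc (suc zero)) = refl

W-square : ∀ x → W x ⊗ W x ≡ conj (W x)
W-square x = table (residue 3 x)
  where
  table : ∀ i → ωPow₃ i ⊗ ωPow₃ i ≡ conj (ωPow₃ i)
  table zero = refl
  table (suc zero) = refl
  table (suc (suc zero)) = refl

W-^ : ∀ x n → W x ^ᴱ n ≡ W (+ n * x)
W-^ x zero    = refl
W-^ x (suc n) = trans (cong (W x ⊗_) (W-^ x n)) (trans (sym (W-+ x (+ n * x))) (cong W (lem (+ n) x)))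
  where
  lem : ∀ n x → x + n * x ≡ (1ℤ + n) * x
  lem = solve-∀

W-norm : ∀ x → norm (W x) ≡ 1ℤ
W-norm x = cong re (trans (sym (⊗-conj (W x))) (W-unit x))

-- Congruence in `𝔼/ q` is coordinatewise and ω, ω² have imaginary coordinate ±1, so the powers of ω
-- stay distinct for every prime q, including 3.
W-kernel : ∀ {q} → Prime q → ∀ {x} → W x ≋ᴱ 1ᴱ ⟨ q ⟩ → x ≋ 0ℤ ⟨ 3 ⟩
W-kernel {q} q-prime {x} h = ≋-trans (≋-sym (residue-≋ 3 x)) (≡⇒≋ (cong (λ i → + toℕ i) (table (residue 3 x) h)))
  where
  table : ∀ i → ωPow₃ i ≋ᴱ 1ᴱ ⟨ q ⟩ → i ≡ zero
  table zero _ = refl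
  table (suc zero) h = contradiction (unmod (im≋ h)) (prime∤1 q-prime)
  table (suc (suc zero)) h = contradiction (∣m⇒∣-m (unmod (im≋ h))) (prime∤1 q-prime)

-- Sums of polynomials of low degree over the residues modulo a prime

module PowerSums {ℓ : ℕ} (ℓ-prime : Prime ℓ) where

  private instance
    ℓ≢0 : NonZero ℓ
    ℓ≢0 = prime⇒nonZero ℓ-prime

  open ResidueSum (ℤ/ ℓ) ℓ
  open SemiringSum (CommutativeRing.semiring (ℤ/ ℓ)) using (∑-distrib-+; *-distribˡ-sum)

  -- The falling factorial x (x - 1) ... (x - j + 1): its forward difference is a multiple of the
  -- previous one, so that sums telescope.
  falling : ℕ → ℤ → ℤ
  falling zero    x = 1ℤ
  falling (suc j) x = falling j x * (x - + j)

  falling-cong : ∀ j → Periodic (falling j)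
  falling-cong zero    e = ≋-refl
  falling-cong (suc j) e = ≋-* (falling-cong j e) (≋-+ʳ (- + j) e)

  falling-shift : ∀ j x → falling (suc j) (x + 1ℤ) ≡ (x + 1ℤ) * falling j x
  falling-shift zero x = lem x
    where
    lem : ∀ x → 1ℤ * (x + 1ℤ - 0ℤ) ≡ (x + 1ℤ) * 1ℤ
    lem = solve-∀
  falling-shift (suc j) x = trans (cong (_* (x + 1ℤ - + suc j)) (falling-shift j x)) (lem x (+ j) (falling j x))
    where
    lem : ∀ x j f → (x + 1ℤ) * f * (x + 1ℤ - (1ℤ + j)) ≡ (x + 1ℤ) * (f * (x - j))
    lem = solve-∀

  -- Satisfied by polynomials of degree at most n: only this consequence for power sums is recorded.
  record Degree≤ (n : ℕ) (f : ℤ → ℤ) : Set where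
    constructor degree
    field
      moment : ∀ j → suc (n ℕ.+ j) ℕ.< ℓ → Σ (λ x → f x * falling j x) ≋ 0ℤ ⟨ ℓ ⟩

  Σ-≡ : ∀ {f g : ℤ → ℤ} → (∀ x → f x ≡ g x) → Σ f ≋ Σ g ⟨ ℓ ⟩
  Σ-≡ {f} {g} eq = Σ-cong {f} {g} λ x → ≡⇒≋ (eq x)

  Σ-linear : ∀ c d (f g : ℤ → ℤ) → Σ (λ x → c * f x + d * g x) ≋ c * Σ f + d * Σ g ⟨ ℓ ⟩
  Σ-linear c d f g = ≋-trans (∑-distrib-+ {ℓ} (λ i → c * f (+ toℕ i)) (λ i → d * g (+ toℕ i)))
    (≋-sym (≋-+ (*-distribˡ-sum {ℓ} c _) (*-distribˡ-sum {ℓ} d _)))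

  -- (j + 1) `falling j x` is the difference of the values of `falling (suc j)` at x + 1 and x.
  -- Summed over all residues this vanishes by translation invariance, and j + 1 < ℓ can be
  -- cancelled.
  degree-1 : Degree≤ 0 (λ _ → 1ℤ)
  degree-1 = degree λ j j<ℓ → ≋-trans (Σ-≡ λ x → ℤ.*-identityˡ (falling j x))
    (≋-cancelˡ ℓ-prime (prime∤small j<ℓ) (≋-trans (≋-sym (≋-trans (Σ-linear (+ suc j) 0ℤ (falling j) (falling j)) (≡⇒≋ (lem₀ (+ suc j) _))))
    (≋-trans (Σ-≡ (step j)) (≋-trans (Σ-linear 1ℤ -1ℤ (λ x → falling (suc j) (x + 1ℤ)) (falling (suc j)))
    (≋-trans (≋-+ʳ (-1ℤ * Σ (falling (suc j))) (≋-*ˡ 1ℤ (Σ-shift {falling (suc j)} (falling-cong (suc j)) 1ℤ)))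
    (≡⇒≋ (lem₁ (Σ (falling (suc j))) (+ suc j))))))))
    where
    lem₀ : ∀ a s → a * s + 0ℤ * s ≡ a * s
    lem₀ = solve-∀
    lem₁ : ∀ s a → 1ℤ * s + -1ℤ * s ≡ a * 0ℤ
    lem₁ = solve-∀
    lem₂ : ∀ x j f → (1ℤ + j) * f + 0ℤ * f ≡ 1ℤ * ((x + 1ℤ) * f) + -1ℤ * (f * (x - j))
    lem₂ = solve-∀
    step : ∀ j x → + suc j * falling j x + 0ℤ * falling j x ≡ 1ℤ * falling (suc j) (x + 1ℤ) + -1ℤ * falling (suc j) x
    step j x = trans (lem₂ x (+ j) (falling j x)) (cong (λ f → 1ℤ * f + -1ℤ * falling (suc j) x) (sym (falling-shift j x)))

  -- Since x `falling j x` = `falling (suc j) x` + j `falling j x`, a factor x is traded for one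
  -- step in j. This is why the moments against all falling factorials are carried along.
  degree-* : ∀ {n f} u v → Degree≤ n f → Degree≤ (suc n) (λ x → (u * x + v) * f x)
  degree-* {n} {f} u v (degree deg) = degree λ j j<ℓ → ≋-trans (Σ-≡ λ x → lem₁ u v x (+ j) (f x) (falling j x))
    (≋-trans (Σ-linear u (u * + j + v) (λ x → f x * falling (suc j) x) (λ x → f x * falling j x))
    (≋-trans (≋-+ (≋-*ˡ u (deg (suc j) (subst (λ m → suc m ℕ.< ℓ) (sym (ℕ.+-suc n j)) j<ℓ)))
                  (≋-*ˡ (u * + j + v) (deg j (ℕ.<-trans (ℕ.n<1+n _) j<ℓ))))
    (≡⇒≋ (lem₂ u (u * + j + v)))))
    where
    lem₁ : ∀ u v x j f g → (u * x + v) * f * g ≡ u * (f * (g * (x - j))) + (u * j + v) * (f * g)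
    lem₁ = solve-∀
    lem₂ : ∀ u v → u * 0ℤ + v * 0ℤ ≡ 0ℤ
    lem₂ = solve-∀

  degree-resp : ∀ {n f g} → (∀ x → f x ≡ g x) → Degree≤ n f → Degree≤ n g
  degree-resp eq (degree deg) = degree λ j j<ℓ → ≋-trans (Σ-≡ λ x → cong (_* falling j x) (sym (eq x))) (deg j j<ℓ)

  degree-^ : ∀ {n f} u v i → Degree≤ n f → Degree≤ (i ℕ.+ n) (λ x → (u * x + v) ^ i * f x)
  degree-^ {n} {f} u v zero    deg = degree-resp (λ x → sym (ℤ.*-identityˡ (f x))) deg
  degree-^ {n} {f} u v (suc i) deg = degree-resp (λ x → sym (ℤ.*-assoc (u * x + v) ((u * x + v) ^ i) (f x))) (degree-* u v (degree-^ u v i deg))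

  Σ-degree : ∀ {n f} → Degree≤ n f → suc n ℕ.< ℓ → Σ f ≋ 0ℤ ⟨ ℓ ⟩
  Σ-degree {n} {f} (degree deg) n<ℓ = ≋-trans (Σ-≡ λ x → sym (ℤ.*-identityʳ (f x))) (deg 0 (subst (λ m → suc m ℕ.< ℓ) (sym (ℕ.+-identityʳ n)) n<ℓ))

-- Cubic characters, Jacobi sums and Gauss sums

𝔼/-^ : ∀ q x n → SemiringExp._^_ (CommutativeRing.semiring (𝔼/ q)) x n ≡ x ^ᴱ n
𝔼/-^ q x zero    = refl
𝔼/-^ q x (suc n) = cong (x ⊗_) (𝔼/-^ q x n)

⊗-^ : ∀ x y n → (x ⊗ y) ^ᴱ n ≡ x ^ᴱ n ⊗ y ^ᴱ n
⊗-^ x y zero    = refl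
⊗-^ x y (suc n) = trans (cong (x ⊗ y ⊗_) (⊗-^ x y n)) (⊗-interchange x y (x ^ᴱ n) (y ^ᴱ n))

conj-^ : ∀ x n → conj (x ^ᴱ n) ≡ conj x ^ᴱ n
conj-^ x zero    = refl
conj-^ x (suc n) = trans (conj-⊗ x (x ^ᴱ n)) (cong (conj x ⊗_) (conj-^ x n))

ι-⊗ : ∀ a b → ι a ⊗ ι b ≡ ι (a * b)
ι-⊗ a b = trans (⊗-ι a (ι b)) (cong (⟪ a * b ,_⟫) (ℤ.*-zeroʳ a))

ι-^ : ∀ a n → ι a ^ᴱ n ≡ ι (a ^ n)
ι-^ a zero    = refl
ι-^ a (suc n) = trans (cong (ι a ⊗_) (ι-^ a n)) (ι-⊗ a (a ^ n))

𝔼/-char : ∀ q n → SemiringMult._×_ (CommutativeRing.semiring (𝔼/ q)) n 1ᴱ ≡ ι (+ n)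
𝔼/-char q zero    = refl
𝔼/-char q (suc n) = cong (1ᴱ ⊕_) (𝔼/-char q n)

ι-≋ : ∀ {q a b} → a ≋ b ⟨ q ⟩ → ι a ≋ᴱ ι b ⟨ q ⟩
ι-≋ h = modᴱ h ≋-refl

ι-cancel : ∀ {q} → Prime q → ∀ {c} → ¬ (+ q ∣ c) → ∀ {x y} → ι c ⊗ x ≋ᴱ ι c ⊗ y ⟨ q ⟩ → x ≋ᴱ y ⟨ q ⟩
ι-cancel {q} q-prime {c} nc {x} {y} h = modᴱ
  (≋-cancelˡ q-prime nc (≋-trans (≡⇒≋ (sym (cong re (⊗-ι c x)))) (≋-trans (re≋ h) (≡⇒≋ (cong re (⊗-ι c y))))))
  (≋-cancelˡ q-prime nc (≋-trans (≡⇒≋ (sym (cong im (⊗-ι c x)))) (≋-trans (im≋ h) (≡⇒≋ (cong im (⊗-ι c y))))))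

ι-cancel-≡ : ∀ c .{{_ : ℤ.NonZero c}} {x y} → ι c ⊗ x ≡ ι c ⊗ y → x ≡ y
ι-cancel-≡ c {x} {y} h = cong₂ ⟪_,_⟫
  (ℤ.*-cancelˡ-≡ c (re x) (re y) (trans (sym (cong re (⊗-ι c x))) (trans (cong re h) (cong re (⊗-ι c y)))))
  (ℤ.*-cancelˡ-≡ c (im x) (im y) (trans (sym (cong im (⊗-ι c x))) (trans (cong im h) (cong im (⊗-ι c y)))))

W-sum : ∀ {x} → ¬ (x ≋ 0ℤ ⟨ 3 ⟩) → 1ᴱ ⊕ W x ⊕ W x ⊗ W x ≡ 0ᴱ
W-sum {x} nx = table (residue 3 x) (λ eq → nx (≋-trans (≋-sym (residue-≋ 3 x)) (≡⇒≋ (cong (λ i → + toℕ i) eq))))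
  where
  table : ∀ i → i ≢ zero → 1ᴱ ⊕ ωPow₃ i ⊕ ωPow₃ i ⊗ ωPow₃ i ≡ 0ᴱ
  table zero ne = contradiction refl ne
  table (suc zero) _ = refl
  table (suc (suc zero)) _ = refl

-- e is the exponent of a cubic residue character χ = ω ^ e modulo ℓ.
record CubicCharacter (ℓ : ℕ) : Set where
  field
    e          : ℤ → ℤ
    e-cong     : ∀ {x y} → x ≋ y ⟨ ℓ ⟩ → e x ≋ e y ⟨ 3 ⟩
    e-*        : ∀ {x y} → ¬ (+ ℓ ∣ x) → ¬ (+ ℓ ∣ y) → e (x * y) ≋ e x + e y ⟨ 3 ⟩
    nontrivial : ∃[ b ] ¬ (+ ℓ ∣ b) × ¬ (e b ≋ 0ℤ ⟨ 3 ⟩)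

module Jacobi {ℓ : ℕ} (ℓ-prime : Prime ℓ) (C : CubicCharacter ℓ) where

  open CubicCharacter C

  private instance
    ℓ≢0 : NonZero ℓ
    ℓ≢0 = prime⇒nonZero ℓ-prime

  private
    ∤1 : ¬ (+ ℓ ∣ 1ℤ)
    ∤1 = prime∤1 ℓ-prime

    ∤-1 : ¬ (+ ℓ ∣ -1ℤ)
    ∤-1 d = ∤1 (∣m⇒∣-m d)

  e-1 : e 1ℤ ≋ 0ℤ ⟨ 3 ⟩
  e-1 = ≋-idempotent (e-* ∤1 ∤1)

  e-neg1 : e -1ℤ ≋ 0ℤ ⟨ 3 ⟩
  e-neg1 = ≋-halve (e-* ∤-1 ∤-1) e-1

  χ : ℤ → 𝔼
  χ x with + ℓ ∣? x
  ... | yes _ = 0ᴱ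
  ... | no  _ = W (e x)

  χ-zero : ∀ {x} → + ℓ ∣ x → χ x ≡ 0ᴱ
  χ-zero {x} d with + ℓ ∣? x
  ... | yes _ = refl
  ... | no nd = contradiction d nd

  χ-unit : ∀ {x} → ¬ (+ ℓ ∣ x) → χ x ≡ W (e x)
  χ-unit {x} nd with + ℓ ∣? x
  ... | yes d = contradiction d nd
  ... | no _  = refl

  χ-cong : ∀ {x y} → x ≋ y ⟨ ℓ ⟩ → χ x ≡ χ y
  χ-cong {x} {y} h with + ℓ ∣? y
  ... | yes d = χ-zero (≋-∣ h d)
  ... | no nd = trans (χ-unit (nd ∘ ≋-∣ (≋-sym h))) (W-cong (e-cong h))

  χ-* : ∀ x y → χ (x * y) ≡ χ x ⊗ χ y
  χ-* x y = go (+ ℓ ∣? x) (+ ℓ ∣? y)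
    where
    go : Dec (+ ℓ ∣ x) → Dec (+ ℓ ∣ y) → χ (x * y) ≡ χ x ⊗ χ y
    go (yes d) _ = trans (χ-zero (∣m⇒∣m*n y d)) (sym (trans (cong (_⊗ χ y) (χ-zero d)) (⊗-zeroˡ (χ y))))
    go (no _) (yes d) = trans (χ-zero (∣n⇒∣m*n x d)) (sym (trans (cong (χ x ⊗_) (χ-zero d)) (⊗-zeroʳ (χ x))))
    go (no nx) (no ny) = trans (χ-unit (∤-* ℓ-prime nx ny)) (trans (W-cong (e-* nx ny)) (trans (W-+ (e x) (e y))
      (sym (cong₂ _⊗_ (χ-unit nx) (χ-unit ny)))))

  χ-1 : χ 1ℤ ≡ 1ᴱ
  χ-1 = trans (χ-unit ∤1) (W-cong e-1)

  χ-neg : ∀ x → χ (- x) ≡ χ x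
  χ-neg x = trans (cong χ (sym (ℤ.-1*i≡-i x))) (trans (χ-* -1ℤ x) (trans (cong (_⊗ χ x) (trans (χ-unit ∤-1) (W-cong e-neg1)))
    (⊗-identityˡ (χ x))))

  χ-square : ∀ x → χ x ⊗ χ x ≡ conj (χ x)
  χ-square x with + ℓ ∣? x
  ... | yes _ = refl
  ... | no _  = W-square (e x)

  χ-inverse : ∀ {x y} → x * y ≋ 1ℤ ⟨ ℓ ⟩ → χ y ≡ conj (χ x)
  χ-inverse {x} {y} h = begin
    χ y ≡⟨ ⊗-identityˡ (χ y) ⟨
    1ᴱ ⊗ χ y ≡⟨ cong (_⊗ χ y) (W-unit (e x)) ⟨
    W (e x) ⊗ conj (W (e x)) ⊗ χ y ≡⟨ cong (λ z → z ⊗ conj z ⊗ χ y) (χ-unit nx) ⟨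
    χ x ⊗ conj (χ x) ⊗ χ y ≡⟨ lem (χ x) (conj (χ x)) (χ y) ⟩
    χ x ⊗ χ y ⊗ conj (χ x) ≡⟨ cong (_⊗ conj (χ x)) (trans (sym (χ-* x y)) (trans (χ-cong h) χ-1)) ⟩
    1ᴱ ⊗ conj (χ x) ≡⟨ ⊗-identityˡ _ ⟩
    conj (χ x) ∎
    where
    open ≡-Reasoning
    nx : ¬ (+ ℓ ∣ x)
    nx d = ∤1 (≋-∣ (≋-sym h) (∣m⇒∣m*n y d))
    lem : ∀ x y z → x ⊗ y ⊗ z ≡ x ⊗ z ⊗ y
    lem = TR.solve-∀ 𝔼-solver

  χ̄ : ℤ → 𝔼
  χ̄ x = conj (χ x)

  χ̄-* : ∀ x y → χ̄ (x * y) ≡ χ̄ x ⊗ χ̄ y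
  χ̄-* x y = trans (cong conj (χ-* x y)) (conj-⊗ (χ x) (χ y))

  open ResidueSum 𝔼-ring ℓ
  open SemiringSum (CommutativeRing.semiring 𝔼-ring) using (*-distribˡ-sum; ∑-distrib-+; ∑-comm; sum)

  𝟙 : ℤ → 𝔼
  𝟙 _ = 1ᴱ

  Σ𝟙 : Σ 𝟙 ≡ ι (+ ℓ)
  Σ𝟙 = go ℓ
    where
    go : ∀ n → sum {n} (λ _ → 1ᴱ) ≡ ι (+ n)
    go zero    = refl
    go (suc n) = cong (1ᴱ ⊕_) (go n)

  Σ-⊗ : ∀ c f → Σ (λ a → c ⊗ f a) ≡ c ⊗ Σ f
  Σ-⊗ c f = sym (*-distribˡ-sum {ℓ} c λ i → f (+ toℕ i))

  Σ-⊕ : ∀ f g → Σ (λ a → f a ⊕ g a) ≡ Σ f ⊕ Σ g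
  Σ-⊕ f g = ∑-distrib-+ {ℓ} (λ i → f (+ toℕ i)) (λ i → g (+ toℕ i))

  Σ-swap : ∀ (f : ℤ → ℤ → 𝔼) → Σ (λ a → Σ (λ b → f a b)) ≡ Σ (λ b → Σ (λ a → f a b))
  Σ-swap f = ∑-comm {ℓ} {ℓ} (λ i j → f (+ toℕ i) (+ toℕ j))

  Σ-conj : ∀ f → Σ (λ a → conj (f a)) ≡ conj (Σ f)
  Σ-conj f = go {ℓ} (λ i → f (+ toℕ i))
    where
    go : ∀ {n} (t : Fin n → 𝔼) → sum (λ i → conj (t i)) ≡ conj (sum t)
    go {zero}  t = refl
    go {suc n} t = trans (cong (conj (t zero) ⊕_) (go (t ∘ suc))) (sym (conj-⊕ (t zero) _))

  -- Scaling by a non-cube b shows S = z S with z = χ(b). Then 3 S = (1 + z + z²) S = 0, and only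
  -- the integer 3 has to be cancelled.
  Σχ : Σ χ ≡ 0ᴱ
  Σχ with nontrivial
  ... | b , nb , eb = ι-cancel-≡ (+ 3) (begin
    ι (+ 3) ⊗ S ≡⟨ lem₁ S ⟩
    S ⊕ S ⊕ S ≡⟨ cong₂ (λ x y → S ⊕ x ⊕ y) invariant (trans invariant (cong (z ⊗_) invariant)) ⟩
    S ⊕ z ⊗ S ⊕ z ⊗ (z ⊗ S) ≡⟨ lem₂ z S ⟩
    (1ᴱ ⊕ z ⊕ z ⊗ z) ⊗ S ≡⟨ cong (_⊗ S) (W-sum eb) ⟩
    0ᴱ ⊗ S ≡⟨ lem₃ S ⟩
    ι (+ 3) ⊗ 0ᴱ ∎)
    where
    open ≡-Reasoning
    S z : 𝔼
    S = Σ χ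
    z = W (e b)
    lem₁ : ∀ x → ι (+ 3) ⊗ x ≡ x ⊕ x ⊕ x
    lem₁ x = trans (⊗-ι (+ 3) x) (cong₂ ⟪_,_⟫ (lem (re x)) (lem (im x)))
      where
      lem : ∀ a → + 3 * a ≡ a + a + a
      lem = solve-∀
    lem₂ : ∀ z S → S ⊕ z ⊗ S ⊕ z ⊗ (z ⊗ S) ≡ (1ᴱ ⊕ z ⊕ z ⊗ z) ⊗ S
    lem₂ = TR.solve-∀ 𝔼-solver
    lem₃ : ∀ S → 0ᴱ ⊗ S ≡ ι (+ 3) ⊗ 0ᴱ
    lem₃ S = ⊗-zeroˡ S
    b⁻¹ = inverse ℓ-prime nb
    invariant : S ≡ z ⊗ S
    invariant = trans (sym (Σ-scale {χ} χ-cong {b} {proj₁ b⁻¹} (proj₂ b⁻¹))) (trans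
      (Σ-cong {λ a → χ (b * a)} λ a → trans (χ-* b a) (cong (_⊗ χ a) (χ-unit nb))) (Σ-⊗ z χ))

  convolve : (ℤ → 𝔼) → (ℤ → 𝔼) → ℤ → 𝔼
  convolve φ ψ c = Σ λ a → φ a ⊗ ψ (c - a)

  J : 𝔼
  J = convolve χ χ 1ℤ

  convolve-unit : ∀ {φ ψ} → (∀ {x y} → x ≋ y ⟨ ℓ ⟩ → φ x ≡ φ y) → (∀ {x y} → x ≋ y ⟨ ℓ ⟩ → ψ x ≡ ψ y) →
    (∀ x y → φ (x * y) ≡ φ x ⊗ φ y) → (∀ x y → ψ (x * y) ≡ ψ x ⊗ ψ y) →
    ∀ {c} → ¬ (+ ℓ ∣ c) → convolve φ ψ c ≡ φ c ⊗ ψ c ⊗ convolve φ ψ 1ℤ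
  convolve-unit {φ} {ψ} φ-cong ψ-cong φ-* ψ-* {c} nc = begin
    Σ (λ a → φ a ⊗ ψ (c - a))
      ≡⟨ Σ-scale {λ a → φ a ⊗ ψ (c - a)} (λ h → cong₂ _⊗_ (φ-cong h) (ψ-cong (≋-+ˡ c (≋-neg h)))) {c} {proj₁ (inverse ℓ-prime nc)} (proj₂ (inverse ℓ-prime nc)) ⟨
    Σ (λ a → φ (c * a) ⊗ ψ (c - c * a))
      ≡⟨ Σ-cong {λ a → φ (c * a) ⊗ ψ (c - c * a)} (λ a → trans (cong₂ _⊗_ (φ-* c a) (trans (cong ψ (lem₁ c a)) (ψ-* c (1ℤ - a))))
           (⊗-interchange (φ c) (φ a) (ψ c) (ψ (1ℤ - a)))) ⟩
    Σ (λ a → φ c ⊗ ψ c ⊗ (φ a ⊗ ψ (1ℤ - a)))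
      ≡⟨ Σ-⊗ (φ c ⊗ ψ c) (λ a → φ a ⊗ ψ (1ℤ - a)) ⟩
    φ c ⊗ ψ c ⊗ convolve φ ψ 1ℤ ∎
    where
    open ≡-Reasoning
    lem₁ : ∀ c a → c - c * a ≡ c * (1ℤ - a)
    lem₁ = solve-∀

  -- These are the coefficients of g² = J ḡ. For a unit c substitute a ↦ c a and use χ² = χ̄; at c ≡
  -- 0, χ(-1) = 1 turns the sum into Σ χ̄ = 0.
  convolve-χχ : ∀ c → convolve χ χ c ≡ J ⊗ χ̄ c
  convolve-χχ c with + ℓ ∣? c
  ... | no nc = trans (convolve-unit {χ} {χ} χ-cong χ-cong χ-* χ-* nc)
    (trans (⊗-comm (χ c ⊗ χ c) J) (cong (J ⊗_) (trans (χ-square c) (cong conj (χ-unit nc)))))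
  ... | yes d = begin
    Σ (λ a → χ a ⊗ χ (c - a))
      ≡⟨ Σ-cong {λ a → χ a ⊗ χ (c - a)} (λ a → trans (cong (χ a ⊗_) (trans (χ-cong (≋-trans (≋-+ʳ (- a) (∣⇒≋0 d)) (≡⇒≋ (ℤ.+-identityˡ (- a))))) (χ-neg a))) (χ-square a)) ⟩
    Σ χ̄ ≡⟨ Σ-conj χ ⟩
    conj (Σ χ) ≡⟨ cong conj Σχ ⟩
    0ᴱ ≡⟨ ⊗-zeroʳ J ⟨
    J ⊗ 0ᴱ ∎
    where open ≡-Reasoning

  private
    K₁ : 𝔼
    K₁ = convolve χ χ̄ 1ℤ

    χ̄-cong : ∀ {x y} → x ≋ y ⟨ ℓ ⟩ → χ̄ x ≡ χ̄ y
    χ̄-cong h = cong conj (χ-cong h)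

    χχ̄-unit : ∀ {x} → ¬ (+ ℓ ∣ x) → χ x ⊗ χ̄ x ≡ 1ᴱ
    χχ̄-unit {x} nx = trans (cong (λ z → z ⊗ conj z) (χ-unit nx)) (W-unit (e x))

    convolve-χχ̄-unit : ∀ {c} → ¬ (+ ℓ ∣ c) → convolve χ χ̄ c ≡ K₁
    convolve-χχ̄-unit {c} nc = trans (convolve-unit {χ} {χ̄} χ-cong χ̄-cong χ-* χ̄-* nc)
      (trans (cong (_⊗ K₁) (χχ̄-unit nc)) (⊗-identityˡ K₁))

    convolve-χχ̄-zero : ∀ {c} → + ℓ ∣ c → convolve χ χ̄ c ≡ ι (+ ℓ) ⊕ ⊖ 1ᴱ
    convolve-χχ̄-zero {c} d = begin
      Σ (λ a → χ a ⊗ χ̄ (c - a)) ≡⟨ Σ-cong {λ a → χ a ⊗ χ̄ (c - a)} term ⟩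
      Σ (λ a → 1ᴱ ⊕ ⊖ 1ᴱ ⊗ (1ᴱ ⊗ δ a)) ≡⟨ Σ-⊕ 𝟙 (λ a → ⊖ 1ᴱ ⊗ (1ᴱ ⊗ δ a)) ⟩
      Σ 𝟙 ⊕ Σ (λ a → ⊖ 1ᴱ ⊗ (1ᴱ ⊗ δ a)) ≡⟨ cong₂ _⊕_ Σ𝟙 (trans (Σ-⊗ (⊖ 1ᴱ) (λ a → 1ᴱ ⊗ δ a)) (cong (⊖ 1ᴱ ⊗_) (Σ-δ 𝟙))) ⟩
      ι (+ ℓ) ⊕ ⊖ 1ᴱ ∎
      where
      open ≡-Reasoning
      neg : ∀ a → χ̄ (c - a) ≡ χ̄ a
      neg a = cong conj (trans (χ-cong (≋-trans (≋-+ʳ (- a) (∣⇒≋0 d)) (≡⇒≋ (ℤ.+-identityˡ (- a))))) (χ-neg a))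
      term : ∀ a → χ a ⊗ χ̄ (c - a) ≡ 1ᴱ ⊕ ⊖ 1ᴱ ⊗ (1ᴱ ⊗ δ a)
      term a with + ℓ ∣? a
      ... | yes d = trans (cong (0ᴱ ⊗_) (neg a)) (⊗-zeroˡ (χ̄ a))
      ... | no na = trans (cong (W (e a) ⊗_) (trans (neg a) (cong conj (χ-unit na)))) (W-unit (e a))

    convolve-χχ̄-δ : ∀ c → convolve χ χ̄ c ≡ K₁ ⊕ (ι (+ ℓ) ⊕ ⊖ 1ᴱ ⊕ ⊖ K₁) ⊗ (1ᴱ ⊗ δ c)
    convolve-χχ̄-δ c = go (+ ℓ ∣? c)
      where
      lem₁ : ∀ K l → l ≡ K ⊕ (l ⊕ ⊖ K) ⊗ (1ᴱ ⊗ 1ᴱ)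
      lem₁ = TR.solve-∀ 𝔼-solver
      lem₀ : ∀ K l → K ≡ K ⊕ (l ⊕ ⊖ K) ⊗ (1ᴱ ⊗ 0ᴱ)
      lem₀ = TR.solve-∀ 𝔼-solver
      go : Dec (+ ℓ ∣ c) → convolve χ χ̄ c ≡ K₁ ⊕ (ι (+ ℓ) ⊕ ⊖ 1ᴱ ⊕ ⊖ K₁) ⊗ (1ᴱ ⊗ δ c)
      go (yes d) = trans (convolve-χχ̄-zero d) (trans (lem₁ K₁ (ι (+ ℓ) ⊕ ⊖ 1ᴱ)) (cong (λ z → K₁ ⊕ (ι (+ ℓ) ⊕ ⊖ 1ᴱ ⊕ ⊖ K₁) ⊗ (1ᴱ ⊗ z)) (sym (δ-zero d))))
      go (no nd) = trans (convolve-χχ̄-unit nd) (trans (lem₀ K₁ (ι (+ ℓ) ⊕ ⊖ 1ᴱ)) (cong (λ z → K₁ ⊕ (ι (+ ℓ) ⊕ ⊖ 1ᴱ ⊕ ⊖ K₁) ⊗ (1ᴱ ⊗ z)) (sym (δ-nonzero nd))))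

    total : Σ (convolve χ χ̄) ≡ 0ᴱ
    total = begin
      Σ (λ c → Σ (λ a → χ a ⊗ χ̄ (c - a))) ≡⟨ Σ-swap (λ c a → χ a ⊗ χ̄ (c - a)) ⟩
      Σ (λ a → Σ (λ c → χ a ⊗ χ̄ (c - a))) ≡⟨ Σ-cong {λ a → Σ (λ c → χ a ⊗ χ̄ (c - a))} inner ⟩
      Σ (λ a → 0ᴱ ⊗ χ a) ≡⟨ Σ-⊗ 0ᴱ χ ⟩
      0ᴱ ⊗ Σ χ ≡⟨ ⊗-zeroˡ (Σ χ) ⟩
      0ᴱ ∎
      where
      open ≡-Reasoning
      inner : ∀ a → Σ (λ c → χ a ⊗ χ̄ (c - a)) ≡ 0ᴱ ⊗ χ a
      inner a = trans (Σ-⊗ (χ a) (λ c → χ̄ (c - a))) (trans (cong (χ a ⊗_)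
        (trans (Σ-shift {χ̄} χ̄-cong (- a)) (trans (Σ-conj χ) (cong conj Σχ)))) (⊗-comm (χ a) 0ᴱ))

    -- The coefficients of g ḡ add up to (Σ χ) (Σ χ̄) = 0. Those at units all equal `K₁` and the one
    -- at 0 is ℓ - 1, so (ℓ - 1) (K₁ + 1) = 0.
    K₁≡-1 : K₁ ≡ ⊖ 1ᴱ
    K₁≡-1 = ι-cancel-≡ (+ ℓ - 1ℤ) {{ℓ-1≢0}} (begin
      ι (+ ℓ - 1ℤ) ⊗ K₁
        ≡⟨ lem₁ K₁ (ι (+ ℓ)) ⟩
      K₁ ⊗ ι (+ ℓ) ⊕ (ι (+ ℓ) ⊕ ⊖ 1ᴱ ⊕ ⊖ K₁) ⊕ ⊖ (ι (+ ℓ) ⊕ ⊖ 1ᴱ)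
        ≡⟨ cong (_⊕ ⊖ (ι (+ ℓ) ⊕ ⊖ 1ᴱ)) sum-value ⟩
      0ᴱ ⊕ ⊖ (ι (+ ℓ) ⊕ ⊖ 1ᴱ)
        ≡⟨ lem₂ (ι (+ ℓ)) ⟩
      ι (+ ℓ - 1ℤ) ⊗ ⊖ 1ᴱ ∎)
      where
      open ≡-Reasoning
      ℓ-1≢0 : ℤ.NonZero (+ ℓ - 1ℤ)
      ℓ-1≢0 = ℤ.≢-nonZero λ eq → ¬prime[1] (subst Prime (ℤ.+-injective (ℤ.i-j≡0⇒i≡j (+ ℓ) 1ℤ eq)) ℓ-prime)
      lem₁ : ∀ K l → (l ⊕ ⊖ 1ᴱ) ⊗ K ≡ K ⊗ l ⊕ (l ⊕ ⊖ 1ᴱ ⊕ ⊖ K) ⊕ ⊖ (l ⊕ ⊖ 1ᴱ)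
      lem₁ = TR.solve-∀ 𝔼-solver
      lem₂ : ∀ l → 0ᴱ ⊕ ⊖ (l ⊕ ⊖ 1ᴱ) ≡ (l ⊕ ⊖ 1ᴱ) ⊗ ⊖ 1ᴱ
      lem₂ = TR.solve-∀ 𝔼-solver
      m : 𝔼
      m = ι (+ ℓ) ⊕ ⊖ 1ᴱ ⊕ ⊖ K₁
      sum-value : K₁ ⊗ ι (+ ℓ) ⊕ m ≡ 0ᴱ
      sum-value = begin
        K₁ ⊗ ι (+ ℓ) ⊕ m
          ≡⟨ cong₂ _⊕_ (cong (K₁ ⊗_) Σ𝟙) (trans (cong (m ⊗_) (Σ-δ 𝟙)) (⊗-identityʳ m)) ⟨
        K₁ ⊗ Σ 𝟙 ⊕ m ⊗ Σ (λ c → 1ᴱ ⊗ δ c)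
          ≡⟨ cong₂ _⊕_ (Σ-⊗ K₁ 𝟙) (Σ-⊗ m (λ c → 1ᴱ ⊗ δ c)) ⟨
        Σ (λ _ → K₁ ⊗ 1ᴱ) ⊕ Σ (λ c → m ⊗ (1ᴱ ⊗ δ c))
          ≡⟨ Σ-⊕ (λ _ → K₁ ⊗ 1ᴱ) (λ c → m ⊗ (1ᴱ ⊗ δ c)) ⟨
        Σ (λ c → K₁ ⊗ 1ᴱ ⊕ m ⊗ (1ᴱ ⊗ δ c))
          ≡⟨ Σ-cong {convolve χ χ̄} (λ c → trans (convolve-χχ̄-δ c) (cong (_⊕ m ⊗ (1ᴱ ⊗ δ c)) (sym (⊗-identityʳ K₁)))) ⟨
        Σ (convolve χ χ̄)
          ≡⟨ total ⟩
        0ᴱ ∎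

  convolve-χχ̄ : ∀ c → convolve χ χ̄ c ≡ ⊖ 1ᴱ ⊕ ι (+ ℓ) ⊗ δ c
  convolve-χχ̄ c = trans (convolve-χχ̄-δ c) (trans (cong (λ K → K ⊕ (ι (+ ℓ) ⊕ ⊖ 1ᴱ ⊕ ⊖ K) ⊗ (1ᴱ ⊗ δ c)) K₁≡-1) (lem (ι (+ ℓ)) (δ c)))
    where
    lem : ∀ l d → ⊖ 1ᴱ ⊕ (l ⊕ ⊖ 1ᴱ ⊕ ⊖ (⊖ 1ᴱ)) ⊗ (1ᴱ ⊗ d) ≡ ⊖ 1ᴱ ⊕ l ⊗ d
    lem = TR.solve-∀ 𝔼-solver

  convolve-χ̄χ̄ : ∀ c → convolve χ̄ χ̄ c ≡ conj J ⊗ χ c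
  convolve-χ̄χ̄ c = trans (trans (Σ-cong {λ a → χ̄ a ⊗ χ̄ (c - a)} λ a → sym (conj-⊗ (χ a) (χ (c - a)))) (Σ-conj (λ a → χ a ⊗ χ (c - a))))
    (trans (cong conj (convolve-χχ c)) (trans (conj-⊗ J (χ̄ c)) (cong (conj J ⊗_) (conj-conj (χ c)))))

  gauss-term : ℤ → 𝔼
  gauss-term c = ⊖ 1ᴱ ⊕ ι (+ ℓ) ⊗ δ c

  gauss-term-cong : ∀ {x y} → x ≋ y ⟨ ℓ ⟩ → gauss-term x ≡ gauss-term y
  gauss-term-cong h = cong (λ z → ⊖ 1ᴱ ⊕ ι (+ ℓ) ⊗ z) (δ-periodic h)

  -- In the group ring g ḡ is ℓ minus the sum of all translations. A primitive ℓ-th root of unity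
  -- would annihilate that sum; here it is annihilated by one more factor `g`, because Σ χ = 0.
  convolve-χ-gauss-term : ∀ c → convolve χ gauss-term c ≡ ι (+ ℓ) ⊗ χ c
  convolve-χ-gauss-term c = begin
    Σ (λ a → χ a ⊗ gauss-term (c - a))
      ≡⟨ Σ-cong {λ a → χ a ⊗ gauss-term (c - a)} (λ a → trans (lem₁ (χ a) (ι (+ ℓ)) (δ (c - a)))
           (cong (λ z → ⊖ 1ᴱ ⊗ χ a ⊕ ι (+ ℓ) ⊗ (χ a ⊗ z)) (δ-even a))) ⟩
    Σ (λ a → ⊖ 1ᴱ ⊗ χ a ⊕ ι (+ ℓ) ⊗ (χ a ⊗ δ (a - c)))
      ≡⟨ Σ-⊕ (λ a → ⊖ 1ᴱ ⊗ χ a) (λ a → ι (+ ℓ) ⊗ (χ a ⊗ δ (a - c))) ⟩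
    Σ (λ a → ⊖ 1ᴱ ⊗ χ a) ⊕ Σ (λ a → ι (+ ℓ) ⊗ (χ a ⊗ δ (a - c)))
      ≡⟨ cong₂ _⊕_ (trans (Σ-⊗ (⊖ 1ᴱ) χ) (cong (⊖ 1ᴱ ⊗_) Σχ)) (trans (Σ-⊗ (ι (+ ℓ)) (λ a → χ a ⊗ δ (a - c))) (cong (ι (+ ℓ) ⊗_) (Σ-δ-at {χ} χ-cong c))) ⟩
    ⊖ 1ᴱ ⊗ 0ᴱ ⊕ ι (+ ℓ) ⊗ χ c
      ≡⟨ lem₂ (ι (+ ℓ) ⊗ χ c) ⟩
    ι (+ ℓ) ⊗ χ c ∎
    where
    open ≡-Reasoning
    lem₁ : ∀ x l d → x ⊗ (⊖ 1ᴱ ⊕ l ⊗ d) ≡ ⊖ 1ᴱ ⊗ x ⊕ l ⊗ (x ⊗ d)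
    lem₁ = TR.solve-∀ 𝔼-solver
    lem₂ : ∀ x → ⊖ 1ᴱ ⊗ 0ᴱ ⊕ x ≡ x
    lem₂ = TR.solve-∀ 𝔼-solver
    neg : ∀ a c → - (a - c) ≡ c - a
    neg = solve-∀
    δ-even : ∀ a → δ (c - a) ≡ δ (a - c)
    δ-even a = go (+ ℓ ∣? (a - c))
      where
      go : Dec (+ ℓ ∣ a - c) → δ (c - a) ≡ δ (a - c)
      go (yes d) = trans (δ-zero (∣-resp (neg a c) (∣m⇒∣-m d))) (sym (δ-zero d))
      go (no nd) = trans (δ-nonzero λ d → nd (∣-resp (neg c a) (∣m⇒∣-m d))) (sym (δ-nonzero nd))

-- Powers of Gauss sums and reciprocity for Jacobi sums

module GaussPower (R : CommutativeRing 0ℓ 0ℓ) where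

  open CommutativeRing R using () renaming (_≈_ to _≈ᴿ_; _*_ to _*ᴿ_)
  private module R = CommutativeRing R
  open SemiringExp R.semiring using () renaming (_^_ to _^ᴿ_)
  open import Algebra.Solver.CommutativeMonoid R.*-commutativeMonoid
    using (_⊜_) renaming (solve to solveᴿ; _⊕_ to _:*_)
  open SetoidReasoning R.setoid

  fourth : ∀ {g h a b} → g *ᴿ g ≈ᴿ a *ᴿ h → h *ᴿ h ≈ᴿ b *ᴿ g → g *ᴿ g *ᴿ (g *ᴿ g) ≈ᴿ a *ᴿ a *ᴿ b *ᴿ g
  fourth {g} {h} {a} {b} gg hh = begin
    g *ᴿ g *ᴿ (g *ᴿ g) ≈⟨ R.*-cong gg gg ⟩
    a *ᴿ h *ᴿ (a *ᴿ h) ≈⟨ solveᴿ 2 (λ a h → (a :* h) :* (a :* h) ⊜ (a :* a) :* (h :* h)) R.refl a h ⟩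
    a *ᴿ a *ᴿ (h *ᴿ h) ≈⟨ R.*-congˡ hh ⟩
    a *ᴿ a *ᴿ (b *ᴿ g) ≈⟨ R.*-assoc (a *ᴿ a) b g ⟨
    a *ᴿ a *ᴿ b *ᴿ g ∎

  -- In the group ring g³ is not a scalar, but g⁴ = a² b g does hold. Hence exponents of the form 3
  -- k + 1, with one factor `g` left over.
  power : ∀ {g h a b} → g *ᴿ g ≈ᴿ a *ᴿ h → h *ᴿ h ≈ᴿ b *ᴿ g → ∀ k → g ^ᴿ suc (3 ℕ.* k) ≈ᴿ (a *ᴿ a *ᴿ b) ^ᴿ k *ᴿ g
  power {g} gg hh zero = R.*-comm g R.1#
  power {g} {h} {a} {b} gg hh (suc k) = begin
    g ^ᴿ suc (3 ℕ.* suc k) ≡⟨ cong (λ n → g ^ᴿ suc n) (ℕ.*-suc 3 k) ⟩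
    g *ᴿ (g *ᴿ (g *ᴿ (g ^ᴿ suc (3 ℕ.* k)))) ≈⟨ R.*-congˡ (R.*-congˡ (R.*-congˡ (power {g} {h} gg hh k))) ⟩
    g *ᴿ (g *ᴿ (g *ᴿ (c ^ᴿ k *ᴿ g))) ≈⟨ solveᴿ 2 (λ g x → g :* (g :* (g :* (x :* g))) ⊜ x :* ((g :* g) :* (g :* g))) R.refl g (c ^ᴿ k) ⟩
    c ^ᴿ k *ᴿ (g *ᴿ g *ᴿ (g *ᴿ g)) ≈⟨ R.*-congˡ (fourth {g} {h} gg hh) ⟩
    c ^ᴿ k *ᴿ (c *ᴿ g) ≈⟨ solveᴿ 3 (λ x c g → x :* (c :* g) ⊜ (c :* x) :* g) R.refl (c ^ᴿ k) c g ⟩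
    c *ᴿ c ^ᴿ k *ᴿ g ∎
    where
    c : R.Carrier
    c = a *ᴿ a *ᴿ b

module Gauss {ℓ : ℕ} (ℓ-prime : Prime ℓ) (C : CubicCharacter ℓ) where

  open CubicCharacter C
  open Jacobi ℓ-prime C
  private instance
    ℓ≢0 : NonZero ℓ
    ℓ≢0 = prime⇒nonZero ℓ-prime

  module Modulo (q : ℕ) where

    private
      module Q = CommutativeRing (𝔼/ q)
    open GroupRing (𝔼/ q) ℓ public
    open SemiringExp O.semiring using () renaming (_^_ to _^ₒ_; ^-congˡ to ^ₒ-congˡ) public
    open SemiringExp Q.semiring using () renaming (_^_ to _^Q_)

    g ḡ : Op
    g = element χ
    ḡ = element χ̄

    χ-per : ∀ {x y} → x ≋ y ⟨ ℓ ⟩ → χ x ≋ᴱ χ y ⟨ q ⟩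
    χ-per h = ≡⇒≋ᴱ (χ-cong h)

    χ̄-per : ∀ {x y} → x ≋ y ⟨ ℓ ⟩ → χ̄ x ≋ᴱ χ̄ y ⟨ q ⟩
    χ̄-per h = ≡⇒≋ᴱ (cong conj (χ-cong h))

    gg : g *ₒ g ≈ₒ scalar J *ₒ ḡ
    gg = O.trans (element-* χ χ χ-per) (O.trans (element-cong {convolve χ χ} λ c → ≡⇒≋ᴱ (convolve-χχ c)) (O.sym (scalar-element J χ̄)))

    ḡḡ : ḡ *ₒ ḡ ≈ₒ scalar (conj J) *ₒ g
    ḡḡ = O.trans (element-* χ̄ χ̄ χ̄-per) (O.trans (element-cong {convolve χ̄ χ̄} λ c → ≡⇒≋ᴱ (convolve-χ̄χ̄ c)) (O.sym (scalar-element (conj J) χ)))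

    gḡ : g *ₒ ḡ ≈ₒ element (convolve χ χ̄)
    gḡ = element-* χ χ̄ χ̄-per

    open GaussPower Op-ring using (power)

    gauss-power : ∀ k → g ^ₒ suc (3 ℕ.* k) ≈ₒ scalar ((J ⊗ J ⊗ conj J) ^ᴱ k) *ₒ g
    gauss-power k = O.trans (power {g} {ḡ} {scalar J} {scalar (conj J)} gg ḡḡ k) (O.*-congʳ {g} (O.trans
      (^ₒ-congˡ k (O.trans (O.*-congʳ {scalar (conj J)} (scalar-* J J)) (scalar-* (J ⊗ J) (conj J))))
      (O.trans (scalar-^ (J ⊗ J ⊗ conj J) k) (scalar-cong (≡⇒≋ᴱ (𝔼/-^ q (J ⊗ J ⊗ conj J) k))))))

    -- As χ(1) = 1, the coefficient of c g at 1 is c. This takes the place of dividing by `g`.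
    scalar-g-injective : ∀ {c d} → scalar c *ₒ g ≈ₒ scalar d *ₒ g → c ≋ᴱ d ⟨ q ⟩
    scalar-g-injective {c} {d} h = Q.trans (≡⇒≋ᴱ (sym (at-1 c))) (Q.trans (element-injective {λ a → c ⊗ χ a} {λ a → d ⊗ χ a}
      (λ e → ≋ᴱ-⊗ (≡⇒≋ᴱ {x = c} refl) (χ-per e)) (λ e → ≋ᴱ-⊗ (≡⇒≋ᴱ {x = d} refl) (χ-per e))
      (O.trans (O.sym (scalar-element c χ)) (O.trans h (scalar-element d χ))) 1ℤ) (≡⇒≋ᴱ (at-1 d)))
      where
      at-1 : ∀ c → c ⊗ χ 1ℤ ≡ c
      at-1 c = trans (cong (c ⊗_) χ-1) (⊗-identityʳ c)

    gḡ-g : g *ₒ (g *ₒ ḡ) ≈ₒ scalar (ι (+ ℓ)) *ₒ g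
    gḡ-g = O.trans (O.*-congˡ {g} (O.trans gḡ (element-cong {convolve χ χ̄} λ c → ≡⇒≋ᴱ (convolve-χχ̄ c))))
      (O.trans (element-* χ gauss-term (λ h → ≡⇒≋ᴱ (gauss-term-cong h)))
      (O.trans (element-cong {convolve χ gauss-term} λ c → ≡⇒≋ᴱ (convolve-χ-gauss-term c)) (O.sym (scalar-element (ι (+ ℓ)) χ))))

    ggḡ : g *ₒ (g *ₒ ḡ) ≈ₒ scalar (J ⊗ conj J) *ₒ g
    ggḡ = begin
      g *ₒ (g *ₒ ḡ) ≈⟨ O.*-assoc g g ḡ ⟨
      g *ₒ g *ₒ ḡ ≈⟨ O.*-congʳ {ḡ} gg ⟩
      scalar J *ₒ ḡ *ₒ ḡ ≈⟨ O.*-assoc (scalar J) ḡ ḡ ⟩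
      scalar J *ₒ (ḡ *ₒ ḡ) ≈⟨ O.*-congˡ {scalar J} ḡḡ ⟩
      scalar J *ₒ (scalar (conj J) *ₒ g) ≈⟨ O.*-assoc (scalar J) (scalar (conj J)) g ⟨
      scalar J *ₒ scalar (conj J) *ₒ g ≈⟨ O.*-congʳ {g} (scalar-* J (conj J)) ⟩
      scalar (J ⊗ conj J) *ₒ g ∎
      where open SetoidReasoning O.setoid

    gḡ-twist : ∀ z → g *ₒ (g *ₒ (scalar z *ₒ ḡ)) ≈ₒ scalar (z ⊗ ι (+ ℓ)) *ₒ g
    gḡ-twist z = begin
      g *ₒ (g *ₒ (scalar z *ₒ ḡ)) ≈⟨ O.*-congˡ {g} (exchange ḡ) ⟩
      g *ₒ (scalar z *ₒ (g *ₒ ḡ)) ≈⟨ exchange (g *ₒ ḡ) ⟩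
      scalar z *ₒ (g *ₒ (g *ₒ ḡ)) ≈⟨ O.*-congˡ {scalar z} gḡ-g ⟩
      scalar z *ₒ (scalar (ι (+ ℓ)) *ₒ g) ≈⟨ O.*-assoc (scalar z) (scalar (ι (+ ℓ))) g ⟨
      scalar z *ₒ scalar (ι (+ ℓ)) *ₒ g ≈⟨ O.*-congʳ {g} (scalar-* z (ι (+ ℓ))) ⟩
      scalar (z ⊗ ι (+ ℓ)) *ₒ g ∎
      where
      open SetoidReasoning O.setoid
      exchange : ∀ u → g *ₒ (scalar z *ₒ u) ≈ₒ scalar z *ₒ (g *ₒ u)
      exchange u = O.trans (O.sym (O.*-assoc g (scalar z) u)) (O.trans (O.*-congʳ {u} (O.*-comm g (scalar z))) (O.*-assoc (scalar z) g u))

    module _ (q-prime : Prime q) (q≢ℓ : q ≢ ℓ) where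

      private
        q∤ℓ : ¬ (+ ℓ ∣ + q)
        q∤ℓ d = q≢ℓ (sym (prime∣prime ℓ-prime q-prime d))

        q⁻¹ : ∃[ b ] + q * b ≋ 1ℤ ⟨ ℓ ⟩
        q⁻¹ = inverse ℓ-prime q∤ℓ

      gauss-frobenius : g ^ₒ q ≈ₒ element (λ a → χ (proj₁ q⁻¹ * a) ^ᴱ q)
      gauss-frobenius = O.trans
        (element-^ q-prime (Q.trans (≡⇒≋ᴱ (𝔼/-char q q)) (ι-≋ q≋0)) {χ} χ-per (proj₂ q⁻¹))
        (element-cong {λ a → χ (proj₁ q⁻¹ * a) ^Q q} λ a → ≡⇒≋ᴱ (𝔼/-^ q (χ (proj₁ q⁻¹ * a)) q))

      χ-q⁻¹ : χ (proj₁ q⁻¹) ≡ conj (W (e (+ q)))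
      χ-q⁻¹ = trans (χ-inverse (proj₂ q⁻¹)) (cong conj (χ-unit q∤ℓ))

      q-inverse : ℤ
      q-inverse = proj₁ q⁻¹

  -- g² ḡ is evaluated in two ways, in the group ring with modulus 0, where congruence is equality.
  J-norm : J ⊗ conj J ≡ ι (+ ℓ)
  J-norm = ≋ᴱ0⇒≡ (scalar-g-injective (O.trans (O.sym ggḡ) gḡ-g))
    where open Modulo 0

  zero^ : ∀ {q} → Prime q → 0ᴱ ^ᴱ q ≡ 0ᴱ
  zero^ {zero}  pr = contradiction pr ¬prime[0]
  zero^ {suc n} pr = ⊗-zeroˡ (0ᴱ ^ᴱ n)

  χ-^-≡1 : ∀ {q k} → Prime q → q ≡ suc (3 ℕ.* k) → ∀ x → χ x ^ᴱ q ≡ χ x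
  χ-^-≡1 {q} {k} q-prime refl x = go (+ ℓ ∣? x)
    where
    go : Dec (+ ℓ ∣ x) → χ x ^ᴱ q ≡ χ x
    go (yes d) = trans (cong (_^ᴱ q) (χ-zero d)) (trans (zero^ q-prime) (sym (χ-zero d)))
    go (no nd) = trans (cong (_^ᴱ q) (χ-unit nd)) (trans (W-^ (e x) q) (trans (W-cong {+ q * e x} {e x} (mod (divides (+ k * e x) eq))) (sym (χ-unit nd))))
      where
      lem : ∀ k e → (1ℤ + + 3 * k) * e - e ≡ k * e * + 3
      lem = solve-∀
      eq : + q * e x - e x ≡ + k * e x * + 3
      eq = trans (cong (λ z → (1ℤ + z) * e x - e x) (ℤ.pos-* 3 k)) (lem (+ k) (e x))

  χ-^-≡2 : ∀ {q k} → Prime q → suc q ≡ 3 ℕ.* k → ∀ x → χ x ^ᴱ q ≡ χ̄ x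
  χ-^-≡2 {q} {k} q-prime eq x = go (+ ℓ ∣? x)
    where
    go : Dec (+ ℓ ∣ x) → χ x ^ᴱ q ≡ χ̄ x
    go (yes d) = trans (cong (_^ᴱ q) (χ-zero d)) (trans (zero^ q-prime) (cong conj (sym (χ-zero d))))
    go (no nd) = trans (cong (_^ᴱ q) (χ-unit nd)) (trans (W-^ (e x) q) (trans (W-cong {+ q * e x} { - e x } (mod (divides (+ k * e x) eq′))) (trans (W-neg (e x)) (cong conj (sym (χ-unit nd))))))
      where
      lem₁ : ∀ q e → q * e - (- e) ≡ (1ℤ + q) * e
      lem₁ = solve-∀
      lem₂ : ∀ k e → + 3 * k * e ≡ k * e * + 3
      lem₂ = solve-∀
      eq′ : + q * e x - (- e x) ≡ + k * e x * + 3
      eq′ = trans (lem₁ (+ q) (e x)) (trans (cong (_* e x) (trans (cong +_ eq) (ℤ.pos-* 3 k))) (lem₂ (+ k) (e x)))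

  -- Modulo 3, Frobenius gives g³ the coefficient at 1 of a cubed power of ω, which is 1. Computed
  -- as J g ḡ, the same coefficient is - J.
  J-primary : ℓ ≢ 3 → J ≋ᴱ ⊖ 1ᴱ ⟨ 3 ⟩
  J-primary ℓ≢3 = Q.trans (≡⇒≋ᴱ (lem J)) (≋ᴱ-⊖ (Q.trans (Q.sym (≡⇒≋ᴱ left)) (Q.trans (Q.sym at-1) (≡⇒≋ᴱ right))))
    where
    open Modulo 3
    module Q = CommutativeRing (𝔼/ 3)
    3⁻¹ : ℤ
    3⁻¹ = q-inverse prime[3] (ℓ≢3 ∘ sym)
    lem : ∀ x → x ≡ ⊖ (x ⊗ ⊖ 1ᴱ)
    lem = TR.solve-∀ 𝔼-solver
    cube : g ^ₒ 3 ≈ₒ element (λ c → J ⊗ convolve χ χ̄ c)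
    cube = begin
      g *ₒ (g *ₒ (g *ₒ T 0ℤ)) ≈⟨ O.*-congˡ {g} (O.*-congˡ {g} (O.*-identityʳ g)) ⟩
      g *ₒ (g *ₒ g) ≈⟨ O.*-congˡ {g} gg ⟩
      g *ₒ (scalar J *ₒ ḡ) ≈⟨ O.*-assoc g (scalar J) ḡ ⟨
      g *ₒ scalar J *ₒ ḡ ≈⟨ O.*-congʳ {ḡ} (O.*-comm g (scalar J)) ⟩
      scalar J *ₒ g *ₒ ḡ ≈⟨ O.*-assoc (scalar J) g ḡ ⟩
      scalar J *ₒ (g *ₒ ḡ) ≈⟨ O.*-congˡ {scalar J} gḡ ⟩
      scalar J *ₒ element (convolve χ χ̄) ≈⟨ scalar-element J (convolve χ χ̄) ⟩
      element (λ c → J ⊗ convolve χ χ̄ c) ∎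
      where open SetoidReasoning O.setoid
    at-1 : χ (3⁻¹ * 1ℤ) ^ᴱ 3 ≋ᴱ J ⊗ convolve χ χ̄ 1ℤ ⟨ 3 ⟩
    at-1 = element-injective {λ a → χ (3⁻¹ * a) ^ᴱ 3} {λ c → J ⊗ convolve χ χ̄ c}
      (λ h → ≡⇒≋ᴱ (cong (_^ᴱ 3) (χ-cong (≋-*ˡ 3⁻¹ h))))
      (λ {x} {y} h → ≡⇒≋ᴱ (cong (J ⊗_) (trans (convolve-χχ̄ x) (trans (gauss-term-cong h) (sym (convolve-χχ̄ y))))))
      (O.trans (O.sym (gauss-frobenius prime[3] (ℓ≢3 ∘ sym))) cube) 1ℤ
    right : χ (3⁻¹ * 1ℤ) ^ᴱ 3 ≡ 1ᴱ
    right = trans (cong (λ z → χ z ^ᴱ 3) (ℤ.*-identityʳ 3⁻¹)) (trans (cong (_^ᴱ 3) (trans (χ-q⁻¹ prime[3] (ℓ≢3 ∘ sym)) (sym (W-neg (e (+ 3))))))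
      (trans (W-^ (- e (+ 3)) 3) (W-cong {+ 3 * - e (+ 3)} {0ℤ} (∣⇒≋0 (∣m⇒∣m*n (- e (+ 3)) ∣-refl)))))
    left : J ⊗ convolve χ χ̄ 1ℤ ≡ J ⊗ ⊖ 1ᴱ
    left = cong (J ⊗_) (trans (convolve-χχ̄ 1ℤ) (trans (cong (λ z → ⊖ 1ᴱ ⊕ ι (+ ℓ) ⊗ z) (ResidueSum.δ-nonzero 𝔼-ring ℓ (prime∤1 ℓ-prime)))
      (lem′ (ι (+ ℓ)))))
      where
      lem′ : ∀ l → ⊖ 1ᴱ ⊕ l ⊗ 0ᴱ ≡ ⊖ 1ᴱ
      lem′ = TR.solve-∀ 𝔼-solver

  private
    c : 𝔼
    c = J ⊗ J ⊗ conj J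

    c≡ : c ≡ J ⊗ ι (+ ℓ)
    c≡ = trans (⊗-assoc J J (conj J)) (cong (J ⊗_) J-norm)

    c^ : ∀ k → c ^ᴱ k ≡ ι ((+ ℓ) ^ k) ⊗ J ^ᴱ k
    c^ k = trans (cong (_^ᴱ k) c≡) (trans (⊗-^ J (ι (+ ℓ)) k) (trans (⊗-comm (J ^ᴱ k) (ι (+ ℓ) ^ᴱ k)) (cong (_⊗ J ^ᴱ k) (ι-^ (+ ℓ) k))))

    conj-c^ : ∀ k → conj (c ^ᴱ k) ≡ ι ((+ ℓ) ^ k) ⊗ conj J ^ᴱ k
    conj-c^ k = trans (cong conj (c^ k)) (trans (conj-⊗ (ι ((+ ℓ) ^ k)) (J ^ᴱ k)) (cong₂ _⊗_ (cong (⟪_, 0ℤ ⟫) (ℤ.+-identityʳ ((+ ℓ) ^ k))) (conj-^ J k)))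

    ℓ^-unit : ∀ {q} → Prime q → q ≢ ℓ → ∀ k → ¬ (+ q ∣ (+ ℓ) ^ k)
    ℓ^-unit q-prime q≢ℓ = ∤-^ q-prime λ d → q≢ℓ (prime∣prime q-prime ℓ-prime d)

  -- g^q equals (ℓ J)^k g by the power formula and χ(q)⁻¹ g by Frobenius, as χ^q = χ here. So (ℓ
  -- J)^k ≡ χ(q)⁻¹ and its conjugate is χ(q); in comparing the two, the rational factor ℓ^k cancels.
  reciprocity₁ : ∀ {q k} → Prime q → q ≢ ℓ → q ≡ suc (3 ℕ.* k) → J ^ᴱ k ≋ᴱ W (e (+ q)) ⊗ conj J ^ᴱ k ⟨ q ⟩
  reciprocity₁ {q} {k} q-prime q≢ℓ eq = ι-cancel q-prime (ℓ^-unit q-prime q≢ℓ k) (begin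
    ι ((+ ℓ) ^ k) ⊗ J ^ᴱ k ≡⟨ c^ k ⟨
    c ^ᴱ k ≈⟨ value ⟩
    conj (W (e (+ q))) ≡⟨ W-square (e (+ q)) ⟨
    W (e (+ q)) ⊗ W (e (+ q)) ≡⟨ cong (W (e (+ q)) ⊗_) (conj-conj (W (e (+ q)))) ⟨
    W (e (+ q)) ⊗ conj (conj (W (e (+ q)))) ≈⟨ ≋ᴱ-⊗ (Q.refl {W (e (+ q))}) (conj-≋ (Q.sym value)) ⟩
    W (e (+ q)) ⊗ conj (c ^ᴱ k) ≡⟨ cong (W (e (+ q)) ⊗_) (conj-c^ k) ⟩
    W (e (+ q)) ⊗ (ι ((+ ℓ) ^ k) ⊗ conj J ^ᴱ k) ≡⟨ ⊗-swap (W (e (+ q))) (ι ((+ ℓ) ^ k)) (conj J ^ᴱ k) ⟩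
    ι ((+ ℓ) ^ k) ⊗ (W (e (+ q)) ⊗ conj J ^ᴱ k) ∎)
    where
    open Modulo q
    module Q = CommutativeRing (𝔼/ q)
    open SetoidReasoning Q.setoid
    q⁻¹ : ℤ
    q⁻¹ = q-inverse q-prime q≢ℓ
    value : c ^ᴱ k ≋ᴱ conj (W (e (+ q))) ⟨ q ⟩
    value = Q.trans (scalar-g-injective (O.trans (O.sym (gauss-power k)) (O.trans (O.reflexive (cong (g ^ₒ_) (sym eq)))
      (O.trans (gauss-frobenius q-prime q≢ℓ) (O.trans
        (element-cong {λ a → χ (q⁻¹ * a) ^ᴱ q} λ a → ≡⇒≋ᴱ (trans (χ-^-≡1 {k = k} q-prime eq (q⁻¹ * a)) (χ-* q⁻¹ a)))
        (O.sym (scalar-element (χ q⁻¹) χ)))))))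
      (≡⇒≋ᴱ (χ-q⁻¹ q-prime q≢ℓ))

  -- Now χ^q = χ̄, so Frobenius gives g^q = χ(q) ḡ. The exponent 3 k + 1 is q + 2, and the two extra
  -- factors `g` turn this into χ(q) ℓ g.
  reciprocity₂ : ∀ {q k} → Prime q → q ≢ ℓ → suc q ≡ 3 ℕ.* k → conj J ^ᴱ k ≋ᴱ W (e (+ q)) ⊗ J ^ᴱ k ⟨ q ⟩
  reciprocity₂ {q} {k} q-prime q≢ℓ eq = ι-cancel q-prime (ℓ^-unit q-prime q≢ℓ k) (begin
    ι ((+ ℓ) ^ k) ⊗ conj J ^ᴱ k ≡⟨ conj-c^ k ⟨
    conj (c ^ᴱ k) ≈⟨ conj-≋ value ⟩
    conj (z ⊗ ι (+ ℓ)) ≡⟨ conj-⊗ z (ι (+ ℓ)) ⟩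
    conj z ⊗ conj (ι (+ ℓ)) ≡⟨ cong₂ _⊗_ (sym (W-square (e (+ q)))) (cong (⟪_, 0ℤ ⟫) (ℤ.+-identityʳ (+ ℓ))) ⟩
    z ⊗ z ⊗ ι (+ ℓ) ≡⟨ ⊗-assoc z z (ι (+ ℓ)) ⟩
    z ⊗ (z ⊗ ι (+ ℓ)) ≈⟨ ≋ᴱ-⊗ (Q.refl {z}) (Q.sym value) ⟩
    z ⊗ c ^ᴱ k ≡⟨ cong (z ⊗_) (c^ k) ⟩
    z ⊗ (ι ((+ ℓ) ^ k) ⊗ J ^ᴱ k) ≡⟨ ⊗-swap z (ι ((+ ℓ) ^ k)) (J ^ᴱ k) ⟩
    ι ((+ ℓ) ^ k) ⊗ (z ⊗ J ^ᴱ k) ∎)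
    where
    open Modulo q
    module Q = CommutativeRing (𝔼/ q)
    open SetoidReasoning Q.setoid
    q⁻¹ : ℤ
    q⁻¹ = q-inverse q-prime q≢ℓ
    z : 𝔼
    z = W (e (+ q))
    χ̄q⁻¹ : χ̄ q⁻¹ ≡ z
    χ̄q⁻¹ = trans (cong conj (χ-q⁻¹ q-prime q≢ℓ)) (conj-conj z)
    frobenius : g ^ₒ q ≈ₒ scalar z *ₒ ḡ
    frobenius = O.trans (gauss-frobenius q-prime q≢ℓ) (O.trans
      (element-cong {λ a → χ (q⁻¹ * a) ^ᴱ q} λ a → ≡⇒≋ᴱ (trans (χ-^-≡2 {k = k} q-prime eq (q⁻¹ * a)) (trans (χ̄-* q⁻¹ a) (cong (_⊗ χ̄ a) χ̄q⁻¹))))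
      (O.sym (scalar-element z χ̄)))
    value : c ^ᴱ k ≋ᴱ z ⊗ ι (+ ℓ) ⟨ q ⟩
    value = scalar-g-injective (O.trans (O.sym (gauss-power k)) (O.trans (O.reflexive (cong (λ n → g *ₒ g ^ₒ n) (sym eq)))
      (O.trans (O.*-congˡ {g} (O.*-congˡ {g} frobenius)) (gḡ-twist z))))

-- The cubic character and the Jacobi sum attached to a root of r² + r + 1 modulo ℓ

module FromRoot {ℓ : ℕ} (ℓ-prime : Prime ℓ) (ℓ≢3 : ℓ ≢ 3) {r : ℤ} (root : + ℓ ∣ r * r + r + 1ℤ) where

  private instance
    ℓ≢0 : NonZero ℓ
    ℓ≢0 = prime⇒nonZero ℓ-prime

  ℓ∤3 : ¬ (+ ℓ ∣ + 3)
  ℓ∤3 d = ℓ≢3 (prime∣prime ℓ-prime prime[3] d)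

  r³≋1 : r * r * r ≋ 1ℤ ⟨ ℓ ⟩
  r³≋1 = mod (∣-resp (lem r) (∣m⇒∣m*n (r - 1ℤ) root))
    where
    lem : ∀ r → (r * r + r + 1ℤ) * (r - 1ℤ) ≡ r * r * r - 1ℤ
    lem = solve-∀

  ℓ∤r : ¬ (+ ℓ ∣ r)
  ℓ∤r d = prime∤1 ℓ-prime (≋-∣ (≋-sym r³≋1) (∣n⇒∣m*n (r * r) d))

  ℓ∤1-r : ¬ (+ ℓ ∣ 1ℤ - r)
  ℓ∤1-r d = ℓ∤3 (∣-resp (lem r) (∣m∣n⇒∣m+n root (∣m⇒∣m*n (r + + 2) d)))
    where
    lem : ∀ r → r * r + r + 1ℤ + (1ℤ - r) * (r + + 2) ≡ + 3
    lem = solve-∀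

  -- Reduction modulo one of the two primes of 𝔼 above ℓ, with ω ↦ r. The character below is chosen
  -- so that `ρ` maps χ(a) to a^k.
  ρ : 𝔼 → ℤ
  ρ x = re x + im x * r

  ρ-⊗ : ∀ x y → ρ (x ⊗ y) ≋ ρ x * ρ y ⟨ ℓ ⟩
  ρ-⊗ ⟪ a , b ⟫ ⟪ c , d ⟫ = mod (∣-resp (lem a b c d r) (∣n⇒∣m*n (- (b * d)) root))
    where
    lem : ∀ a b c d r → - (b * d) * (r * r + r + 1ℤ) ≡ a * c - b * d + (a * d + b * c - b * d) * r - (a + b * r) * (c + d * r)
    lem = solve-∀

  ρ-⊕ : ∀ x y → ρ (x ⊕ y) ≡ ρ x + ρ y
  ρ-⊕ ⟪ a , b ⟫ ⟪ c , d ⟫ = lem a b c d r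
    where
    lem : ∀ a b c d r → a + c + (b + d) * r ≡ a + b * r + (c + d * r)
    lem = solve-∀

  ρ-^ : ∀ x n → ρ (x ^ᴱ n) ≋ ρ x ^ n ⟨ ℓ ⟩
  ρ-^ x zero    = ≋-refl
  ρ-^ x (suc n) = ≋-trans (ρ-⊗ x (x ^ᴱ n)) (≋-*ˡ (ρ x) (ρ-^ x n))

  private
    -- If ℓ = 3 k + 2, then r³ ≡ 1 and r^(3 k + 1) ≡ 1 force r ≡ 1, so that r² + r + 1 ≡ 3 would
    -- vanish modulo ℓ.
    exponent : ∃[ k ] ℓ ≡ suc (3 ℕ.* k)
    exponent with prime-mod-3 ℓ-prime ℓ≢3
    ... | inj₁ h = h
    ... | inj₂ (zero , ())
    ... | inj₂ (suc k , eq) = contradiction (∣-resp (lem₁ r) (∣m⇒∣-m (unmod r≋1))) ℓ∤1-r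
      where
      lem₁ : ∀ r → - (r - 1ℤ) ≡ 1ℤ - r
      lem₁ = solve-∀
      lem₂ : ∀ r → r * (r * (r * 1ℤ)) ≡ r * r * r
      lem₂ = solve-∀
      pow : r ^ (3 ℕ.* k) ≋ 1ℤ ⟨ ℓ ⟩
      pow = ≋-trans (≡⇒≋ (sym (ℤ.^-*-assoc r 3 k))) (≋-trans (≋-^ k (≋-trans (≡⇒≋ (lem₂ r)) r³≋1)) (≡⇒≋ (1^ k)))
      r≋1 : r ≋ 1ℤ ⟨ ℓ ⟩
      r≋1 = ≋-trans (≋-trans (≡⇒≋ (sym (ℤ.*-identityʳ r))) (≋-*ˡ r (≋-sym pow)))
        (fermat-unit ℓ-prime (ℕ.suc-injective (trans eq (ℕ.*-suc 3 k))) ℓ∤r)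

  k : ℕ
  k = proj₁ exponent

  ℓ≡1+3k : ℓ ≡ suc (3 ℕ.* k)
  ℓ≡1+3k = proj₂ exponent

  k-positive : k ≢ 0
  k-positive k≡0 = ¬prime[1] (subst Prime (trans ℓ≡1+3k (cong (λ m → suc (3 ℕ.* m)) k≡0)) ℓ-prime)

  ρ-W-kernel : ∀ {x} → ρ (W x) ≋ 1ℤ ⟨ ℓ ⟩ → x ≋ 0ℤ ⟨ 3 ⟩
  ρ-W-kernel {x} h = ≋-trans (≋-sym (residue-≋ 3 x)) (≡⇒≋ (cong (λ i → + toℕ i) (table (residue 3 x) h)))
    where
    lem₁ : ∀ r → - (0ℤ + 1ℤ * r - 1ℤ) ≡ 1ℤ - r
    lem₁ = solve-∀
    lem₂ : ∀ r → r * r + r + 1ℤ - (-1ℤ + -1ℤ * r - 1ℤ) * (1ℤ - r) ≡ + 3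
    lem₂ = solve-∀
    table : ∀ i → ρ (ωPow₃ i) ≋ 1ℤ ⟨ ℓ ⟩ → i ≡ zero
    table zero _ = refl
    table (suc zero) (mod h) = contradiction (∣-resp (lem₁ r) (∣m⇒∣-m h)) ℓ∤1-r
    table (suc (suc zero)) (mod h) = contradiction (∣-resp (lem₂ r) (∣m∣n⇒∣m-n root (∣m⇒∣m*n (1ℤ - r) h))) ℓ∤3

  ρ-W-injective : ∀ {x y} → ρ (W x) ≋ ρ (W y) ⟨ ℓ ⟩ → x ≋ y ⟨ 3 ⟩
  ρ-W-injective {x} {y} h = mod (∣-resp (lem x y) (unmod (ρ-W-kernel {x - y} (≋-trans (≡⇒≋ (cong ρ (W-+ x (- y))))
    (≋-trans (ρ-⊗ (W x) (W (- y))) (≋-trans (≋-*ʳ (ρ (W (- y))) h) (≋-trans (≋-sym (ρ-⊗ (W y) (W (- y))))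
    (≡⇒≋ (cong ρ (trans (sym (W-+ y (- y))) (cong W (ℤ.+-inverseʳ y))))))))))))
    where
    lem : ∀ x y → x - y - 0ℤ ≡ x - y
    lem = solve-∀

  cube-root : ∀ {u} → u * (u * (u * 1ℤ)) ≋ 1ℤ ⟨ ℓ ⟩ → ∃[ i ] ρ (ωPow₃ i) ≋ u ⟨ ℓ ⟩
  cube-root {u} (mod h) = go (prime∣* ℓ-prime (u - 1ℤ) ((u - r) * (u + 1ℤ + r)) (∣-resp (lem u r) (∣m∣n⇒∣m-n h (∣n⇒∣m*n (u - 1ℤ) root))))
    where
    lem : ∀ u r → u * (u * (u * 1ℤ)) - 1ℤ - (u - 1ℤ) * (r * r + r + 1ℤ) ≡ (u - 1ℤ) * ((u - r) * (u + 1ℤ + r))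
    lem = solve-∀
    lem₀ : ∀ r → 1ℤ + 0ℤ * r ≡ 1ℤ
    lem₀ = solve-∀
    lem₁ : ∀ r → 0ℤ + 1ℤ * r ≡ r
    lem₁ = solve-∀
    lem₂ : ∀ u r → u + 1ℤ + r ≡ u - (-1ℤ + -1ℤ * r)
    lem₂ = solve-∀
    go′ : (+ ℓ ∣ u - r) ⊎ (+ ℓ ∣ u + 1ℤ + r) → ∃[ i ] ρ (ωPow₃ i) ≋ u ⟨ ℓ ⟩
    go′ (inj₁ d) = suc zero , ≋-trans (≡⇒≋ (lem₁ r)) (≋-sym (mod d))
    go′ (inj₂ d) = suc (suc zero) , ≋-sym (mod (∣-resp (lem₂ u r) d))
    go : (+ ℓ ∣ u - 1ℤ) ⊎ (+ ℓ ∣ (u - r) * (u + 1ℤ + r)) → ∃[ i ] ρ (ωPow₃ i) ≋ u ⟨ ℓ ⟩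
    go (inj₁ d) = zero , ≋-trans (≡⇒≋ (lem₀ r)) (≋-sym (mod d))
    go (inj₂ d) = go′ (prime∣* ℓ-prime (u - r) (u + 1ℤ + r) d)

  power-is-root : ∀ {a} → ¬ (+ ℓ ∣ a) → ∃[ i ] ρ (ωPow₃ i) ≋ a ^ k ⟨ ℓ ⟩
  power-is-root {a} na = cube-root (≋-trans (≡⇒≋ (trans (ℤ.^-*-assoc a k 3) (cong (a ^_) (ℕ.*-comm k 3)))) (fermat-unit ℓ-prime ℓ≡1+3k na))

  e : ℤ → ℤ
  e a with + ℓ ∣? a
  -- A default value, constant on the multiples of ℓ so that `e-cong` holds for all integers.
  ... | yes _ = 0ℤ
  ... | no na = + toℕ (proj₁ (power-is-root na))

  ρ-e : ∀ {a} → ¬ (+ ℓ ∣ a) → ρ (W (e a)) ≋ a ^ k ⟨ ℓ ⟩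
  ρ-e {a} na with + ℓ ∣? a
  ... | yes d = contradiction d na
  ... | no na′ = ≋-trans (≡⇒≋ (cong ρ (W-toℕ (proj₁ (power-is-root na′))))) (proj₂ (power-is-root na′))

  private
    0^k : 0ℤ ^ k ≡ 0ℤ
    0^k = go k k-positive
      where
      go : ∀ k → k ≢ 0 → 0ℤ ^ k ≡ 0ℤ
      go zero    k≢0 = contradiction refl k≢0
      go (suc k) _   = refl

    k<ℓ-1 : ∀ {j} → j ℕ.≤ k ℕ.+ k → suc j ℕ.< ℓ
    k<ℓ-1 {j} j≤2k = subst (suc j ℕ.<_) (sym ℓ≡1+3k) (ℕ.s<s (ℕ.≤-<-trans j≤2k (subst (k ℕ.+ k ℕ.<_) (sum k) (ℕ.m<m+n (k ℕ.+ k) (ℕ.n≢0⇒n>0 k-positive)))))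
      where
      sum : ∀ k → k ℕ.+ k ℕ.+ k ≡ 3 ℕ.* k
      sum = solveℕ-∀

    e-* : ∀ {x y} → ¬ (+ ℓ ∣ x) → ¬ (+ ℓ ∣ y) → e (x * y) ≋ e x + e y ⟨ 3 ⟩
    e-* {x} {y} nx ny = ρ-W-injective (≋-trans (ρ-e (∤-* ℓ-prime nx ny)) (≋-trans (≡⇒≋ (*-^ x y k))
      (≋-trans (≋-* (≋-sym (ρ-e nx)) (≋-sym (ρ-e ny))) (≋-trans (≋-sym (ρ-⊗ (W (e x)) (W (e y)))) (≡⇒≋ (cong ρ (sym (W-+ (e x) (e y)))))))))

    e-zero : ∀ {x} → + ℓ ∣ x → e x ≡ 0ℤ
    e-zero {x} d with + ℓ ∣? x
    ... | yes _ = refl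
    ... | no nd = contradiction d nd

    e-cong : ∀ {x y} → x ≋ y ⟨ ℓ ⟩ → e x ≋ e y ⟨ 3 ⟩
    e-cong {x} {y} h = go (+ ℓ ∣? y)
      where
      go : Dec (+ ℓ ∣ y) → e x ≋ e y ⟨ 3 ⟩
      go (yes d) = ≡⇒≋ (trans (e-zero (≋-∣ h d)) (sym (e-zero d)))
      go (no nd) = ρ-W-injective (≋-trans (ρ-e (nd ∘ ≋-∣ (≋-sym h))) (≋-trans (≋-^ k h) (≋-sym (ρ-e nd))))

  open PowerSums ℓ-prime
  private
    module Σℤ = ResidueSum (ℤ/ ℓ) ℓ

    power-degree : Degree≤ (k ℕ.+ 0) (λ x → x ^ k)
    power-degree = degree-resp (λ x → trans (ℤ.*-identityʳ _) (cong (_^ k) (lem x))) (degree-^ 1ℤ 0ℤ k degree-1)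
      where
      lem : ∀ x → 1ℤ * x + 0ℤ ≡ x
      lem = solve-∀

    Σ-power : Σℤ.Σ (λ x → x ^ k) ≋ 0ℤ ⟨ ℓ ⟩
    Σ-power = Σ-degree power-degree (k<ℓ-1 (ℕ.+-monoʳ-≤ k ℕ.z≤n))

    Σ-power² : Σℤ.Σ (λ x → (1ℤ - x) ^ k * x ^ k) ≋ 0ℤ ⟨ ℓ ⟩
    Σ-power² = Σ-degree (degree-resp (λ x → cong (λ z → z ^ k * x ^ k) (lem x)) (degree-^ -1ℤ 1ℤ k power-degree))
      (k<ℓ-1 (ℕ.+-monoʳ-≤ k (ℕ.≤-reflexive (ℕ.+-identityʳ k))))
      where
      lem : ∀ x → -1ℤ * x + 1ℤ ≡ 1ℤ - x
      lem = solve-∀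

    -- If every unit had trivial symbol, the k-th powers would sum to ℓ - 1 ≡ -1, whereas `Σ-power`
    -- says 0.
    not-all-cubes : ¬ (∀ (i : Fin ℓ) → (+ ℓ ∣ + toℕ i) ⊎ (+ 3 ∣ e (+ toℕ i)))
    not-all-cubes all = prime∤1 ℓ-prime (∣-resp (lem (+ ℓ)) (∣m∣n⇒∣m-n ∣-refl (≋0⇒∣ (≋-trans (≋-sym total) Σ-power))))
      where
      lem : ∀ l → l - (1ℤ * l + -1ℤ * 1ℤ) ≡ 1ℤ
      lem = solve-∀
      Σ1 : Σℤ.Σ (λ _ → 1ℤ) ≡ + ℓ
      Σ1 = go ℓ
        where
        go : ∀ n → SemiringSum.sum (CommutativeRing.semiring (ℤ/ ℓ)) {n} (λ _ → 1ℤ) ≡ + n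
        go zero    = refl
        go (suc n) = cong (λ x → 1ℤ + x) (go n)
      value : ∀ i → (+ toℕ i) ^ k ≋ 1ℤ * 1ℤ + -1ℤ * (1ℤ * Σℤ.δ (+ toℕ i)) ⟨ ℓ ⟩
      value i = go (+ ℓ ∣? (+ toℕ i))
        where
        x : ℤ
        x = + toℕ i
        lem′ : ∀ {d} → d ≋ 1ℤ ⟨ ℓ ⟩ → 1ℤ * 1ℤ + -1ℤ * (1ℤ * d) ≋ 0ℤ ⟨ ℓ ⟩
        lem′ h = ≋-+ˡ 1ℤ (≋-*ˡ -1ℤ (≋-*ˡ 1ℤ h))
        lem″ : ∀ {d} → d ≋ 0ℤ ⟨ ℓ ⟩ → 1ℤ * 1ℤ + -1ℤ * (1ℤ * d) ≋ 1ℤ ⟨ ℓ ⟩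
        lem″ h = ≋-+ˡ 1ℤ (≋-*ˡ -1ℤ (≋-*ˡ 1ℤ h))
        cube : ¬ (+ ℓ ∣ x) → (+ ℓ ∣ x) ⊎ (+ 3 ∣ e x) → x ^ k ≋ 1ℤ ⟨ ℓ ⟩
        cube nd (inj₁ d) = contradiction d nd
        cube nd (inj₂ d) = ≋-trans (≋-sym (ρ-e nd)) (≡⇒≋ (cong ρ (W-cong {e x} {0ℤ} (∣⇒≋0 d))))
        go : Dec (+ ℓ ∣ x) → x ^ k ≋ 1ℤ * 1ℤ + -1ℤ * (1ℤ * Σℤ.δ x) ⟨ ℓ ⟩
        go (yes d) = ≋-trans (≋-^ k (∣⇒≋0 d)) (≋-trans (≡⇒≋ 0^k) (≋-sym (lem′ (Σℤ.δ-zero d))))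
        go (no nd) = ≋-trans (cube nd (all i)) (≋-sym (lem″ (Σℤ.δ-nonzero nd)))
      total : Σℤ.Σ (λ x → x ^ k) ≋ 1ℤ * + ℓ + -1ℤ * 1ℤ ⟨ ℓ ⟩
      total = ≋-trans (Σℤ.sum-cong value) (≋-trans (Σ-linear 1ℤ -1ℤ (λ _ → 1ℤ) (λ x → 1ℤ * Σℤ.δ x))
        (≋-+ (≋-*ˡ 1ℤ (≡⇒≋ Σ1)) (≋-*ˡ -1ℤ (Σℤ.Σ-δ (λ _ → 1ℤ)))))

    CubeAt : Fin ℓ → Set
    CubeAt i = (+ ℓ ∣ + toℕ i) ⊎ (+ 3 ∣ e (+ toℕ i))

    non-cube : ∃[ i ] ¬ CubeAt i
    non-cube = Fin.¬∀⟶∃¬ ℓ CubeAt (λ i → (+ ℓ ∣? (+ toℕ i)) ⊎-dec (+ 3 ∣? e (+ toℕ i))) not-all-cubes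

    nontrivial : ∃[ b ] ¬ (+ ℓ ∣ b) × ¬ (e b ≋ 0ℤ ⟨ 3 ⟩)
    nontrivial = + toℕ (proj₁ non-cube) , proj₂ non-cube ∘ inj₁ , λ h → proj₂ non-cube (inj₂ (≋0⇒∣ h))

  character : CubicCharacter ℓ
  character = record { e = e ; e-cong = e-cong ; e-* = e-* ; nontrivial = nontrivial }

  open Jacobi ℓ-prime character public hiding (convolve-unit; convolve-χχ; convolve-χ̄χ̄; convolve-χχ̄)
  open Gauss ℓ-prime character public

  ρ-χ : ∀ a → ρ (χ a) ≋ a ^ k ⟨ ℓ ⟩
  ρ-χ a = go (+ ℓ ∣? a)
    where
    go : Dec (+ ℓ ∣ a) → ρ (χ a) ≋ a ^ k ⟨ ℓ ⟩
    go (yes d) = ≋-trans (≡⇒≋ (cong ρ (χ-zero d))) (≋-trans (≡⇒≋ (sym 0^k)) (≋-^ k (≋-sym (∣⇒≋0 d))))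
    go (no nd) = ≋-trans (≡⇒≋ (cong ρ (χ-unit nd))) (ρ-e nd)

  -- `ρ` maps J to the sum of a^k (1 - a)^k, a polynomial of degree 2 k < ℓ - 1. So J lies in the
  -- prime above ℓ that r singles out.
  ρ-J : ρ J ≋ 0ℤ ⟨ ℓ ⟩
  ρ-J = ≋-trans (≡⇒≋ (ρ-sum {ℓ} (λ i → χ (+ toℕ i) ⊗ χ (1ℤ - + toℕ i)))) (≋-trans
    (Σℤ.Σ-cong {λ a → ρ (χ a ⊗ χ (1ℤ - a))} λ a → ≋-trans (ρ-⊗ (χ a) (χ (1ℤ - a)))
      (≋-trans (≋-* (ρ-χ a) (ρ-χ (1ℤ - a))) (≡⇒≋ (ℤ.*-comm (a ^ k) ((1ℤ - a) ^ k)))))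
    Σ-power²)
    where
    ρ-sum : ∀ {n} (t : Fin n → 𝔼) → ρ (SemiringSum.sum (CommutativeRing.semiring 𝔼-ring) t)
      ≡ SemiringSum.sum (CommutativeRing.semiring (ℤ/ ℓ)) (λ i → ρ (t i))
    ρ-sum {zero}  t = ℤ.+-identityˡ 0ℤ
    ρ-sum {suc n} t = trans (ρ-⊕ (t zero) _) (cong (λ z → ρ (t zero) + z) (ρ-sum (t ∘ suc)))

  -- r is the image of ω, hence r^k that of ω^k: the supplementary law for ω.
  e-root : e r ≋ + k ⟨ 3 ⟩
  e-root = ρ-W-injective (≋-trans (ρ-e ℓ∤r) (≋-sym (≋-trans (≡⇒≋ (cong ρ (sym (trans (W-^ 1ℤ k) (cong W (ℤ.*-identityʳ (+ k)))))))
    (≋-trans (ρ-^ (W 1ℤ) k) (≡⇒≋ (cong (_^ k) (lem r)))))))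
    where
    lem : ∀ r → 0ℤ + 1ℤ * r ≡ r
    lem = solve-∀

-- Cubic residue symbols

norm-conj : ∀ x → norm (conj x) ≡ norm x
norm-conj ⟪ a , b ⟫ = lem a b
  where
  lem : ∀ a b → (a - b) * (a - b) - (a - b) * (- b) + (- b) * (- b) ≡ a * a - a * b + b * b
  lem = solve-∀

norm-^ : ∀ x n → norm (x ^ᴱ n) ≡ norm x ^ n
norm-^ x zero    = refl
norm-^ x (suc n) = trans (norm-⊗ x (x ^ᴱ n)) (cong (norm x *_) (norm-^ x n))

≋ᴱ-^ : ∀ {q x y} n → x ≋ᴱ y ⟨ q ⟩ → x ^ᴱ n ≋ᴱ y ^ᴱ n ⟨ q ⟩
≋ᴱ-^ zero    h = ≡⇒≋ᴱ refl
≋ᴱ-^ (suc n) h = ≋ᴱ-⊗ h (≋ᴱ-^ n h)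

⊗-cancelʳ : ∀ {q} → Prime q → ∀ {y} → ¬ (+ q ∣ norm y) → ∀ {x z} → x ⊗ y ≋ᴱ z ⊗ y ⟨ q ⟩ → x ≋ᴱ z ⟨ q ⟩
⊗-cancelʳ {q} q-prime {y} ny {x} {z} h = ι-cancel q-prime ny (Q.trans (≡⇒≋ᴱ (eq x)) (Q.trans (≋ᴱ-⊗ h (Q.refl {conj y})) (≡⇒≋ᴱ (sym (eq z)))))
  where
  module Q = CommutativeRing (𝔼/ q)
  lem : ∀ x y z → y ⊗ z ⊗ x ≡ x ⊗ y ⊗ z
  lem = TR.solve-∀ 𝔼-solver
  eq : ∀ x → ι (norm y) ⊗ x ≡ x ⊗ y ⊗ conj y
  eq x = trans (cong (_⊗ x) (sym (⊗-conj y))) (lem x y (conj y))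

square≋1 : ∀ {x} → ¬ (+ 3 ∣ x) → 1ℤ - x * x ≋ 0ℤ ⟨ 3 ⟩
square≋1 {x} nx = ≋-+ˡ 1ℤ (≋-neg (≋-trans (≡⇒≋ (cong (x *_) (sym (ℤ.*-identityʳ x)))) (fermat-unit prime[3] refl nx)))

3∣*3∣⇒9∣ : ∀ {x y} → + 3 ∣ x → + 3 ∣ y → + 9 ∣ x * y
3∣*3∣⇒9∣ (divides s eq) (divides t eq′) = divides (s * t) (trans (cong₂ _*_ eq eq′) (lem s t))
  where
  lem : ∀ s t → s * + 3 * (t * + 3) ≡ s * t * + 9
  lem = solve-∀

*3-cancel : ∀ {a b} → + 3 * a ≋ + 3 * b ⟨ 9 ⟩ → a ≋ b ⟨ 3 ⟩
*3-cancel {a} {b} (mod h) = mod (*-cancelˡ-∣ (+ 3) (∣-resp (lem a b) h))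
  where
  lem : ∀ a b → + 3 * a - + 3 * b ≡ + 3 * (a - b)
  lem = solve-∀

*3-mono : ∀ {a b} → a ≋ b ⟨ 3 ⟩ → + 3 * a ≋ + 3 * b ⟨ 9 ⟩
*3-mono {a} {b} (mod (divides t eq)) = mod (divides t (trans (lem a b) (trans (cong (+ 3 *_) eq) (lem′ t))))
  where
  lem : ∀ a b → + 3 * a - + 3 * b ≡ + 3 * (a - b)
  lem = solve-∀
  lem′ : ∀ t → + 3 * (t * + 3) ≡ t * + 9
  lem′ = solve-∀

Coprime : 𝔼 → ℤ → Set
Coprime β x = ∀ {ℓ} → Prime ℓ → + ℓ ∣ norm β → ¬ (+ ℓ ∣ x)

-- e x is the exponent of the rational cubic residue symbol (x / β)₃, and the
-- reciprocity fields express (q / β)₃ = (β / q)₃ (β̄ / q)₃⁻¹.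
record Symbol (β : 𝔼) : Set where
  field
    e      : ℤ → ℤ
    e-cong : ∀ {x y} → norm β ∣ x - y → e x ≋ e y ⟨ 3 ⟩
    e-*    : ∀ {x y} → Coprime β x → Coprime β y → e (x * y) ≋ e x + e y ⟨ 3 ⟩
    recip₁ : ∀ {q k} → Prime q → ¬ (+ q ∣ norm β) → q ≡ suc (3 ℕ.* k) → β ^ᴱ k ≋ᴱ W (e (+ q)) ⊗ conj β ^ᴱ k ⟨ q ⟩
    recip₂ : ∀ {q k} → Prime q → ¬ (+ q ∣ norm β) → suc q ≡ 3 ℕ.* k → conj β ^ᴱ k ≋ᴱ W (e (+ q)) ⊗ β ^ᴱ k ⟨ q ⟩

SelfConjugate : ℕ → 𝔼 → Set
SelfConjugate q δ = (δ ≋ᴱ conj δ ⟨ q ⟩) ⊎ (δ ≋ᴱ ⊖ conj δ ⟨ q ⟩)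

module _ {q : ℕ} (q-prime : Prime q) where

  private
    ∤-1 : ¬ (+ q ∣ -1ℤ)
    ∤-1 d = prime∤1 q-prime (∣m⇒∣-m d)

    -1^3k : ∀ k → -1ℤ ^ (3 ℕ.* k) ≡ -1ℤ ^ k
    -1^3k k = sym (ℤ.^-*-assoc -1ℤ 3 k)

  -1^₁ : ∀ {k} → q ≡ suc (3 ℕ.* k) → -1ℤ ^ k ≋ 1ℤ ⟨ q ⟩
  -1^₁ {k} eq = ≋-trans (≡⇒≋ (sym (-1^3k k))) (fermat-unit q-prime eq ∤-1)

  -- (-1)^k = (-1)^(3 k) = (-1)^(q + 1). Fermat treats q = 2, where k = 1 is odd, together with odd
  -- q.
  -1^₂ : ∀ {k} → suc q ≡ 3 ℕ.* k → -1ℤ ^ k ≋ 1ℤ ⟨ q ⟩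
  -1^₂ {k} eq = ≋-trans (≡⇒≋ (trans (sym (-1^3k k)) (cong (-1ℤ ^_) (sym eq)))) (≋-*ˡ -1ℤ (fermat q-prime -1ℤ))

  self-conjugate-^ : ∀ {δ k} → SelfConjugate q δ → -1ℤ ^ k ≋ 1ℤ ⟨ q ⟩ → δ ^ᴱ k ≋ᴱ conj δ ^ᴱ k ⟨ q ⟩
  self-conjugate-^ {δ} {k} (inj₁ h) _ = ≋ᴱ-^ k h
  self-conjugate-^ {δ} {k} (inj₂ h) -1^k = begin
    δ ^ᴱ k ≈⟨ ≋ᴱ-^ k h ⟩
    (⊖ conj δ) ^ᴱ k ≡⟨ cong (_^ᴱ k) (lem (conj δ)) ⟩
    (ι -1ℤ ⊗ conj δ) ^ᴱ k ≡⟨ ⊗-^ (ι -1ℤ) (conj δ) k ⟩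
    ι -1ℤ ^ᴱ k ⊗ conj δ ^ᴱ k ≡⟨ cong (_⊗ conj δ ^ᴱ k) (ι-^ -1ℤ k) ⟩
    ι (-1ℤ ^ k) ⊗ conj δ ^ᴱ k ≈⟨ ≋ᴱ-⊗ (ι-≋ -1^k) (Q.refl {conj δ ^ᴱ k}) ⟩
    1ᴱ ⊗ conj δ ^ᴱ k ≡⟨ ⊗-identityˡ (conj δ ^ᴱ k) ⟩
    conj δ ^ᴱ k ∎
    where
    module Q = CommutativeRing (𝔼/ q)
    open SetoidReasoning Q.setoid
    lem : ∀ x → ⊖ x ≡ ι -1ℤ ⊗ x
    lem x = sym (trans (⊗-ι -1ℤ x) (cong₂ ⟪_,_⟫ (ℤ.-1*i≡-i (re x)) (ℤ.-1*i≡-i (im x))))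

module _ {β : 𝔼} (σ : Symbol β) (j : ℤ) where

  open Symbol σ

  private
    δ : 𝔼
    δ = W j ⊗ β

    δ^ : ∀ k → δ ^ᴱ k ≡ W (+ k * j) ⊗ β ^ᴱ k
    δ^ k = trans (⊗-^ (W j) β k) (cong (_⊗ β ^ᴱ k) (W-^ j k))

    conj-δ^ : ∀ k → conj δ ^ᴱ k ≡ W (- (+ k * j)) ⊗ conj β ^ᴱ k
    conj-δ^ k = trans (sym (conj-^ δ k)) (trans (cong conj (δ^ k)) (trans (conj-⊗ (W (+ k * j)) (β ^ᴱ k))
      (cong₂ _⊗_ (sym (W-neg (+ k * j))) (conj-^ β k))))

  -- Reciprocity for β and δ^k ≡ δ̄^k leave an identity between powers of ω: e(q) ≡ - 2 k j for q =
  -- 1 + 3 k, and e(q) ≡ 2 k j for q = 3 k - 1. Both are j (1 - q²) / 3 modulo 3.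
  symbol-at-prime : ∀ {q} → Prime q → q ≢ 3 → ¬ (+ q ∣ norm β) → SelfConjugate q δ → + 3 * e (+ q) ≋ j * (1ℤ - + q * + q) ⟨ 9 ⟩
  symbol-at-prime {q} q-prime q≢3 nβ sc = go (prime-mod-3 q-prime q≢3)
    where
    module Q = CommutativeRing (𝔼/ q)
    E : ℤ
    E = e (+ q)
    case₁ : ∀ {k} → q ≡ suc (3 ℕ.* k) → + k * j + E + + k * j ≋ 0ℤ ⟨ 3 ⟩
    case₁ {k} eq = W-kernel q-prime (Q.trans (≡⇒≋ᴱ (W-+ (+ k * j + E) (+ k * j))) (Q.trans
      (≋ᴱ-⊗ cancelled (Q.refl {W (+ k * j)})) (≡⇒≋ᴱ (trans (sym (W-+ (- (+ k * j)) (+ k * j))) (cong W (ℤ.+-inverseˡ (+ k * j)))))))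
      where
      cancelled : W (+ k * j + E) ≋ᴱ W (- (+ k * j)) ⟨ q ⟩
      cancelled = ⊗-cancelʳ q-prime {conj β ^ᴱ k} (subst (λ n → ¬ (+ q ∣ n)) (sym (trans (norm-^ (conj β) k) (cong (_^ k) (norm-conj β)))) (∤-^ q-prime nβ k)) (begin
        W (+ k * j + E) ⊗ conj β ^ᴱ k ≡⟨ cong (_⊗ conj β ^ᴱ k) (W-+ (+ k * j) E) ⟩
        W (+ k * j) ⊗ W E ⊗ conj β ^ᴱ k ≡⟨ ⊗-assoc (W (+ k * j)) (W E) (conj β ^ᴱ k) ⟩
        W (+ k * j) ⊗ (W E ⊗ conj β ^ᴱ k) ≈⟨ ≋ᴱ-⊗ (Q.refl {W (+ k * j)}) (Q.sym (recip₁ {k = k} q-prime nβ eq)) ⟩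
        W (+ k * j) ⊗ β ^ᴱ k ≡⟨ δ^ k ⟨
        δ ^ᴱ k ≈⟨ self-conjugate-^ q-prime {δ} sc (-1^₁ q-prime {k} eq) ⟩
        conj δ ^ᴱ k ≡⟨ conj-δ^ k ⟩
        W (- (+ k * j)) ⊗ conj β ^ᴱ k ∎)
        where open SetoidReasoning Q.setoid
    case₂ : ∀ {k} → suc q ≡ 3 ℕ.* k → - (+ k * j) + E - + k * j ≋ 0ℤ ⟨ 3 ⟩
    case₂ {k} eq = W-kernel q-prime (Q.trans (≡⇒≋ᴱ (W-+ (- (+ k * j) + E) (- (+ k * j)))) (Q.trans
      (≋ᴱ-⊗ cancelled (Q.refl {W (- (+ k * j))})) (≡⇒≋ᴱ (trans (sym (W-+ (+ k * j) (- (+ k * j)))) (cong W (ℤ.+-inverseʳ (+ k * j)))))))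
      where
      cancelled : W (- (+ k * j) + E) ≋ᴱ W (+ k * j) ⟨ q ⟩
      cancelled = ⊗-cancelʳ q-prime {β ^ᴱ k} (subst (λ n → ¬ (+ q ∣ n)) (sym (norm-^ β k)) (∤-^ q-prime nβ k)) (begin
        W (- (+ k * j) + E) ⊗ β ^ᴱ k ≡⟨ cong (_⊗ β ^ᴱ k) (W-+ (- (+ k * j)) E) ⟩
        W (- (+ k * j)) ⊗ W E ⊗ β ^ᴱ k ≡⟨ ⊗-assoc (W (- (+ k * j))) (W E) (β ^ᴱ k) ⟩
        W (- (+ k * j)) ⊗ (W E ⊗ β ^ᴱ k) ≈⟨ ≋ᴱ-⊗ (Q.refl {W (- (+ k * j))}) (Q.sym (recip₂ {k = k} q-prime nβ eq)) ⟩
        W (- (+ k * j)) ⊗ conj β ^ᴱ k ≡⟨ conj-δ^ k ⟨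
        conj δ ^ᴱ k ≈⟨ self-conjugate-^ q-prime {δ} sc (-1^₂ q-prime {k} eq) ⟨
        δ ^ᴱ k ≡⟨ δ^ k ⟩
        W (+ k * j) ⊗ β ^ᴱ k ∎)
        where open SetoidReasoning Q.setoid
    go : (∃[ k ] q ≡ suc (3 ℕ.* k)) ⊎ (∃[ k ] suc q ≡ 3 ℕ.* k) → + 3 * E ≋ j * (1ℤ - + q * + q) ⟨ 9 ⟩
    go (inj₁ (k , eq)) = subst (λ z → + 3 * E ≋ j * (1ℤ - z * z) ⟨ 9 ⟩) (sym (trans (cong +_ eq) (cong (λ z → 1ℤ + z) (ℤ.pos-* 3 k))))
      (mod (∣-resp (lem (+ k) j E) (∣m∣n⇒∣m+n (unmod (*3-mono (case₁ {k} eq))) (∣m⇒∣m*n (+ k * + k * j) ∣-refl))))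
      where
      lem : ∀ k j E → + 3 * (k * j + E + k * j) - + 3 * 0ℤ + + 9 * (k * k * j) ≡ + 3 * E - j * (1ℤ - (1ℤ + + 3 * k) * (1ℤ + + 3 * k))
      lem = solve-∀
    go (inj₂ (k , eq)) = subst (λ z → + 3 * E ≋ j * (1ℤ - z * z) ⟨ 9 ⟩) (sym (trans (pred (+ q)) (trans (cong (λ z → + z - 1ℤ) eq) (cong (_- 1ℤ) (ℤ.pos-* 3 k)))))
      (mod (∣-resp (lem (+ k) j E) (∣m∣n⇒∣m+n (unmod (*3-mono (case₂ {k} eq))) (∣m⇒∣m*n (+ k * + k * j) ∣-refl))))
      where
      pred : ∀ q → q ≡ 1ℤ + q - 1ℤ
      pred = solve-∀
      lem : ∀ k j E → + 3 * (- (k * j) + E - k * j) - + 3 * 0ℤ + + 9 * (k * k * j) ≡ + 3 * E - j * (1ℤ - (+ 3 * k - 1ℤ) * (+ 3 * k - 1ℤ))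
      lem = solve-∀

  e-one : e 1ℤ ≋ 0ℤ ⟨ 3 ⟩
  e-one = ≋-idempotent (e-* (λ pr _ → prime∤1 pr) (λ pr _ → prime∤1 pr))

  coprime-neg1 : Coprime β -1ℤ
  coprime-neg1 pr _ d = prime∤1 pr (∣m⇒∣-m d)

  e-neg-one : e -1ℤ ≋ 0ℤ ⟨ 3 ⟩
  e-neg-one = ≋-halve (e-* coprime-neg1 coprime-neg1) e-one

  -- Conditions imposed prime by prime pass to divisors, so a law known at primes can be carried
  -- along the factorisation of n.
  record Tame (n : ℤ) : Set where
    constructor tame
    field
      at-prime : ∀ {q} → Prime q → + q ∣ n → q ≢ 3 × ¬ (+ q ∣ norm β) × SelfConjugate q δ
  open Tame

  tame-∣ : ∀ {m n} → m ∣ n → Tame n → Tame m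
  tame-∣ d (tame t) = tame λ pr d′ → t pr (∣-trans d′ d)

  tame-coprime : ∀ {n} → Tame n → Coprime β n
  tame-coprime (tame t) pr dβ dn = proj₁ (proj₂ (t pr dn)) dβ

  private
    tame-∤3 : ∀ {n} → Tame n → ¬ (+ 3 ∣ n)
    tame-∤3 (tame t) d = proj₁ (t prime[3] d) refl

    record Law (n : ℤ) : Set where
      constructor law
      field
        lawful : + 3 * e n ≋ j * (1ℤ - n * n) ⟨ 9 ⟩
    open Law

    law-1 : Law 1ℤ
    law-1 = law (≋-trans (*3-mono e-one) (≡⇒≋ (lem j)))
      where
      lem : ∀ j → + 3 * 0ℤ ≡ j * (1ℤ - 1ℤ * 1ℤ)
      lem = solve-∀

    law-* : ∀ {m n} → Tame m → Tame n → Law m → Law n → Law (m * n)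
    law-* {m} {n} tm tn (law lm) (law ln) = law (≋-trans (*3-mono (e-* (tame-coprime tm) (tame-coprime tn))) (≋-trans (≡⇒≋ (ℤ.*-distribˡ-+ (+ 3) (e m) (e n)))
      (≋-trans (≋-+ lm ln) (mod (∣-resp (lem j m n) (∣n⇒∣m*n j (3∣*3∣⇒9∣ (≋0⇒∣ (square≋1 (tame-∤3 tm))) (≋0⇒∣ (square≋1 (tame-∤3 tn))))))))))
      where
      lem : ∀ j m n → j * ((1ℤ - m * m) * (1ℤ - n * n)) ≡ j * (1ℤ - m * m) + j * (1ℤ - n * n) - j * (1ℤ - m * n * (m * n))
      lem = solve-∀

    law-primes : ∀ {qs} → All Prime qs → Tame (+ product qs) → Law (+ product qs)
    law-primes [] t = law-1
    law-primes {q ∷ qs} (pr ∷ prs) t = subst Law (sym (ℤ.pos-* q (product qs))) (law-* {+ q} {+ product qs} tq tqs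
      (law (symbol-at-prime pr (proj₁ at) (proj₁ (proj₂ at)) (proj₂ (proj₂ at)))) (law-primes prs tqs))
      where
      tq : Tame (+ q)
      tq = tame-∣ (divides (+ product qs) (trans (ℤ.pos-* q (product qs)) (ℤ.*-comm (+ q) (+ product qs)))) t
      tqs : Tame (+ product qs)
      tqs = tame-∣ (divides (+ q) (ℤ.pos-* q (product qs))) t
      at : q ≢ 3 × ¬ (+ q ∣ norm β) × SelfConjugate q δ
      at = at-prime tq pr ∣-refl

    law-ℕ : ∀ n → Tame (+ n) → Law (+ n)
    law-ℕ zero    t = contradiction (divides 0ℤ refl) (tame-∤3 t)
    law-ℕ (suc n) t = subst (λ m → Law (+ m)) (sym isFactorisation) (law-primes factorsPrime (subst (λ m → Tame (+ m)) isFactorisation t))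
      where open PrimeFactorisation (factorise (suc n))

  symbol-law : ∀ n → Tame n → + 3 * e n ≋ j * (1ℤ - n * n) ⟨ 9 ⟩
  symbol-law (+ n)      t = lawful (law-ℕ n t)
  symbol-law -[1+ n ]   t = lawful (subst Law (ℤ.-1*i≡-i (+ suc n)) (law-* {m = -1ℤ} {n = + suc n} tm t′ (law (≋-trans (*3-mono e-neg-one) (≡⇒≋ (lem j)))) (law-ℕ (suc n) t′)))
    where
    t′ : Tame (+ suc n)
    t′ = tame-∣ (divides -1ℤ (sym (ℤ.-1*i≡-i (+ suc n)))) t
    tm : Tame -1ℤ
    tm = tame λ pr d → contradiction (∣m⇒∣-m d) (prime∤1 pr)
    lem : ∀ j → + 3 * 0ℤ ≡ j * (1ℤ - -1ℤ * -1ℤ)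
    lem = solve-∀

-- The exponent `A * B` of 3 does not change when β is replaced by - β. For A ≡ -1 modulo 3 it is 2
-- B, as in the classical supplementary law.
record PrimarySymbol (β : 𝔼) : Set where
  field
    symbol  : Symbol β
    A B     : ℤ
    β≡      : β ≡ ⟪ A , + 3 * B ⟫
    3∤A     : ¬ (+ 3 ∣ A)
    e-three : Symbol.e symbol (+ 3) ≋ A * B ⟨ 3 ⟩

self-conjugate⁺ : ∀ {q x} → + q ∣ im x → SelfConjugate q x
self-conjugate⁺ {q} {x} d = inj₁ (modᴱ (mod (∣-resp (lem₁ (re x) (im x)) d)) (≋-trans (∣⇒≋0 d) (≋-neg (≋-sym (∣⇒≋0 d)))))
  where
  lem₁ : ∀ a b → b ≡ a - (a - b)
  lem₁ = solve-∀

self-conjugate⁻ : ∀ {q x} → + q ∣ re x + re x - im x → SelfConjugate q x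
self-conjugate⁻ {q} {x} d = inj₂ (modᴱ (mod (∣-resp (lem₁ (re x) (im x)) d)) (≡⇒≋ (sym (ℤ.neg-involutive (im x)))))
  where
  lem₁ : ∀ a b → a + a - b ≡ a - (- (a - b))
  lem₁ = solve-∀

-- The supplementary law for Jacobi sums

module PrimeSymbol {ℓ : ℕ} (ℓ-prime : Prime ℓ) (ℓ≢3 : ℓ ≢ 3) {r : ℤ} (root : + ℓ ∣ r * r + r + 1ℤ) where

  open FromRoot ℓ-prime ℓ≢3 {r} root public using (J; J-norm; ρ-J)
  open FromRoot ℓ-prime ℓ≢3 {r} root
    using (character; e-root; k; ℓ≡1+3k; e-1; e-neg1; J-primary; reciprocity₁; reciprocity₂; r³≋1; ℓ∤r; ℓ∤1-r)
  open CubicCharacter character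

  norm-J : norm J ≡ + ℓ
  norm-J = cong re (trans (sym (⊗-conj J)) J-norm)

  J-symbol : Symbol J
  J-symbol = record
    { e = e
    ; e-cong = λ {x} {y} d → e-cong (mod (subst (_∣ x - y) norm-J d))
    ; e-* = λ cx cy → e-* (cx ℓ-prime ℓ∣N) (cy ℓ-prime ℓ∣N)
    ; recip₁ = λ {q} {k} pr nq eq → reciprocity₁ {q} {k} pr (λ { refl → nq ℓ∣N }) eq
    ; recip₂ = λ {q} {k} pr nq eq → reciprocity₂ {q} {k} pr (λ { refl → nq ℓ∣N }) eq
    }
    where
    ℓ∣N : + ℓ ∣ norm J
    ℓ∣N = subst (+ ℓ ∣_) (sym norm-J) ∣-refl

  private
    x y : ℤ
    x = re J
    y = im J

    3∤x : ¬ (+ 3 ∣ x)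
    3∤x d = prime∤1 prime[3] (∣m⇒∣-m (≋-∣ (≋-sym (re≋ (J-primary ℓ≢3))) d))

    3∣y : + 3 ∣ y
    3∣y = ≋0⇒∣ (im≋ (J-primary ℓ≢3))

    B : ℤ
    B = _∣_.quotient 3∣y

    y≡3B : y ≡ + 3 * B
    y≡3B = trans (_∣_.equality 3∣y) (ℤ.*-comm B (+ 3))

    norm-xy : x * x - x * y + y * y ≡ + ℓ
    norm-xy = norm-J

    ℓ∤x : ¬ (+ ℓ ∣ x)
    ℓ∤x d = prime∤1 ℓ-prime (both d (prime∣square ℓ-prime y (∣-resp (trans (cong (λ n → n - x * (x - y)) (sym norm-xy)) (lem x y)) (∣m∣n⇒∣m-n ∣-refl (∣m⇒∣m*n (x - y) d)))))
      where
      lem : ∀ x y → x * x - x * y + y * y - x * (x - y) ≡ y * y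
      lem = solve-∀
      lem₂ : ∀ a b l → a * l * (a * l) - a * l * (b * l) + b * l * (b * l) ≡ (a * a - a * b + b * b) * l * l
      lem₂ = solve-∀
      both : + ℓ ∣ x → + ℓ ∣ y → + ℓ ∣ 1ℤ
      both (divides a eq) (divides b eq′) = divides (a * a - a * b + b * b) (sym (ℤ.*-cancelʳ-≡ _ _ (+ ℓ) {{prime⇒nonZero ℓ-prime}}
        (trans (sym (lem₂ a b (+ ℓ))) (trans (sym (cong₂ (λ u v → u * u - u * v + v * v) eq eq′)) (trans norm-xy (sym (ℤ.*-identityˡ (+ ℓ))))))))

    -- `ρ-J` amounts to y ≡ - x r², so x + y ≡ x (1 - r²); now write 1 as r³.
    x+y≋ : x + y ≋ -1ℤ * (x * (r * r * (1ℤ - r))) ⟨ ℓ ⟩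
    x+y≋ = mod (∣-resp (lem x y r) (∣m∣n⇒∣m-n (∣m⇒∣m*n (1ℤ + r * r * (1ℤ - r)) (≋0⇒∣ ρ-J)) (∣m⇒∣m*n (y * (1ℤ - r)) (unmod r³≋1))))
      where
      lem : ∀ x y r → (x + y * r) * (1ℤ + r * r * (1ℤ - r)) - (r * r * r - 1ℤ) * (y * (1ℤ - r)) ≡ x + y - -1ℤ * (x * (r * r * (1ℤ - r)))
      lem = solve-∀

    3≋ : + 3 ≋ -1ℤ * (r * r * ((1ℤ - r) * (1ℤ - r))) ⟨ ℓ ⟩
    3≋ = mod (∣-resp (lem r) (∣m⇒∣m*n (r * r - + 3 * r + + 3) root))
      where
      lem : ∀ r → (r * r + r + 1ℤ) * (r * r - + 3 * r + + 3) ≡ + 3 - -1ℤ * (r * r * ((1ℤ - r) * (1ℤ - r)))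
      lem = solve-∀

    ∤* : ∀ {a b} → ¬ (+ ℓ ∣ a) → ¬ (+ ℓ ∣ b) → ¬ (+ ℓ ∣ a * b)
    ∤* {a} {b} = ∤-* ℓ-prime {a} {b}

    ℓ∤-1 : ¬ (+ ℓ ∣ -1ℤ)
    ℓ∤-1 d = prime∤1 ℓ-prime (∣m⇒∣-m d)

    r² 1-r² : ℤ
    r² = r * r
    1-r² = (1ℤ - r) * (1ℤ - r)

    ℓ∤r² : ¬ (+ ℓ ∣ r²)
    ℓ∤r² = ∤* {r} {r} ℓ∤r ℓ∤r

    ℓ∤1-r² : ¬ (+ ℓ ∣ 1-r²)
    ℓ∤1-r² = ∤* {1ℤ - r} {1ℤ - r} ℓ∤1-r ℓ∤1-r

    ℓ∤r²[1-r] : ¬ (+ ℓ ∣ r² * (1ℤ - r))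
    ℓ∤r²[1-r] = ∤* {r²} {1ℤ - r} ℓ∤r² ℓ∤1-r

    ℓ∤xr²[1-r] : ¬ (+ ℓ ∣ x * (r² * (1ℤ - r)))
    ℓ∤xr²[1-r] = ∤* {x} {r² * (1ℤ - r)} ℓ∤x ℓ∤r²[1-r]

    ℓ∤x+y : ¬ (+ ℓ ∣ x + y)
    ℓ∤x+y d = ∤* { -1ℤ} {x * (r² * (1ℤ - r))} ℓ∤-1 ℓ∤xr²[1-r] (≋-∣ (≋-sym x+y≋) d)

    e-x+y : e (x + y) ≋ e x + (e r + e r + e (1ℤ - r)) ⟨ 3 ⟩
    e-x+y = ≋-trans (e-cong x+y≋) (≋-trans (e-* { -1ℤ} {x * (r² * (1ℤ - r))} ℓ∤-1 ℓ∤xr²[1-r]) (≋-trans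
      (≋-+ e-neg1 (≋-trans (e-* {x} {r² * (1ℤ - r)} ℓ∤x ℓ∤r²[1-r]) (≋-+ˡ (e x) (≋-trans (e-* {r²} {1ℤ - r} ℓ∤r² ℓ∤1-r) (≋-+ʳ (e (1ℤ - r)) (e-* {r} {r} ℓ∤r ℓ∤r))))))
      (≡⇒≋ (ℤ.+-identityˡ (e x + (e r + e r + e (1ℤ - r)))))))

    e-3 : e (+ 3) ≋ e r + e r + (e (1ℤ - r) + e (1ℤ - r)) ⟨ 3 ⟩
    e-3 = ≋-trans (e-cong 3≋) (≋-trans (e-* { -1ℤ} {r² * 1-r²} ℓ∤-1 (∤* {r²} {1-r²} ℓ∤r² ℓ∤1-r²)) (≋-trans
      (≋-+ e-neg1 (≋-trans (e-* {r²} {1-r²} ℓ∤r² ℓ∤1-r²) (≋-+ (e-* {r} {r} ℓ∤r ℓ∤r) (e-* {1ℤ - r} {1ℤ - r} ℓ∤1-r ℓ∤1-r))))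
      (≡⇒≋ (ℤ.+-identityˡ (e r + e r + (e (1ℤ - r) + e (1ℤ - r)))))))

    ∤norm : ∀ {q n} → Prime q → ¬ (+ ℓ ∣ n) → + q ∣ n → ¬ (+ q ∣ norm J)
    ∤norm {q} {n} pr nℓ d dN = nℓ (subst (λ p → + p ∣ n) (prime∣prime pr ℓ-prime (subst (+ q ∣_) norm-J dN)) d)

    -- ω⁻¹ J has imaginary coordinate - x, so it agrees with its conjugate modulo each prime
    -- dividing x.
    law-x : + 3 * e x ≋ -1ℤ * (1ℤ - x * x) ⟨ 9 ⟩
    law-x = symbol-law J-symbol -1ℤ x (tame λ {q} pr d → (λ { refl → 3∤x d }) , ∤norm pr ℓ∤x d ,
      self-conjugate⁺ {x = W -1ℤ ⊗ J} (∣-resp (lem x y) (∣m⇒∣-m d)))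
      where
      lem : ∀ x y → - x ≡ -1ℤ * y + -1ℤ * x - -1ℤ * y
      lem = solve-∀

    -- For ω J, twice the real coordinate minus the imaginary one is - (x + y), so it is minus its
    -- conjugate modulo each prime dividing x + y.
    law-x+y : + 3 * e (x + y) ≋ 1ℤ * (1ℤ - (x + y) * (x + y)) ⟨ 9 ⟩
    law-x+y = symbol-law J-symbol 1ℤ (x + y) (tame λ {q} pr d → (λ { refl → 3∤x (∣-resp (lem₀ x y) (∣m∣n⇒∣m-n d 3∣y)) }) , ∤norm pr ℓ∤x+y d ,
      self-conjugate⁻ {x = W 1ℤ ⊗ J} (∣-resp (lem x y) (∣m⇒∣-m d)))
      where
      lem₀ : ∀ x y → x + y - y ≡ x
      lem₀ = solve-∀
      lem : ∀ x y → - (x + y) ≡ 0ℤ * x - 1ℤ * y + (0ℤ * x - 1ℤ * y) - (0ℤ * y + 1ℤ * x - 1ℤ * y)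
      lem = solve-∀

    3k≡ : + 3 * + k ≡ x * x - x * y + y * y - 1ℤ
    3k≡ = trans (lem (+ 3 * + k)) (cong (_- 1ℤ) (trans (cong (λ z → 1ℤ + z) (sym (ℤ.pos-* 3 k))) (trans (cong +_ (sym ℓ≡1+3k)) (sym norm-xy))))
      where
      lem : ∀ z → z ≡ 1ℤ + z - 1ℤ
      lem = solve-∀

  private
    1-x² : + 3 ∣ 1ℤ - x * x
    1-x² = ≋0⇒∣ (square≋1 3∤x)

    u : ℤ
    u = _∣_.quotient 1-x²

    -- The symbol s of 1 - r is unknown; it drops out of e(3) - 2 (e(x + y) - e(x)). What remains is
    -- evaluated with 3 k = ℓ - 1 = x² - x y + y² - 1, and `u` stands for (1 - x²) / 3.
    combine : ∀ x y B T a b R s k u → y ≡ + 3 * B → + 3 * k ≡ x * x - x * y + y * y - 1ℤ → 1ℤ - x * x ≡ u * + 3 →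
        + 3 * T - + 3 * (R + R + (s + s)) - + 2 * (+ 3 * a - + 3 * (b + (R + R + s)))
      + (+ 2 * (+ 3 * a - 1ℤ * (1ℤ - (x + y) * (x + y))) - + 2 * (+ 3 * b - -1ℤ * (1ℤ - x * x)))
      + (- + 2 * (+ 3 * R - + 3 * k) + + 9 * (+ 2 * u - x * B - + 4 * (B * B))) ≡ + 3 * T - + 3 * (x * B)
    combine x _ B T a b R s k u refl 3k u≡ = trans (lem₁ x B T a b R s (+ 3 * k) u)
      (trans (cong₂ (λ K U → + 3 * T - + 4 + + 2 * (x * x) + + 2 * ((x + + 3 * B) * (x + + 3 * B)) + + 2 * K + + 6 * U - + 9 * (x * B) - + 36 * (B * B)) 3k (sym u≡)) (lem₂ x B T))
      where
      lem₁ : ∀ x B T a b R s K u →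
          + 3 * T - + 3 * (R + R + (s + s)) - + 2 * (+ 3 * a - + 3 * (b + (R + R + s)))
        + (+ 2 * (+ 3 * a - 1ℤ * (1ℤ - (x + + 3 * B) * (x + + 3 * B))) - + 2 * (+ 3 * b - -1ℤ * (1ℤ - x * x)))
        + (- + 2 * (+ 3 * R - K) + + 9 * (+ 2 * u - x * B - + 4 * (B * B)))
        ≡ + 3 * T - + 4 + + 2 * (x * x) + + 2 * ((x + + 3 * B) * (x + + 3 * B)) + + 2 * K + + 6 * (u * + 3) - + 9 * (x * B) - + 36 * (B * B)
      lem₁ = solve-∀
      lem₂ : ∀ x B T → + 3 * T - + 4 + + 2 * (x * x) + + 2 * ((x + + 3 * B) * (x + + 3 * B)) + + 2 * (x * x - x * (+ 3 * B) + + 3 * B * (+ 3 * B) - 1ℤ)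
        + + 6 * (1ℤ - x * x) - + 9 * (x * B) - + 36 * (B * B) ≡ + 3 * T - + 3 * (x * B)
      lem₂ = solve-∀

  -- From A + 3 B ≡ - A r² (1 - r) and 3 ≡ - r² (1 - r)² modulo ℓ, where the symbols of
  -- A, A + 3 B and r are known.
  J-three : e (+ 3) ≋ x * B ⟨ 3 ⟩
  J-three = *3-cancel (mod (∣-resp (combine x y B (e (+ 3)) (e (x + y)) (e x) (e r) (e (1ℤ - r)) (+ k) u y≡3B 3k≡ (_∣_.equality 1-x²))
    (∣m∣n⇒∣m+n
      (∣m∣n⇒∣m+n (∣m∣n⇒∣m-n (unmod (*3-mono e-3)) (∣n⇒∣m*n (+ 2) (unmod (*3-mono e-x+y))))
        (∣m∣n⇒∣m-n (∣n⇒∣m*n (+ 2) (unmod law-x+y)) (∣n⇒∣m*n (+ 2) (unmod law-x))))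
      (∣m∣n⇒∣m+n (∣n⇒∣m*n (- + 2) (unmod (*3-mono e-root)))
        (∣m⇒∣m*n (+ 2 * u - x * B - + 4 * (B * B)) ∣-refl)))))

  J-primary-symbol : PrimarySymbol J
  J-primary-symbol = record
    { symbol = J-symbol ; A = x ; B = B ; β≡ = cong (⟪ x ,_⟫) y≡3B ; 3∤A = 3∤x ; e-three = J-three }

symbol-1 : PrimarySymbol 1ᴱ
symbol-1 = record
  { symbol = record
    { e = λ _ → 0ℤ ; e-cong = λ _ → ≋-refl ; e-* = λ _ _ → ≋-refl
    ; recip₁ = λ {q} {k} _ _ _ → ≡⇒≋ᴱ (sym (⊗-identityˡ (1ᴱ ^ᴱ k)))
    ; recip₂ = λ {q} {k} _ _ _ → ≡⇒≋ᴱ (sym (⊗-identityˡ (1ᴱ ^ᴱ k))) }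
  ; A = 1ℤ ; B = 0ℤ ; β≡ = refl ; 3∤A = prime∤1 prime[3] ; e-three = ≋-refl }

module _ {β γ : 𝔼} (σ : Symbol β) (τ : Symbol γ) where

  private
    module σ = Symbol σ
    module τ = Symbol τ

    ∣ˡ : ∀ {m} → m ∣ norm β → m ∣ norm (β ⊗ γ)
    ∣ˡ d = subst (_ ∣_) (sym (norm-⊗ β γ)) (∣m⇒∣m*n (norm γ) d)

    ∣ʳ : ∀ {m} → m ∣ norm γ → m ∣ norm (β ⊗ γ)
    ∣ʳ d = subst (_ ∣_) (sym (norm-⊗ β γ)) (∣n⇒∣m*n (norm β) d)

    combine : ∀ {q} k {a b a′ b′} e f → a ^ᴱ k ≋ᴱ W e ⊗ a′ ^ᴱ k ⟨ q ⟩ → b ^ᴱ k ≋ᴱ W f ⊗ b′ ^ᴱ k ⟨ q ⟩ →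
      (a ⊗ b) ^ᴱ k ≋ᴱ W (e + f) ⊗ (a′ ⊗ b′) ^ᴱ k ⟨ q ⟩
    combine {q} k {a} {b} {a′} {b′} e f h h′ = Q.trans (≡⇒≋ᴱ (⊗-^ a b k)) (Q.trans (≋ᴱ-⊗ h h′)
      (≡⇒≋ᴱ (trans (⊗-interchange (W e) (a′ ^ᴱ k) (W f) (b′ ^ᴱ k)) (cong₂ _⊗_ (sym (W-+ e f)) (sym (⊗-^ a′ b′ k))))))
      where module Q = CommutativeRing (𝔼/ q)

    swap₄ : ∀ a b c d → a + b + (c + d) ≡ a + c + (b + d)
    swap₄ = solve-∀

  symbol-⊗ : Symbol (β ⊗ γ)
  symbol-⊗ = record
    { e = λ x → σ.e x + τ.e x
    ; e-cong = λ d → ≋-+ (σ.e-cong (∣-trans (∣ˡ ∣-refl) d)) (τ.e-cong (∣-trans (∣ʳ ∣-refl) d))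
    ; e-* = λ {x} {y} cx cy → ≋-trans (≋-+ (σ.e-* (λ pr d → cx pr (∣ˡ d)) (λ pr d → cy pr (∣ˡ d))) (τ.e-* (λ pr d → cx pr (∣ʳ d)) (λ pr d → cy pr (∣ʳ d))))
        (≡⇒≋ (swap₄ (σ.e x) (σ.e y) (τ.e x) (τ.e y)))
    ; recip₁ = λ {q} {k} pr nq eq → subst (λ z → (β ⊗ γ) ^ᴱ k ≋ᴱ W (σ.e (+ q) + τ.e (+ q)) ⊗ z ^ᴱ k ⟨ q ⟩) (sym (conj-⊗ β γ))
        (combine k (σ.e (+ q)) (τ.e (+ q)) (σ.recip₁ {q} {k} pr (nq ∘ ∣ˡ) eq) (τ.recip₁ {q} {k} pr (nq ∘ ∣ʳ) eq))
    ; recip₂ = λ {q} {k} pr nq eq → subst (λ z → z ^ᴱ k ≋ᴱ W (σ.e (+ q) + τ.e (+ q)) ⊗ (β ⊗ γ) ^ᴱ k ⟨ q ⟩) (sym (conj-⊗ β γ))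
        (combine k (σ.e (+ q)) (τ.e (+ q)) (σ.recip₂ {q} {k} pr (nq ∘ ∣ˡ) eq) (τ.recip₂ {q} {k} pr (nq ∘ ∣ʳ) eq))
    }

-- Modulo 3 the product A B equals B / A because A² ≡ 1, and B / A is additive: (A + 3 B ω) (C + 3 D
-- ω) = A C (1 + 3 (B / A + D / C) ω) to first order in 3.
primary-symbol-⊗ : ∀ {β γ} → PrimarySymbol β → PrimarySymbol γ → PrimarySymbol (β ⊗ γ)
primary-symbol-⊗ {β} {γ} σ τ = record
  { symbol = symbol-⊗ σ.symbol τ.symbol
  ; A = A
  ; B = B
  ; β≡ = trans (cong₂ _⊗_ σ.β≡ τ.β≡) (cong (⟪ A ,_⟫) (lem₁ σ.A σ.B τ.A τ.B))
  ; 3∤A = λ d → ∤-* prime[3] σ.3∤A τ.3∤A (∣-resp (lem₂ (σ.A * τ.A) σ.B τ.B) (∣m∣n⇒∣m+n d (∣m⇒∣m*n (+ 3 * (σ.B * τ.B)) ∣-refl)))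
  ; e-three = ≋-trans (≋-+ σ.e-three τ.e-three) (mod (∣-resp (lem₃ σ.A σ.B τ.A τ.B)
      (∣m∣n⇒∣m+n (∣m∣n⇒∣m+n (∣n⇒∣m*n (τ.A * τ.B) (≋0⇒∣ (square≋1 σ.3∤A))) (∣n⇒∣m*n (σ.A * σ.B) (≋0⇒∣ (square≋1 τ.3∤A))))
        (∣m⇒∣m*n (σ.A * τ.A * (σ.B * τ.B) + + 3 * (σ.B * τ.B) * (σ.A * τ.B + σ.B * τ.A - + 3 * (σ.B * τ.B))) ∣-refl))))
  }
  where
  module σ = PrimarySymbol σ
  module τ = PrimarySymbol τ
  A B : ℤ
  A = σ.A * τ.A - + 3 * σ.B * (+ 3 * τ.B)
  B = σ.A * τ.B + σ.B * τ.A - + 3 * (σ.B * τ.B)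
  lem₁ : ∀ a b c d → a * (+ 3 * d) + + 3 * b * c - + 3 * b * (+ 3 * d) ≡ + 3 * (a * d + b * c - + 3 * (b * d))
  lem₁ = solve-∀
  lem₂ : ∀ x b d → x - + 3 * b * (+ 3 * d) + + 3 * (+ 3 * (b * d)) ≡ x
  lem₂ = solve-∀
  lem₃ : ∀ a b c d → c * d * (1ℤ - a * a) + a * b * (1ℤ - c * c) + + 3 * (a * c * (b * d) + + 3 * (b * d) * (a * d + b * c - + 3 * (b * d)))
    ≡ a * b + c * d - (a * c - + 3 * b * (+ 3 * d)) * (a * d + b * c - + 3 * (b * d))
  lem₃ = solve-∀

-- Factorisation into Jacobi sums

record PrimaryForm (γ : 𝔼) : Set where
  constructor primary-form
  field
    c j     : ℤ
    {β}     : 𝔼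
    primary : PrimarySymbol β
    form    : γ ≡ ι c ⊗ (W j ⊗ β)

norm-ι : ∀ c → norm (ι c) ≡ c * c
norm-ι c = lem c
  where
  lem : ∀ c → c * c - c * 0ℤ + 0ℤ * 0ℤ ≡ c * c
  lem = solve-∀

module _ where
  private
    square≡ : ∀ x → + (∣ x ∣ ℕ.* ∣ x ∣) ≡ x * x
    square≡ x = trans (ℤ.pos-* ∣ x ∣ ∣ x ∣) (go x)
      where
      go : ∀ x → + ∣ x ∣ * + ∣ x ∣ ≡ x * x
      go (+ n)    = refl
      go -[1+ n ] = refl

    -- Completing the square shows that the norm form is positive definite; this bounds the
    -- coordinates of a unit.
    norm-squares : ∀ a b → + 4 * norm ⟪ a , b ⟫ ≡ + (∣ a + a - b ∣ ℕ.* ∣ a + a - b ∣ ℕ.+ 3 ℕ.* (∣ b ∣ ℕ.* ∣ b ∣))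
    norm-squares a b = trans (lem a b) (sym (trans (ℤ.pos-+ (∣ a + a - b ∣ ℕ.* ∣ a + a - b ∣) (3 ℕ.* (∣ b ∣ ℕ.* ∣ b ∣)))
      (cong₂ _+_ (square≡ (a + a - b)) (trans (ℤ.pos-* 3 (∣ b ∣ ℕ.* ∣ b ∣)) (cong (+ 3 *_) (square≡ b))))))
      where
      lem : ∀ a b → + 4 * (a * a - a * b + b * b) ≡ (a + a - b) * (a + a - b) + + 3 * (b * b)
      lem = solve-∀

    small : ∀ m t → m ℕ.+ 3 ℕ.* (t ℕ.* t) ≡ 4 → t ℕ.≤ 1
    small m zero          _  = ℕ.z≤n
    small m (suc zero)    _  = ℕ.s≤s ℕ.z≤n
    small m (suc (suc t)) eq = contradiction (subst (12 ℕ.≤_) eq (ℕ.≤-trans (ℕ.*-monoʳ-≤ 3 (ℕ.*-mono-≤ {2} {suc (suc t)} {2} {suc (suc t)} (ℕ.s≤s (ℕ.s≤s ℕ.z≤n)) (ℕ.s≤s (ℕ.s≤s ℕ.z≤n)))) (ℕ.m≤n+m _ m))) (from-no (12 ℕ.≤? 4))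

    im-small : ∀ a b → ∣ norm ⟪ a , b ⟫ ∣ ≡ 1 → ∣ b ∣ ℕ.≤ 1
    im-small a b eq = small (∣ a + a - b ∣ ℕ.* ∣ a + a - b ∣) ∣ b ∣ (trans (cong ∣_∣ (sym (norm-squares a b)))
      (trans (ℤ.∣i*j∣≡∣i∣*∣j∣ (+ 4) (norm ⟪ a , b ⟫)) (cong (4 ℕ.*_) eq)))

    re-small : ∀ a b → ∣ norm ⟪ a , b ⟫ ∣ ≡ 1 → ∣ a ∣ ℕ.≤ 1
    re-small a b eq = im-small b a (trans (cong ∣_∣ (lem a b)) eq)
      where
      lem : ∀ a b → b * b - b * a + a * a ≡ a * a - a * b + b * b
      lem = solve-∀

  unit-form : ∀ γ → ∣ norm γ ∣ ≡ 1 → PrimaryForm γ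
  unit-form ⟪ a , b ⟫ eq = table a b (re-small a b eq) (im-small a b eq) eq
    where
    table : ∀ a b → ∣ a ∣ ℕ.≤ 1 → ∣ b ∣ ℕ.≤ 1 → ∣ norm ⟪ a , b ⟫ ∣ ≡ 1 → PrimaryForm ⟪ a , b ⟫
    table (+ 1)    (+ 0)    _ _ _ = primary-form 1ℤ 0ℤ symbol-1 refl
    table (+ 0)    (+ 1)    _ _ _ = primary-form 1ℤ 1ℤ symbol-1 refl
    table -[1+ 0 ] -[1+ 0 ] _ _ _ = primary-form 1ℤ (+ 2) symbol-1 refl
    table -[1+ 0 ] (+ 0)    _ _ _ = primary-form -1ℤ 0ℤ symbol-1 refl
    table (+ 0)    -[1+ 0 ] _ _ _ = primary-form -1ℤ 1ℤ symbol-1 refl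
    table (+ 1)    (+ 1)    _ _ _ = primary-form -1ℤ (+ 2) symbol-1 refl
    table (+ 0)    (+ 0)    _ _ ()
    table (+ 1)    -[1+ 0 ] _ _ ()
    table -[1+ 0 ] (+ 1)    _ _ ()
    table (+ suc (suc _)) _ (ℕ.s≤s ()) _ _
    table -[1+ suc _ ]    _ (ℕ.s≤s ()) _ _
    table (+ 0)    (+ suc (suc _)) _ (ℕ.s≤s ()) _
    table (+ 0)    -[1+ suc _ ]    _ (ℕ.s≤s ()) _
    table (+ 1)    (+ suc (suc _)) _ (ℕ.s≤s ()) _
    table (+ 1)    -[1+ suc _ ]    _ (ℕ.s≤s ()) _
    table -[1+ 0 ] (+ suc (suc _)) _ (ℕ.s≤s ()) _
    table -[1+ 0 ] -[1+ suc _ ]    _ (ℕ.s≤s ()) _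

private
  scale-form : ∀ l {γ} → PrimaryForm γ → PrimaryForm (ι l ⊗ γ)
  scale-form l (primary-form c j {β} σ eq) = primary-form (l * c) j σ
    (trans (cong (ι l ⊗_) eq) (trans (sym (⊗-assoc (ι l) (ι c) (W j ⊗ β))) (cong (_⊗ (W j ⊗ β)) (ι-⊗ l c))))

  multiply-form : ∀ {π γ} → PrimarySymbol π → PrimaryForm γ → PrimaryForm (π ⊗ γ)
  multiply-form {π} τ (primary-form c j {β} σ eq) = primary-form c j (primary-symbol-⊗ τ σ) (trans (cong (π ⊗_) eq) (lem π (ι c) (W j) β))
    where
    lem : ∀ p c w b → p ⊗ (c ⊗ (w ⊗ b)) ≡ c ⊗ (w ⊗ (p ⊗ b))
    lem = TR.solve-∀ 𝔼-solver

module SplitPrime {ℓ : ℕ} (ℓ-prime : Prime ℓ) (ℓ≢3 : ℓ ≢ 3) {a b : ℤ} (ℓ∣N : + ℓ ∣ norm ⟪ a , b ⟫) where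

  private instance
    ℓ≢0 : NonZero ℓ
    ℓ≢0 = prime⇒nonZero ℓ-prime

  -- Every inert ℓ ends up here, as r² + r + 1 then has no root modulo ℓ; so does a split ℓ that
  -- divides both coordinates.
  inert : + ℓ ∣ b → ∃[ δ ] ⟪ a , b ⟫ ≡ ι (+ ℓ) ⊗ δ
  inert ℓ∣b@(divides t eq) = build (prime∣square ℓ-prime a (∣-resp (lem a b) (∣m∣n⇒∣m-n ℓ∣N (∣m⇒∣m*n (b - a) ℓ∣b))))
    where
    lem : ∀ a b → a * a - a * b + b * b - b * (b - a) ≡ a * a
    lem = solve-∀
    build : + ℓ ∣ a → ∃[ δ ] ⟪ a , b ⟫ ≡ ι (+ ℓ) ⊗ δ
    build (divides s eq′) = ⟪ s , t ⟫ , trans (cong₂ ⟪_,_⟫ (trans eq′ (ℤ.*-comm s (+ ℓ))) (trans eq (ℤ.*-comm t (+ ℓ)))) (sym (⊗-ι (+ ℓ) ⟪ s , t ⟫))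

  -- The root r = - a / b makes `ρ` vanish at γ, which selects, among the primes above ℓ, the one
  -- containing γ. J lies in the same prime and J̄ in the conjugate one, so γ J̄ is divisible by ℓ =
  -- J J̄, and γ by J.
  split : ¬ (+ ℓ ∣ b) → ∃[ π ] ∃[ δ ] PrimarySymbol π × norm π ≡ + ℓ × ⟪ a , b ⟫ ≡ π ⊗ δ
  split ℓ∤b = J , δ , J-primary-symbol , norm-J , ι-cancel-≡ (+ ℓ) (trans (cong (_⊗ γ) (sym J-norm)) (trans (lem J (conj J) γ) (trans (cong (J ⊗_) γJ̄) (⊗-swap J (ι (+ ℓ)) δ))))
    where
    γ : 𝔼
    γ = ⟪ a , b ⟫
    b⁻¹ r : ℤ
    b⁻¹ = proj₁ (inverse ℓ-prime ℓ∤b)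
    r = - (a * b⁻¹)
    bb⁻¹ : + ℓ ∣ b * b⁻¹ - 1ℤ
    bb⁻¹ = unmod (proj₂ (inverse ℓ-prime ℓ∤b))
    root : + ℓ ∣ r * r + r + 1ℤ
    root = ∣-resp (lem₁ a b b⁻¹) (∣m∣n⇒∣m-n (∣n⇒∣m*n (b⁻¹ * b⁻¹) ℓ∣N) (∣m⇒∣m*n (1ℤ + b * b⁻¹ - a * b⁻¹) bb⁻¹))
      where
      lem₁ : ∀ a b c → c * c * (a * a - a * b + b * b) - (b * c - 1ℤ) * (1ℤ + b * c - a * c) ≡ - (a * c) * - (a * c) + - (a * c) + 1ℤ
      lem₁ = solve-∀
    open PrimeSymbol ℓ-prime ℓ≢3 {r} root
    x y : ℤ
    x = re J
    y = im J
    γ-root : + ℓ ∣ a + b * r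
    γ-root = ∣-resp (lem₁ a b b⁻¹) (∣n⇒∣m*n (- a) bb⁻¹)
      where
      lem₁ : ∀ a b c → - a * (b * c - 1ℤ) ≡ a + b * - (a * c)
      lem₁ = solve-∀
    re-∣ : + ℓ ∣ a * (x - y) - b * - y
    re-∣ = ∣-resp (lem₁ a b x y r) (∣m∣n⇒∣m+n (∣m∣n⇒∣m-n (∣n⇒∣m*n a (≋0⇒∣ ρ-J)) (∣n⇒∣m*n (y * (r + 1ℤ)) γ-root)) (∣n⇒∣m*n (y * b) root))
      where
      lem₁ : ∀ a b x y r → a * (x + y * r) - y * (r + 1ℤ) * (a + b * r) + y * b * (r * r + r + 1ℤ) ≡ a * (x - y) - b * - y
      lem₁ = solve-∀
    im-∣ : + ℓ ∣ a * - y + b * (x - y) - b * - y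
    im-∣ = ∣-resp (lem₁ a b x y r) (∣m∣n⇒∣m-n (∣n⇒∣m*n b (≋0⇒∣ ρ-J)) (∣n⇒∣m*n y γ-root))
      where
      lem₁ : ∀ a b x y r → b * (x + y * r) - y * (a + b * r) ≡ a * - y + b * (x - y) - b * - y
      lem₁ = solve-∀
    δ : 𝔼
    δ = ⟪ _∣_.quotient re-∣ , _∣_.quotient im-∣ ⟫
    γJ̄ : γ ⊗ conj J ≡ ι (+ ℓ) ⊗ δ
    γJ̄ = trans (cong₂ ⟪_,_⟫ (trans (_∣_.equality re-∣) (ℤ.*-comm _ (+ ℓ))) (trans (_∣_.equality im-∣) (ℤ.*-comm _ (+ ℓ)))) (sym (⊗-ι (+ ℓ) δ))
    lem : ∀ x y z → x ⊗ y ⊗ z ≡ x ⊗ (z ⊗ y)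
    lem = TR.solve-∀ 𝔼-solver

primary-form-of : ∀ γ → ¬ (+ 3 ∣ norm γ) → PrimaryForm γ
primary-form-of γ = go (suc ∣ norm γ ∣) γ ℕ.≤-refl
  where
  -- `n` is fuel bounding the norm. A recursive call follows the removal of a factor whose norm is a
  -- multiple of ℓ, so the norm strictly drops.
  go : ∀ n γ → ∣ norm γ ∣ ℕ.< n → ¬ (+ 3 ∣ norm γ) → PrimaryForm γ
  go (suc n) γ@(⟪ a , b ⟫) (ℕ.s≤s N≤n) 3∤N = step (factorise ∣ norm γ ∣ {{N≢0}})
    where
    N≢0 : NonZero ∣ norm γ ∣
    N≢0 = ℕ.≢-nonZero λ eq → 3∤N (subst (+ 3 ∣_) (sym (ℤ.∣i∣≡0⇒i≡0 eq)) (divides 0ℤ refl))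

    descend : ∀ {ℓ} → Prime ℓ → ∀ π δ → + ℓ ∣ norm π → γ ≡ π ⊗ δ → PrimaryForm δ
    descend {ℓ} pr π δ ℓ∣π eq = go n δ (ℕ.<-≤-trans smaller N≤n) (λ d → 3∤N (subst (+ 3 ∣_) (sym N≡) (∣n⇒∣m*n (norm π) d)))
      where
      N≡ : norm γ ≡ norm π * norm δ
      N≡ = trans (cong norm eq) (norm-⊗ π δ)
      N≡ℕ : ∣ norm γ ∣ ≡ ∣ norm π ∣ ℕ.* ∣ norm δ ∣
      N≡ℕ = trans (cong ∣_∣ N≡) (ℤ.∣i*j∣≡∣i∣*∣j∣ (norm π) (norm δ))
      large : ∀ {m k} → .{{NonZero (m ℕ.* k)}} → ℓ ℕ.∣ m → k ℕ.< m ℕ.* k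
      large {zero} {{nz}} _ = contradiction refl (ℕ.≢-nonZero⁻¹ 0 {{nz}})
      large {suc m} {zero} {{nz}} _ = contradiction (ℕ.*-zeroʳ (suc m)) (ℕ.≢-nonZero⁻¹ (suc m ℕ.* 0) {{nz}})
      large {suc zero} {suc k} d = contradiction (subst Prime (ℕ.∣1⇒≡1 d) pr) ¬prime[1]
      large {suc (suc m)} {suc k} d = ℕ.m<m+n (suc k) (ℕ.s≤s ℕ.z≤n)
      smaller : ∣ norm δ ∣ ℕ.< ∣ norm γ ∣
      smaller = subst (∣ norm δ ∣ ℕ.<_) (sym N≡ℕ) (large {{subst NonZero N≡ℕ N≢0}} (∣⇒∣ᵤ ℓ∣π))

    step : PrimeFactorisation ∣ norm γ ∣ → PrimaryForm γ
    step record { factors = [] ; isFactorisation = eq } = unit-form γ eq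
    step record { factors = ℓ ∷ ℓs ; isFactorisation = eq ; factorsPrime = pr ∷ _ } = branch (+ ℓ ∣? b)
      where
      ℓ∣N : + ℓ ∣ norm γ
      ℓ∣N = ∣ᵤ⇒∣ (ℕ.divides (product ℓs) (trans eq (ℕ.*-comm ℓ (product ℓs))))
      ℓ≢3 : ℓ ≢ 3
      ℓ≢3 refl = 3∤N ℓ∣N
      open SplitPrime pr ℓ≢3 {a} {b} ℓ∣N
      branch : Dec (+ ℓ ∣ b) → PrimaryForm γ
      branch (yes d) = assemble (inert d)
        where
        assemble : ∃[ δ ] γ ≡ ι (+ ℓ) ⊗ δ → PrimaryForm γ
        assemble (δ , eq) = subst PrimaryForm (sym eq) (scale-form (+ ℓ) {δ} (descend pr (ι (+ ℓ)) δ
          (subst (+ ℓ ∣_) (sym (norm-ι (+ ℓ))) (∣m⇒∣m*n (+ ℓ) ∣-refl)) eq))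
      branch (no nd) = assemble (split nd)
        where
        assemble : ∃[ π ] ∃[ δ ] PrimarySymbol π × norm π ≡ + ℓ × γ ≡ π ⊗ δ → PrimaryForm γ
        assemble (π , δ , σ , Nπ , eq) = subst PrimaryForm (sym eq) (multiply-form {π} {δ} σ (descend pr π δ (subst (+ ℓ ∣_) (sym Nπ) ∣-refl) eq))

self-conjugate-cancel : ∀ {q} → Prime q → ∀ {c} → ¬ (+ q ∣ c) → ∀ δ → SelfConjugate q (ι c ⊗ δ) → SelfConjugate q δ
self-conjugate-cancel {q} q-prime {c} nc δ = go
  where
  module Q = CommutativeRing (𝔼/ q)
  conj-scale : conj (ι c ⊗ δ) ≡ ι c ⊗ conj δ
  conj-scale = trans (conj-⊗ (ι c) δ) (cong (λ z → ⟪ z , 0ℤ ⟫ ⊗ conj δ) (ℤ.+-identityʳ c))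
  lem : ∀ x y → ⊖ (x ⊗ y) ≡ x ⊗ ⊖ y
  lem = TR.solve-∀ 𝔼-solver
  go : SelfConjugate q (ι c ⊗ δ) → SelfConjugate q δ
  go (inj₁ h) = inj₁ (ι-cancel q-prime nc (Q.trans h (≡⇒≋ᴱ conj-scale)))
  go (inj₂ h) = inj₂ (ι-cancel q-prime nc (Q.trans h (≡⇒≋ᴱ (trans (cong ⊖_ conj-scale) (lem (ι c) (conj δ))))))

-- Coordinates P + Q ω of ω⁻ⁱ (a + b √-3) for the exponent i making it primary.
primary-coordinates : ∀ {a b P Q} → ¬ (+ 3 ∣ a) → + 3 ∣ Q → ∀ i → ⟪ a + b , b + b ⟫ ≡ ωPow₃ i ⊗ ⟪ P , Q ⟫ →
  + toℕ i ≋ - (a * b) ⟨ 3 ⟩ × P * Q ≋ + 2 * (a * b) * (a * a - b * b) ⟨ 9 ⟩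
primary-coordinates {a} {b} {P} {Q} 3∤a 3∣Q = go
  where
  1-a² : + 3 ∣ 1ℤ - a * a
  1-a² = ≋0⇒∣ (square≋1 3∤a)
  Claim : Fin 3 → Set
  Claim i = + toℕ i ≋ - (a * b) ⟨ 3 ⟩ × P * Q ≋ + 2 * (a * b) * (a * a - b * b) ⟨ 9 ⟩

  -- For i = 0, 1, 2 the condition 3 ∣ Q reads b ≡ 0, - a, a modulo 3. In each case i ≡ - a b, a
  -- single polynomial for all three, and likewise for P Q modulo 9.
  claim₀ : P ≡ a + b → Q ≡ b + b → Claim zero
  claim₀ refl refl = mod (∣-resp (lem₁ a b) (∣n⇒∣m*n a 3∣b)) ,
    mod (∣-resp (lem₂ a b) (∣m∣n⇒∣m+n (∣n⇒∣m*n (+ 2 * a) (3∣*3∣⇒9∣ 3∣b 1-a²)) (∣m⇒∣m*n (+ 2 + + 2 * (a * b)) (3∣*3∣⇒9∣ 3∣b 3∣b))))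
    where
    lem₀ : ∀ b → + 3 * b - (b + b) ≡ b
    lem₀ = solve-∀
    3∣b : + 3 ∣ b
    3∣b = ∣-resp (lem₀ b) (∣m∣n⇒∣m-n (∣m⇒∣m*n b ∣-refl) 3∣Q)
    lem₁ : ∀ a b → a * b ≡ 0ℤ - (- (a * b))
    lem₁ = solve-∀
    lem₂ : ∀ a b → + 2 * a * (b * (1ℤ - a * a)) + b * b * (+ 2 + + 2 * (a * b)) ≡ (a + b) * (b + b) - + 2 * (a * b) * (a * a - b * b)
    lem₂ = solve-∀

  claim₁ : P ≡ b - a → Q ≡ - (a + b) → Claim (suc zero)
  claim₁ refl refl = mod (∣-resp (lem₁ a b) (∣m∣n⇒∣m+n 1-a² (∣n⇒∣m*n a 3∣a+b))) ,
    mod (∣-resp (lem₂ a b) (∣n⇒∣m*n (a - b) (3∣*3∣⇒9∣ 3∣a+b (∣m∣n⇒∣m-n (∣m∣n⇒∣m+n (∣m⇒∣m*n 1ℤ ∣-refl) (∣n⇒∣m*n (- + 2) 1-a²)) (∣n⇒∣m*n (+ 2 * a) 3∣a+b)))))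
    where
    lem₀ : ∀ a b → - - (a + b) ≡ a + b
    lem₀ = solve-∀
    3∣a+b : + 3 ∣ a + b
    3∣a+b = ∣-resp (lem₀ a b) (∣m⇒∣-m 3∣Q)
    lem₁ : ∀ a b → 1ℤ - a * a + a * (a + b) ≡ 1ℤ - (- (a * b))
    lem₁ = solve-∀
    lem₂ : ∀ a b → (a - b) * ((a + b) * (+ 3 * 1ℤ + - + 2 * (1ℤ - a * a) - + 2 * a * (a + b))) ≡ (b - a) * - (a + b) - + 2 * (a * b) * (a * a - b * b)
    lem₂ = solve-∀

  claim₂ : P ≡ - (b + b) → Q ≡ a - b → Claim (suc (suc zero))
  claim₂ refl refl = mod (∣-resp (lem₁ a b) (∣m∣n⇒∣m-n (∣m∣n⇒∣m-n (∣m⇒∣m*n 1ℤ ∣-refl) 1-a²) (∣n⇒∣m*n a 3∣Q))) ,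
    mod (∣-resp (lem₂ a b) (∣n⇒∣m*n (- + 2 * b) (3∣*3∣⇒9∣ 3∣Q (∣m∣n⇒∣m-n (∣m∣n⇒∣m-n (∣m⇒∣m*n 1ℤ ∣-refl) (∣n⇒∣m*n (+ 2) 1-a²)) (∣n⇒∣m*n a 3∣Q)))))
    where
    lem₁ : ∀ a b → + 3 * 1ℤ - (1ℤ - a * a) - a * (a - b) ≡ + 2 - (- (a * b))
    lem₁ = solve-∀
    lem₂ : ∀ a b → - + 2 * b * ((a - b) * (+ 3 * 1ℤ - + 2 * (1ℤ - a * a) - a * (a - b))) ≡ - (b + b) * (a - b) - + 2 * (a * b) * (a * a - b * b)
    lem₂ = solve-∀

  go : ∀ i → ⟪ a + b , b + b ⟫ ≡ ωPow₃ i ⊗ ⟪ P , Q ⟫ → Claim i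
  go zero eq = claim₀ (sym (trans (cong re eq) (lem₁ P Q))) (sym (trans (cong im eq) (lem₂ P Q)))
    where
    lem₁ : ∀ P Q → 1ℤ * P - 0ℤ * Q ≡ P
    lem₁ = solve-∀
    lem₂ : ∀ P Q → 1ℤ * Q + 0ℤ * P - 0ℤ * Q ≡ Q
    lem₂ = solve-∀
  go (suc zero) eq = claim₁ (trans (lem₁ P Q) (trans (sym (cong₂ _-_ (cong im eq) (cong re eq))) (lem₃ a b)))
      (trans (lem₂ P Q) (cong -_ (sym (cong re eq))))
    where
    lem₁ : ∀ P Q → P ≡ 0ℤ * Q + 1ℤ * P - 1ℤ * Q - (0ℤ * P - 1ℤ * Q)
    lem₁ = solve-∀
    lem₂ : ∀ P Q → Q ≡ - (0ℤ * P - 1ℤ * Q)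
    lem₂ = solve-∀
    lem₃ : ∀ a b → b + b - (a + b) ≡ b - a
    lem₃ = solve-∀
  go (suc (suc zero)) eq = claim₂ (trans (lem₁ P Q) (cong -_ (sym (cong im eq))))
      (trans (lem₂ P Q) (trans (sym (cong₂ _-_ (cong re eq) (cong im eq))) (lem₃ a b)))
    where
    lem₁ : ∀ P Q → P ≡ - (-1ℤ * Q + -1ℤ * P - -1ℤ * Q)
    lem₁ = solve-∀
    lem₂ : ∀ P Q → Q ≡ -1ℤ * P - -1ℤ * Q - (-1ℤ * Q + -1ℤ * P - -1ℤ * Q)
    lem₂ = solve-∀
    lem₃ : ∀ a b → a + b - (b + b) ≡ a - b
    lem₃ = solve-∀

-- The power of (m + n √d) / 2 modulo p

module PowerLaw {p : ℕ} (p-prime : Prime p) (p≢3 : p ≢ 3) {a b u v : ℤ}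
  (N≡ : a * a + + 3 * (b * b) ≡ u * u * + p - + 3 * (v * v)) (u∣a : u ∣ a) (v∣2b : v ∣ b + b)
  (coprime : ∀ {q} → Prime q → + q ∣ u → ¬ (+ q ∣ v)) (3∤a : ¬ (+ 3 ∣ a)) (3∤v : ¬ (+ 3 ∣ v)) (p∤v : ¬ (+ p ∣ v))
  {K : ℕ} (p≡1+3K : p ≡ suc (3 ℕ.* K)) where

  -- This is a + b √-3, with √-3 = 1 + 2 ω.
  γ : 𝔼
  γ = ⟪ a + b , b + b ⟫

  private
    normγ : norm γ ≡ u * u * + p - + 3 * (v * v)
    normγ = trans (lem a b) N≡
      where
      lem : ∀ a b → (a + b) * (a + b) - (a + b) * (b + b) + (b + b) * (b + b) ≡ a * a + + 3 * (b * b)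
      lem = solve-∀

    3∤N : ¬ (+ 3 ∣ norm γ)
    3∤N d = ∤-* prime[3] 3∤a 3∤a (∣-resp (lem a b) (∣m∣n⇒∣m-n d (∣m⇒∣m*n (b * b) ∣-refl)))
      where
      lem : ∀ a b → (a + b) * (a + b) - (a + b) * (b + b) + (b + b) * (b + b) - + 3 * (b * b) ≡ a * a
      lem = solve-∀

    3∤u : ¬ (+ 3 ∣ u)
    3∤u d = 3∤a (∣-trans d u∣a)

    -- A prime dividing the norm and one of u, v, p divides both u² p and 3 v².
    3v²∤ : ∀ {q} → Prime q → q ≢ 3 → ¬ (+ q ∣ v) → + q ∣ u * u * + p → ¬ (+ q ∣ norm γ)
    3v²∤ {q} pr q≢3 nv du d = ∤-* pr (λ d3 → q≢3 (prime∣prime pr prime[3] d3)) (∤-* pr nv nv)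
      (∣-resp (trans (cong (λ z → u * u * + p - z) normγ) (lem (u * u * + p) (+ 3 * (v * v)))) (∣m∣n⇒∣m-n du d))
      where
      lem : ∀ x y → x - (x - y) ≡ y
      lem = solve-∀

    u²p∤ : ∀ {q} → Prime q → + q ∣ v → ¬ (+ q ∣ norm γ)
    u²p∤ {q} pr dv d = ∤-* pr {u * u} (∤-* pr {u} {u} nu nu) (λ dp → p∤v (subst (λ r → + r ∣ v) (prime∣prime pr p-prime dp) dv))
      (∣-resp (trans (cong (λ z → z + + 3 * (v * v)) normγ) (lem (u * u * + p) (+ 3 * (v * v)))) (∣m∣n⇒∣m+n d (∣n⇒∣m*n (+ 3) (∣m⇒∣m*n v dv))))
      where
      nu : ¬ (+ q ∣ u)
      nu du = coprime pr du dv
      lem : ∀ x y → x - y + y ≡ x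
      lem = solve-∀

  p∤N : ¬ (+ p ∣ norm γ)
  p∤N = 3v²∤ p-prime p≢3 p∤v (∣n⇒∣m*n (u * u) ∣-refl)

  module _ (f : PrimaryForm γ) where
    open PrimaryForm f
    open PrimarySymbol primary
    open Symbol symbol

    private
      δ : 𝔼
      δ = W j ⊗ β

      N≡c²Nβ : norm γ ≡ c * c * norm β
      N≡c²Nβ = trans (cong norm form) (trans (norm-⊗ (ι c) δ) (cong₂ _*_ (norm-ι c)
        (trans (norm-⊗ (W j) β) (trans (cong (_* norm β) (W-norm j)) (ℤ.*-identityˡ (norm β))))))

      Nβ∣N : norm β ∣ norm γ
      Nβ∣N = subst (norm β ∣_) (sym N≡c²Nβ) (∣n⇒∣m*n (c * c) ∣-refl)

      c∣N : c ∣ norm γ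
      c∣N = subst (c ∣_) (sym N≡c²Nβ) (∣m⇒∣m*n (norm β) (∣m⇒∣m*n c ∣-refl))

      3∤c : ¬ (+ 3 ∣ c)
      3∤c d = 3∤N (∣-trans d c∣N)

      self-conjugate-δ : ∀ {q} → Prime q → ¬ (+ q ∣ norm γ) → SelfConjugate q γ → SelfConjugate q δ
      self-conjugate-δ {q} pr nN sc = self-conjugate-cancel pr (λ d → nN (∣-trans d c∣N)) δ (subst (SelfConjugate q) form sc)

      -- Modulo a prime dividing u, and hence a, γ reduces to b √-3, which is minus its conjugate.
      tame-u : Tame symbol j u
      tame-u = tame λ {q} pr d → let q≢3 = (λ { refl → 3∤u d }) ; nN = 3v²∤ pr q≢3 (coprime pr d) (∣m⇒∣m*n (+ p) (∣m⇒∣m*n u d)) in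
        q≢3 , (λ dβ → nN (∣-trans dβ Nβ∣N)) , self-conjugate-δ pr nN (self-conjugate⁻ {x = γ} (∣-resp (lem a b) (∣m⇒∣m*n (+ 2) (∣-trans d u∣a))))
        where
        lem : ∀ a b → a * + 2 ≡ a + b + (a + b) - (b + b)
        lem = solve-∀

      -- Modulo a prime dividing v, the imaginary coordinate 2 b of γ vanishes and γ is its own
      -- conjugate. Asking for v ∣ 2 b covers even v, where v need not divide b.
      tame-v : Tame symbol j v
      tame-v = tame λ {q} pr d → let nN = u²p∤ pr d in
        (λ { refl → 3∤v d }) , (λ dβ → nN (∣-trans dβ Nβ∣N)) , self-conjugate-δ pr nN (self-conjugate⁺ {x = γ} (∣-trans d v∣2b))

      coprime-u : Coprime β u
      coprime-u = tame-coprime symbol j tame-u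

      coprime-v : Coprime β v
      coprime-v = tame-coprime symbol j tame-v

      coprime-* : ∀ {x y} → Coprime β x → Coprime β y → Coprime β (x * y)
      coprime-* cx cy pr d = ∤-* pr (cx pr d) (cy pr d)

      coprime-p : Coprime β (+ p)
      coprime-p pr d dp = p∤N (subst (λ q → + q ∣ norm γ) (prime∣prime pr p-prime dp) (∣-trans d Nβ∣N))

      coprime-3 : Coprime β (+ 3)
      coprime-3 pr d d3 = 3∤N (subst (λ q → + q ∣ norm γ) (prime∣prime pr prime[3] d3) (∣-trans d Nβ∣N))

      e-relation : e u + e u + e (+ p) ≋ e (+ 3) + (e v + e v) ⟨ 3 ⟩
      e-relation = ≋-trans (≋-sym (≋-trans (e-* {u * u} {+ p} (coprime-* {u} {u} coprime-u coprime-u) coprime-p) (≋-+ʳ (e (+ p)) (e-* coprime-u coprime-u))))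
        (≋-trans (e-cong (subst (norm β ∣_) normγ Nβ∣N))
        (≋-trans (e-* {+ 3} {v * v} coprime-3 (coprime-* {v} {v} coprime-v coprime-v)) (≋-+ˡ (e (+ 3)) (e-* coprime-v coprime-v))))

    E : ℤ
    E = + K * j + e (+ p) + + K * j

    -- The rational factor c contributes equally to both sides. The unit ω^j enters through γ and,
    -- inverted, through γ̄, which accounts for the two terms K j in `E`.
    power-law : γ ^ᴱ K ≋ᴱ W E ⊗ conj γ ^ᴱ K ⟨ p ⟩
    power-law = begin
      γ ^ᴱ K ≡⟨ cong (_^ᴱ K) form ⟩
      (ι c ⊗ (W j ⊗ β)) ^ᴱ K ≡⟨ trans (⊗-^ (ι c) (W j ⊗ β) K) (cong (ι c ^ᴱ K ⊗_) (trans (⊗-^ (W j) β K) (cong (_⊗ β ^ᴱ K) (W-^ j K)))) ⟩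
      κ ⊗ (W (+ K * j) ⊗ β ^ᴱ K) ≈⟨ ≋ᴱ-⊗ (Q.refl {κ}) (≋ᴱ-⊗ (Q.refl {W (+ K * j)}) (recip₁ {p} {K} p-prime (λ d → p∤N (∣-trans d Nβ∣N)) p≡1+3K)) ⟩
      κ ⊗ (W (+ K * j) ⊗ (W (e (+ p)) ⊗ conj β ^ᴱ K)) ≡⟨ lem₁ κ (W (+ K * j)) (W (e (+ p))) (conj β ^ᴱ K) ⟩
      W (+ K * j) ⊗ W (e (+ p)) ⊗ 1ᴱ ⊗ (κ ⊗ conj β ^ᴱ K) ≡⟨ cong (λ z → W (+ K * j) ⊗ W (e (+ p)) ⊗ z ⊗ (κ ⊗ conj β ^ᴱ K)) (sym (W-unit (+ K * j))) ⟩
      W (+ K * j) ⊗ W (e (+ p)) ⊗ (W (+ K * j) ⊗ conj (W (+ K * j))) ⊗ (κ ⊗ conj β ^ᴱ K)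
        ≡⟨ lem₂ κ (W (+ K * j)) (W (e (+ p))) (conj (W (+ K * j))) (conj β ^ᴱ K) ⟩
      W (+ K * j) ⊗ W (e (+ p)) ⊗ W (+ K * j) ⊗ (κ ⊗ (conj (W (+ K * j)) ⊗ conj β ^ᴱ K))
        ≡⟨ cong₂ _⊗_ (trans (W-+ (+ K * j + e (+ p)) (+ K * j)) (cong (_⊗ W (+ K * j)) (W-+ (+ K * j) (e (+ p))))) conj-side ⟨
      W E ⊗ conj γ ^ᴱ K ∎
      where
      module Q = CommutativeRing (𝔼/ p)
      open SetoidReasoning Q.setoid
      κ : 𝔼
      κ = ι c ^ᴱ K
      lem₁ : ∀ κ w e b → κ ⊗ (w ⊗ (e ⊗ b)) ≡ w ⊗ e ⊗ 1ᴱ ⊗ (κ ⊗ b)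
      lem₁ = TR.solve-∀ 𝔼-solver
      lem₂ : ∀ κ w e w̄ b → w ⊗ e ⊗ (w ⊗ w̄) ⊗ (κ ⊗ b) ≡ w ⊗ e ⊗ w ⊗ (κ ⊗ (w̄ ⊗ b))
      lem₂ = TR.solve-∀ 𝔼-solver
      conj-side : conj γ ^ᴱ K ≡ κ ⊗ (conj (W (+ K * j)) ⊗ conj β ^ᴱ K)
      conj-side = trans (cong (_^ᴱ K) (trans (cong conj form) (trans (conj-⊗ (ι c) (W j ⊗ β)) (cong₂ _⊗_ (cong (⟪_, 0ℤ ⟫) (ℤ.+-identityʳ c)) (conj-⊗ (W j) β)))))
        (trans (⊗-^ (ι c) (conj (W j) ⊗ conj β) K) (cong (κ ⊗_) (trans (⊗-^ (conj (W j)) (conj β) K)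
        (cong (_⊗ conj β ^ᴱ K) (trans (sym (conj-^ (W j) K)) (cong conj (W-^ j K)))))))

    private
      P Q : ℤ
      P = c * A
      Q = c * (+ 3 * B)

      coordinates : j ≋ - (a * b) ⟨ 3 ⟩ × P * Q ≋ + 2 * (a * b) * (a * a - b * b) ⟨ 9 ⟩
      coordinates = ≋-trans (≋-sym (residue-≋ 3 j)) (proj₁ claim) , proj₂ claim
        where
        claim : + toℕ (residue 3 j) ≋ - (a * b) ⟨ 3 ⟩ × P * Q ≋ + 2 * (a * b) * (a * a - b * b) ⟨ 9 ⟩
        claim = primary-coordinates {a} {b} {P} {Q} 3∤a (∣n⇒∣m*n c (∣m⇒∣m*n B ∣-refl)) (residue 3 j)
          (trans form (trans (⊗-swap (ι c) (W j) β) (cong (W j ⊗_) (trans (cong (ι c ⊗_) β≡) (⊗-ι c ⟪ A , + 3 * B ⟫)))))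

      unit² : ∀ {x} → ¬ (+ 3 ∣ x) → ∃[ t ] 1ℤ - x * x ≡ t * + 3
      unit² nx = _∣_.quotient d , _∣_.equality d
        where d = ≋0⇒∣ (square≋1 nx)

      3e₃≋PQ : + 3 * e (+ 3) ≋ P * Q ⟨ 9 ⟩
      3e₃≋PQ = ≋-trans (*3-mono e-three) (mod (divides (A * B * proj₁ c²) (trans (lem c A B) (trans (cong (λ z → + 3 * (A * B) * z) (proj₂ c²)) (lem′ (A * B) (proj₁ c²))))))
        where
        c² : ∃[ t ] 1ℤ - c * c ≡ t * + 3
        c² = unit² 3∤c
        lem : ∀ c A B → + 3 * (A * B) - c * A * (c * (+ 3 * B)) ≡ + 3 * (A * B) * (1ℤ - c * c)
        lem = solve-∀
        lem′ : ∀ x t → + 3 * x * (t * + 3) ≡ x * t * + 9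
        lem′ = solve-∀

      S : ℤ
      S = + 2 * (a * a) + + 6 * (b * b) + + 4 * (v * v)

      -- The laws for u and v and 6 K j = 2 j (p - 1) give P Q + 2 j (u² + p - 1 - v²). Modulo 9, u²
      -- + p - 1 may be replaced by u² p, since (u² - 1) (p - 1) ≡ 0, and u² p is a² + 3 b² + 3 v².
      3E≋PQ+jS : + 3 * E ≋ P * Q + j * S ⟨ 9 ⟩
      3E≋PQ+jS = mod (∣-resp (combine j (e (+ p)) (e (+ 3)) (e u) (e v) (+ K) (P * Q) (a * a) (b * b) u v (proj₁ u²) (+ p) (proj₂ u²) N≡ p≡)
        (∣m∣n⇒∣m+n (∣m∣n⇒∣m+n (∣m∣n⇒∣m+n (unmod (*3-mono e-relation)) (unmod 3e₃≋PQ))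
          (∣m∣n⇒∣m-n (∣n⇒∣m*n (+ 2) (unmod (symbol-law symbol j v tame-v))) (∣n⇒∣m*n (+ 2) (unmod (symbol-law symbol j u tame-u)))))
          (∣m⇒∣m*n (+ 2 * j * + K * proj₁ u²) ∣-refl)))
        where
        u² : ∃[ t ] 1ℤ - u * u ≡ t * + 3
        u² = unit² 3∤u
        p≡ : + p ≡ 1ℤ + + 3 * + K
        p≡ = trans (cong +_ p≡1+3K) (cong (λ z → 1ℤ + z) (ℤ.pos-* 3 K))
        combine : ∀ j ep e₃ eu ev K PQ a² b² u v t p → 1ℤ - u * u ≡ t * + 3 → a² + + 3 * b² ≡ u * u * p - + 3 * (v * v) → p ≡ 1ℤ + + 3 * K →
          + 3 * (eu + eu + ep) - + 3 * (e₃ + (ev + ev)) + (+ 3 * e₃ - PQ)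
          + (+ 2 * (+ 3 * ev - j * (1ℤ - v * v)) - + 2 * (+ 3 * eu - j * (1ℤ - u * u)))
          + + 9 * (+ 2 * j * K * t)
          ≡ + 3 * (K * j + ep + K * j) - (PQ + j * (+ 2 * a² + + 6 * b² + + 4 * (v * v)))
        combine j ep e₃ eu ev K PQ a² b² u v t p u²≡ N p≡ = begin
          _ ≡⟨ lem₁ j ep e₃ eu ev K PQ u v t ⟩
          base + + 6 * (j * K * (t * + 3)) ≡⟨ cong (λ z → base + + 6 * (j * K * z)) u²≡ ⟨
          base + + 6 * (j * K * (1ℤ - u * u)) ≡⟨ lem₂ j ep K PQ u v ⟩
          + 3 * (K * j + ep + K * j) - (PQ + j * (+ 2 * (u * u * (1ℤ + + 3 * K) - + 3 * (v * v)) + + 4 * (v * v)))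
            ≡⟨ cong (λ z → + 3 * (K * j + ep + K * j) - (PQ + j * (+ 2 * z + + 4 * (v * v)))) (trans (cong (λ z → u * u * z - + 3 * (v * v)) (sym p≡)) (sym N)) ⟩
          + 3 * (K * j + ep + K * j) - (PQ + j * (+ 2 * (a² + + 3 * b²) + + 4 * (v * v))) ≡⟨ lem₃ (+ 3 * (K * j + ep + K * j)) j PQ a² b² (v * v) ⟩
          _ ∎
          where
          open ≡-Reasoning
          base : ℤ
          base = + 3 * ep - PQ - + 2 * j * (1ℤ - v * v) + + 2 * j * (1ℤ - u * u)
          lem₁ : ∀ j ep e₃ eu ev K PQ u v t → + 3 * (eu + eu + ep) - + 3 * (e₃ + (ev + ev)) + (+ 3 * e₃ - PQ)
            + (+ 2 * (+ 3 * ev - j * (1ℤ - v * v)) - + 2 * (+ 3 * eu - j * (1ℤ - u * u))) + + 9 * (+ 2 * j * K * t)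
            ≡ + 3 * ep - PQ - + 2 * j * (1ℤ - v * v) + + 2 * j * (1ℤ - u * u) + + 6 * (j * K * (t * + 3))
          lem₁ = solve-∀
          lem₂ : ∀ j ep K PQ u v → + 3 * ep - PQ - + 2 * j * (1ℤ - v * v) + + 2 * j * (1ℤ - u * u) + + 6 * (j * K * (1ℤ - u * u))
            ≡ + 3 * (K * j + ep + K * j) - (PQ + j * (+ 2 * (u * u * (1ℤ + + 3 * K) - + 3 * (v * v)) + + 4 * (v * v)))
          lem₂ = solve-∀
          lem₃ : ∀ X j PQ a² b² v² → X - (PQ + j * (+ 2 * (a² + + 3 * b²) + + 4 * v²)) ≡ X - (PQ + j * (+ 2 * a² + + 6 * b² + + 4 * v²))
          lem₃ = solve-∀

    power-law-exponent : + 3 * E ≋ a * b * (b * b - + 4 * (v * v)) ⟨ 9 ⟩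
    -- As 3 ∣ `S`, knowing j ≡ - a b modulo 3 determines j S modulo 9.
    power-law-exponent = ≋-trans 3E≋PQ+jS (≋-trans (≋-+ (proj₂ coordinates) (mod (∣-resp (lem₀ j (a * b) S) (3∣*3∣⇒9∣ (unmod (proj₁ coordinates)) 3∣S))))
      (mod (∣-resp (lem a b v) (∣m⇒∣m*n (- (a * b * (b * b))) ∣-refl))))
      where
      lem₀ : ∀ j x S → (j - (- x)) * S ≡ j * S - (- x) * S
      lem₀ = solve-∀
      3∣S : + 3 ∣ S
      3∣S = ∣-resp (lem₁ a b v) (∣m∣n⇒∣m-n (∣m⇒∣m*n (+ 2 + + 2 * (b * b)) ∣-refl) (∣m∣n⇒∣m+n (∣n⇒∣m*n (+ 2) (≋0⇒∣ (square≋1 3∤a))) (∣n⇒∣m*n (+ 4) (≋0⇒∣ (square≋1 3∤v)))))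
        where
        lem₁ : ∀ a b v → + 3 * (+ 2 + + 2 * (b * b)) - (+ 2 * (1ℤ - a * a) + + 4 * (1ℤ - v * v)) ≡ + 2 * (a * a) + + 6 * (b * b) + + 4 * (v * v)
        lem₁ = solve-∀
      lem : ∀ a b v → + 9 * - (a * b * (b * b)) ≡ + 2 * (a * b) * (a * a - b * b) + - (a * b) * (+ 2 * (a * a) + + 6 * (b * b) + + 4 * (v * v)) - a * b * (b * b - + 4 * (v * v))
      lem = solve-∀

  cubic-power-law : ∃[ E ] (γ ^ᴱ K ≋ᴱ W E ⊗ conj γ ^ᴱ K ⟨ p ⟩) × (+ 3 * E ≋ a * b * (b * b - + 4 * (v * v)) ⟨ 9 ⟩)
  cubic-power-law = E f , power-law f , power-law-exponent f
    where
    f : PrimaryForm γ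
    f = primary-form-of γ 3∤N

-- The Legendre symbol modulo 3

-1-non-residue : ¬ IsSquareMod 3 -1ℤ
-1-non-residue (zero , d)           = prime∤1 prime[3] d
-1-non-residue (suc zero , d)       = from-no (+ 3 ∣? (+ 2)) d
-1-non-residue (suc (suc zero) , d) = from-no (+ 3 ∣? (+ 5)) d

private
  legendre-cases : ∀ z {b c} → does (+ 3 ∣? z) ≡ b → does (isSquareMod? 3 z) ≡ c →
    legendre z 3 ≡ (if b then 0ℤ else if c then 1ℤ else -1ℤ)
  legendre-cases z = cong₂ (λ b c → if b then 0ℤ else if c then 1ℤ else -1ℤ)

legendre-1 : ∀ {z} → z ≋ 1ℤ ⟨ 3 ⟩ → legendre z 3 ≡ 1ℤ
legendre-1 {z} h = legendre-cases z {false} {true} (dec-false (+ 3 ∣? z) λ d → prime∤1 prime[3] (≋-∣ (≋-sym h) d))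
  (dec-true (isSquareMod? 3 z) (suc zero , unmod (≋-sym h)))

legendre-neg1 : ∀ {z} → z ≋ -1ℤ ⟨ 3 ⟩ → legendre z 3 ≡ -1ℤ
legendre-neg1 {z} h = legendre-cases z {false} {false} (dec-false (+ 3 ∣? z) λ d → prime∤1 prime[3] (∣m⇒∣-m (≋-∣ (≋-sym h) d)))
  (dec-false (isSquareMod? 3 z) λ (k , sq) → -1-non-residue (k , unmod (≋-trans {a = + toℕ k * + toℕ k} (mod sq) h)))

-- Specialisation to (m + n √d) / 2 and the cases modulo 9

module Main {d m n : ℤ} (m²≡ : m * m - d * (n * n) ≡ - + 4) {p : ℕ} (p-prime : Prime p)
  {x y : ℤ} (p≡ : + p ≡ x * x + + 3 * d * (y * y)) (3∤y : ¬ (+ 3 ∣ y)) (x≋y : x ≋ y ⟨ 3 ⟩)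
  {s : ℤ} (s² : s * s ≋ d ⟨ p ⟩) {half : ℤ} (2half : + 2 * half ≋ 1ℤ ⟨ p ⟩) {w : ℤ} (dyw : d * y * w ≋ 1ℤ ⟨ p ⟩) where

  private
    m²≡′ : m * m ≡ d * (n * n) - + 4
    m²≡′ = trans (lem (m * m) (d * (n * n))) (cong (λ z → d * (n * n) + z) m²≡)
      where
      lem : ∀ a b → a ≡ b + (a - b)
      lem = solve-∀

    p∤2 : ¬ (+ p ∣ + 2)
    p∤2 e = prime∤1 p-prime (≋-∣ (≋-sym 2half) (∣m⇒∣m*n half e))

    p∤y : ¬ (+ p ∣ y)
    p∤y e = prime∤1 p-prime (≋-∣ (≋-sym dyw) (∣m⇒∣m*n w (∣n⇒∣m*n d e)))

    3∤2 : ¬ (+ 3 ∣ + 2)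
    3∤2 = from-no (+ 3 ∣? (+ 2))

    3∤x : ¬ (+ 3 ∣ x)
    3∤x e = 3∤y (≋-∣ (≋-sym x≋y) e)

    p≢3 : p ≢ 3
    p≢3 refl = ∤-* prime[3] 3∤x 3∤x (∣-resp (trans (cong (_- + 3 * d * (y * y)) p≡) (lem x d y)) (∣m∣n⇒∣m-n ∣-refl (∣m⇒∣m*n (y * y) (∣m⇒∣m*n d ∣-refl))))
      where
      lem : ∀ x d y → x * x + + 3 * d * (y * y) - + 3 * d * (y * y) ≡ x * x
      lem = solve-∀

    -- Otherwise m² ≡ -4 ≡ 2 modulo 3, a non-residue.
    3∤n : ¬ (+ 3 ∣ n)
    3∤n e = go (+ 3 ∣? m)
      where
      3∣m²+4 : + 3 ∣ m * m + + 4
      3∣m²+4 = ∣-resp (trans (lem (d * (n * n))) (cong (λ z → z + + 4) (sym m²≡′))) (∣n⇒∣m*n d (∣m⇒∣m*n n e))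
        where
        lem : ∀ a → a ≡ a - + 4 + + 4
        lem = solve-∀
      lem₁ : ∀ m → m * m + + 4 - m * m ≡ + 4
      lem₁ = solve-∀
      lem₂ : ∀ m → m * m + + 4 + (1ℤ - m * m) ≡ + 5
      lem₂ = solve-∀
      go : Dec (+ 3 ∣ m) → ⊥
      go (yes e′) = from-no (+ 3 ∣? (+ 4)) (∣-resp (lem₁ m) (∣m∣n⇒∣m-n 3∣m²+4 (∣m⇒∣m*n m e′)))
      go (no ne′) = from-no (+ 3 ∣? (+ 5)) (∣-resp (lem₂ m) (∣m∣n⇒∣m+n 3∣m²+4 (≋0⇒∣ (square≋1 ne′))))

  -- t represents √-3 modulo p, and x = t s y.
  t r : ℤ
  t = x * w * s
  r = half * (-1ℤ + t)

  private
    t² : t * t ≋ - + 3 ⟨ p ⟩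
    t² = mod (∣-resp (lem x w s d y) (∣m∣n⇒∣m-n (∣m∣n⇒∣m+n (∣n⇒∣m*n (x * x * (w * w)) (unmod s²)) (∣m⇒∣m*n (w * w * d) p∣))
      (∣n⇒∣m*n (+ 3 * (d * y * w + 1ℤ)) (unmod dyw))))
      where
      p∣ : + p ∣ x * x + + 3 * d * (y * y)
      p∣ = subst (+ p ∣_) p≡ ∣-refl
      lem : ∀ x w s d y → x * x * (w * w) * (s * s - d) + (x * x + + 3 * d * (y * y)) * (w * w * d) - + 3 * (d * y * w + 1ℤ) * (d * y * w - 1ℤ)
        ≡ x * w * s * (x * w * s) - (- + 3)
      lem = solve-∀

    root : + p ∣ r * r + r + 1ℤ
    root = ∣-resp (lem half t) (∣m∣n⇒∣m-n (∣n⇒∣m*n (half * half) (unmod t²)) (∣n⇒∣m*n (half * (1ℤ + t) + 1ℤ) (unmod 2half)))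
      where
      lem : ∀ h t → h * h * (t * t - (- + 3)) - (h * (1ℤ + t) + 1ℤ) * (+ 2 * h - 1ℤ) ≡ h * (-1ℤ + t) * (h * (-1ℤ + t)) + h * (-1ℤ + t) + 1ℤ
      lem = solve-∀

    x≋tsy : x ≋ t * s * y ⟨ p ⟩
    x≋tsy = ≋-sym (mod (∣-resp (lem x w s d y) (∣m∣n⇒∣m+n (∣n⇒∣m*n (x * w * y) (unmod s²)) (∣n⇒∣m*n x (unmod dyw)))))
      where
      lem : ∀ x w s d y → x * w * y * (s * s - d) + x * (d * y * w - 1ℤ) ≡ x * w * s * s * y - x
      lem = solve-∀

  open FromRoot p-prime p≢3 {r} root using (ρ; ρ-⊗; ρ-^) renaming (k to K; ℓ≡1+3k to p≡1+3K)

  ε : ℤ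
  ε = (m + n * s) * half

  private
    nonzero-mod-3 : ∀ {z} → ¬ (+ 3 ∣ z) → (z ≋ 1ℤ ⟨ 3 ⟩) ⊎ (z ≋ -1ℤ ⟨ 3 ⟩)
    nonzero-mod-3 {z} nz = go (residue 3 z) (≋-sym (residue-≋ 3 z))
      where
      go : ∀ (i : Fin 3) → z ≋ + toℕ i ⟨ 3 ⟩ → (z ≋ 1ℤ ⟨ 3 ⟩) ⊎ (z ≋ -1ℤ ⟨ 3 ⟩)
      go zero             h = contradiction (≋0⇒∣ h) nz
      go (suc zero)       h = inj₁ h
      go (suc (suc zero)) h = inj₂ (≋-trans h (mod (divides 1ℤ refl)))

    value : ℤ → ℤ
    value c = half * (-1ℤ + c * (x * w) * s)

    ρ-ω : ρ (W 1ℤ) ≡ value 1ℤ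
    ρ-ω = lem half x w s
      where
      lem : ∀ h x w s → 0ℤ + 1ℤ * (h * (-1ℤ + x * w * s)) ≡ h * (-1ℤ + 1ℤ * (x * w) * s)
      lem = solve-∀

    ρ-ω² : ρ (W -1ℤ) ≋ value -1ℤ ⟨ p ⟩
    ρ-ω² = mod (∣-resp (lem half x w s) (unmod 2half))
      where
      lem : ∀ h x w s → + 2 * h - 1ℤ ≡ -1ℤ + -1ℤ * (h * (-1ℤ + x * w * s)) - h * (-1ℤ + -1ℤ * (x * w) * s)
      lem = solve-∀

    ρ-W-1 : ∀ {z} → z ≋ 1ℤ ⟨ 3 ⟩ → ρ (W z) ≋ value 1ℤ ⟨ p ⟩
    ρ-W-1 h = ≡⇒≋ (trans (cong ρ (W-cong h)) ρ-ω)

    ρ-W-neg1 : ∀ {z} → z ≋ -1ℤ ⟨ 3 ⟩ → ρ (W z) ≋ value -1ℤ ⟨ p ⟩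
    ρ-W-neg1 h = ≋-trans (≡⇒≋ (cong ρ (W-cong h))) ρ-ω²

  -- For z ≡ ±1 modulo 3, ω^z is (-1 ± √-3) / 2, and x w s stands for √-3.
  ρ-W-legendre : ∀ {z} → ¬ (+ 3 ∣ z) → ρ (W z) ≋ half * (-1ℤ + legendre z 3 * (x * w) * s) ⟨ p ⟩
  ρ-W-legendre {z} nz = go (nonzero-mod-3 nz)
    where
    go : (z ≋ 1ℤ ⟨ 3 ⟩) ⊎ (z ≋ -1ℤ ⟨ 3 ⟩) → ρ (W z) ≋ value (legendre z 3) ⟨ p ⟩
    go (inj₁ h) = subst (λ c → ρ (W z) ≋ value c ⟨ p ⟩) (sym (legendre-1 h)) (ρ-W-1 h)
    go (inj₂ h) = subst (λ c → ρ (W z) ≋ value c ⟨ p ⟩) (sym (legendre-neg1 h)) (ρ-W-neg1 h)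

  ρ-W-neg-legendre : ∀ {z} → ¬ (+ 3 ∣ z) → ρ (W (- z)) ≋ half * (-1ℤ - legendre z 3 * (x * w) * s) ⟨ p ⟩
  ρ-W-neg-legendre {z} nz = ≋-trans (go (nonzero-mod-3 nz)) (≡⇒≋ (lem half (legendre z 3) (x * w) s))
    where
    lem : ∀ h c t s → h * (-1ℤ + - c * t * s) ≡ h * (-1ℤ - c * t * s)
    lem = solve-∀
    go : (z ≋ 1ℤ ⟨ 3 ⟩) ⊎ (z ≋ -1ℤ ⟨ 3 ⟩) → ρ (W (- z)) ≋ value (- legendre z 3) ⟨ p ⟩
    go (inj₁ h) = subst (λ c → ρ (W (- z)) ≋ value (- c) ⟨ p ⟩) (sym (legendre-1 h)) (ρ-W-neg1 (≋-neg h))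
    go (inj₂ h) = subst (λ c → ρ (W (- z)) ≋ value (- c) ⟨ p ⟩) (sym (legendre-neg1 h)) (ρ-W-1 (≋-neg h))

  private
    9⇒3 : ∀ {a b} → a ≋ b ⟨ 9 ⟩ → a ≋ b ⟨ 3 ⟩
    9⇒3 (mod h) = mod (∣-trans (divides (+ 3) refl) h)

    square-± : ∀ {a c q} → (a ≋ c ⟨ q ⟩) ⊎ (a ≋ - c ⟨ q ⟩) → a * a ≋ c * c ⟨ q ⟩
    square-± (inj₁ h) = ≋-* h h
    square-± {a} {c} (inj₂ h) = ≋-trans (≋-* h h) (≡⇒≋ (lem c))
      where
      lem : ∀ c → - c * - c ≡ c * c
      lem = solve-∀

    ±-∤ : ∀ {a c} → ¬ (+ 3 ∣ c) → (a ≋ c ⟨ 9 ⟩) ⊎ (a ≋ - c ⟨ 9 ⟩) → ¬ (+ 3 ∣ a)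
    ±-∤ {a} {c} nc (inj₁ h) d = nc (≋-∣ (≋-sym (9⇒3 h)) d)
    ±-∤ {a} {c} nc (inj₂ h) d = nc (∣-resp (ℤ.neg-involutive c) (∣m⇒∣-m (≋-∣ (≋-sym (9⇒3 h)) d)))

  exact-/3 : ∀ {z} → + 3 ∣ z → + 3 * (z / + 3) ≡ z
  exact-/3 {z} (divides k eq) = sym (trans (a≡a%n+[a/n]*n z (+ 3)) (trans (cong (λ r → + r + z / + 3 * + 3) remainder≡0)
    (trans (ℤ.+-identityˡ (z / + 3 * + 3)) (ℤ.*-comm (z / + 3) (+ 3)))))
    where
    lem₁ : ∀ r q k → r ≡ r + q * + 3 - q * + 3
    lem₁ = solve-∀
    lem₂ : ∀ q k → k * + 3 - q * + 3 ≡ (k - q) * + 3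
    lem₂ = solve-∀
    3∣remainder : + 3 ∣ + (z % + 3)
    3∣remainder = divides (k - z / + 3) (trans (lem₁ (+ (z % + 3)) (z / + 3) k) (trans (cong (_- z / + 3 * + 3) (trans (sym (a≡a%n+[a/n]*n z (+ 3))) eq)) (lem₂ (z / + 3) k)))
    remainder≡0 : z % + 3 ≡ 0
    remainder≡0 = go (z % + 3) (n%d<d z (+ 3)) 3∣remainder
      where
      go : ∀ r → r ℕ.< 3 → + 3 ∣ + r → r ≡ 0
      go zero    _   _ = refl
      go (suc r) r<3 d = contradiction (ℕ.∣⇒≤ (∣⇒∣ᵤ d)) (ℕ.<⇒≱ r<3)

  Conclusion : Set
  Conclusion = let power = ε ^ ((p ∸ 1) ÷ 3) in
      ( (m ≡ + 0 [mod 9 ]) ⊎ (m ≡ + 4 [mod 9 ]) ⊎ (m ≡ - + 4 [mod 9 ]) → power ≡ 1ℤ [mod p ] )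
    × ( (m ≡ + 3 [mod 9 ]) ⊎ (m ≡ - + 3 [mod 9 ]) → power ≡ half * (-1ℤ + legendre ((m * n) / + 3) 3 * (x * w) * s) [mod p ] )
    × ( (m ≡ + 1 [mod 9 ]) ⊎ (m ≡ - + 1 [mod 9 ]) → power ≡ half * (-1ℤ - legendre (m * n) 3 * (x * w) * s) [mod p ] )
    × ( (m ≡ + 2 [mod 9 ]) ⊎ (m ≡ - + 2 [mod 9 ]) → power ≡ half * (-1ℤ + legendre (m * n) 3 * (x * w) * s) [mod p ] )

  module WithGCD {g u v b : ℤ} (g≢0 : ℤ.NonZero g) (n≡ : n ≡ u * g) (2y≡ : + 2 * y ≡ v * g)
    (coprime : ∀ {q} → Prime q → + q ∣ u → ¬ (+ q ∣ v)) (2b≡ : b + b ≡ m * v) where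

    private
      a : ℤ
      a = u * x

      p∤2y : ¬ (+ p ∣ + 2 * y)
      p∤2y = ∤-* p-prime p∤2 p∤y

      3∤2y : ¬ (+ 3 ∣ + 2 * y)
      3∤2y = ∤-* prime[3] 3∤2 3∤y

      p∤g : ¬ (+ p ∣ g)
      p∤g e = p∤2y (subst (+ p ∣_) (sym 2y≡) (∣n⇒∣m*n v e))

      p∤v : ¬ (+ p ∣ v)
      p∤v e = p∤2y (subst (+ p ∣_) (sym 2y≡) (∣m⇒∣m*n g e))

      3∤v : ¬ (+ 3 ∣ v)
      3∤v e = 3∤2y (subst (+ 3 ∣_) (sym 2y≡) (∣m⇒∣m*n g e))

      3∤u : ¬ (+ 3 ∣ u)
      3∤u e = 3∤n (subst (+ 3 ∣_) (sym n≡) (∣m⇒∣m*n g e))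

      -- As g γ = n x + m y √-3, this is n² x² + 3 m² y² = n² p - 12 y² divided by g², a consequence
      -- of m² = d n² - 4. The factor 4 g² clears the denominators of u, v and b.
      N≡ : a * a + + 3 * (b * b) ≡ u * u * + p - + 3 * (v * v)
      N≡ = ℤ.*-cancelˡ-≡ (+ 4 * (g * g)) _ _ {{ℤ.i*j≢0 (+ 4) (g * g) {{_}} {{ℤ.i*j≢0 g g {{g≢0}} {{g≢0}}}}}} (begin
        + 4 * (g * g) * (u * x * (u * x) + + 3 * (b * b))
          ≡⟨ lem₁ g u x b ⟩
        + 4 * (u * g * (u * g)) * (x * x) + + 3 * ((b + b) * (b + b)) * (g * g)
          ≡⟨ cong₂ (λ n z → + 4 * (n * n) * (x * x) + + 3 * (z * z) * (g * g)) (sym n≡) 2b≡ ⟩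
        + 4 * (n * n) * (x * x) + + 3 * (m * v * (m * v)) * (g * g)
          ≡⟨ lem₂ n x m v g ⟩
        + 4 * (n * n) * (x * x) + + 3 * (m * m) * (v * g * (v * g))
          ≡⟨ cong₂ (λ m² z → + 4 * (n * n) * (x * x) + + 3 * m² * (z * z)) m²≡′ (sym 2y≡) ⟩
        + 4 * (n * n) * (x * x) + + 3 * (d * (n * n) - + 4) * (+ 2 * y * (+ 2 * y))
          ≡⟨ lem₃ n x d y ⟩
        + 4 * (n * n) * (x * x + + 3 * d * (y * y)) - + 12 * (+ 2 * y * (+ 2 * y))
          ≡⟨ cong₂ (λ z P → + 4 * (n * n) * P - + 12 * (z * z)) 2y≡ (sym p≡) ⟩
        + 4 * (n * n) * + p - + 12 * (v * g * (v * g))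
          ≡⟨ cong (λ n → + 4 * (n * n) * + p - + 12 * (v * g * (v * g))) n≡ ⟩
        + 4 * (u * g * (u * g)) * + p - + 12 * (v * g * (v * g))
          ≡⟨ lem₄ u g v (+ p) ⟩
        + 4 * (g * g) * (u * u * + p - + 3 * (v * v)) ∎)
        where
        open ≡-Reasoning
        lem₁ : ∀ g u x b → + 4 * (g * g) * (u * x * (u * x) + + 3 * (b * b)) ≡ + 4 * (u * g * (u * g)) * (x * x) + + 3 * ((b + b) * (b + b)) * (g * g)
        lem₁ = solve-∀
        lem₂ : ∀ n x m v g → + 4 * (n * n) * (x * x) + + 3 * (m * v * (m * v)) * (g * g) ≡ + 4 * (n * n) * (x * x) + + 3 * (m * m) * (v * g * (v * g))
        lem₂ = solve-∀
        lem₃ : ∀ n x d y → + 4 * (n * n) * (x * x) + + 3 * (d * (n * n) - + 4) * (+ 2 * y * (+ 2 * y))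
          ≡ + 4 * (n * n) * (x * x + + 3 * d * (y * y)) - + 12 * (+ 2 * y * (+ 2 * y))
        lem₃ = solve-∀
        lem₄ : ∀ u g v p → + 4 * (u * g * (u * g)) * p - + 12 * (v * g * (v * g)) ≡ + 4 * (g * g) * (u * u * p - + 3 * (v * v))
        lem₄ = solve-∀

    open PowerLaw p-prime p≢3 {a} {b} {u} {v} N≡ (∣m⇒∣m*n x ∣-refl) (subst (v ∣_) (sym 2b≡) (∣n⇒∣m*n m ∣-refl))
      coprime (∤-* prime[3] 3∤u 3∤x) 3∤v p∤v {K} p≡1+3K using (γ; p∤N; cubic-power-law)

    private
      Γ Γ̄ : ℤ
      Γ = ρ γ
      Γ̄ = ρ (conj γ)

      -- Here b + 2 b r ≡ b t, since r = (-1 + t) / 2. Keeping m and b general allows both to be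
      -- negated, which yields the conjugate.
      image : ∀ m b → b + b ≡ m * v → + 2 * g * (u * x + b + (b + b) * r) ≋ + 2 * y * (t * (n * s + m)) ⟨ p ⟩
      image m b 2b≡ = begin
        + 2 * g * (u * x + b + (b + b) * (half * (-1ℤ + t)))
          ≡⟨ lem₁ u g x b half t ⟩
        + 2 * (u * g) * x + (b + b) * g * (1ℤ + (-1ℤ + t) * (+ 2 * half))
          ≈⟨ ≋-+ˡ (+ 2 * (u * g) * x) (≋-*ˡ ((b + b) * g) (≋-+ˡ 1ℤ (≋-*ˡ (-1ℤ + t) 2half))) ⟩
        + 2 * (u * g) * x + (b + b) * g * (1ℤ + (-1ℤ + t) * 1ℤ)
          ≡⟨ cong₂ (λ n z → + 2 * n * x + z * (1ℤ + (-1ℤ + t) * 1ℤ)) (sym n≡) (trans (cong (_* g) 2b≡) (trans (ℤ.*-assoc m v g) (cong (m *_) (sym 2y≡)))) ⟩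
        + 2 * n * x + m * (+ 2 * y) * (1ℤ + (-1ℤ + t) * 1ℤ)
          ≈⟨ ≋-+ʳ (m * (+ 2 * y) * (1ℤ + (-1ℤ + t) * 1ℤ)) (≋-*ˡ (+ 2 * n) x≋tsy) ⟩
        + 2 * n * (t * s * y) + m * (+ 2 * y) * (1ℤ + (-1ℤ + t) * 1ℤ)
          ≡⟨ lem₂ n t s y m ⟩
        + 2 * y * (t * (n * s + m)) ∎
        where
        open SetoidReasoning (CommutativeRing.setoid (ℤ/ p))
        lem₁ : ∀ u g x b h t → + 2 * g * (u * x + b + (b + b) * (h * (-1ℤ + t))) ≡ + 2 * (u * g) * x + (b + b) * g * (1ℤ + (-1ℤ + t) * (+ 2 * h))
        lem₁ = solve-∀
        lem₂ : ∀ n t s y m → + 2 * n * (t * s * y) + m * (+ 2 * y) * (1ℤ + (-1ℤ + t) * 1ℤ) ≡ + 2 * y * (t * (n * s + m))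
        lem₂ = solve-∀

      2gΓ : + 2 * g * Γ ≋ + 2 * y * (t * (n * s + m)) ⟨ p ⟩
      2gΓ = image m b 2b≡

      2gΓ̄ : + 2 * g * Γ̄ ≋ + 2 * y * (t * (n * s - m)) ⟨ p ⟩
      2gΓ̄ = ≋-trans (≡⇒≋ (lem g u x b r)) (image (- m) (- b) (trans (sym (ℤ.neg-distrib-+ b b)) (trans (cong -_ 2b≡) (ℤ.neg-distribˡ-* m v))))
        where
        lem : ∀ g u x b r → + 2 * g * (u * x + b - (b + b) + - (b + b) * r) ≡ + 2 * g * (u * x + - b + (- b + - b) * r)
        lem = solve-∀

      p∤2g : ¬ (+ p ∣ + 2 * g)
      p∤2g = ∤-* p-prime p∤2 p∤g

      -- Γ : Γ̄ is n s + m : n s - m, and (n s + m) (n s - m) ≡ d n² - m² = 4 cancels the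
      -- denominator of ε².
      ε²Γ̄ : ε * ε * Γ̄ ≋ Γ ⟨ p ⟩
      ε²Γ̄ = ≋-cancelˡ p-prime p∤2g (begin
        + 2 * g * (ε * ε * Γ̄) ≡⟨ lem₁ (+ 2 * g) (ε * ε) Γ̄ ⟩
        ε * ε * (+ 2 * g * Γ̄) ≈⟨ ≋-*ˡ (ε * ε) 2gΓ̄ ⟩
        ε * ε * (+ 2 * y * (t * (n * s - m))) ≡⟨ lem₂ m n s half y t ⟩
        half * half * (+ 2 * y * (t * (n * s + m))) * (n * n * (s * s) - m * m)
          ≈⟨ ≋-*ˡ H (≋-+ʳ (- (m * m)) (≋-*ˡ (n * n) s²)) ⟩
        H * (n * n * d - m * m) ≡⟨ cong (H *_) (trans (lem₃ d n m) (cong -_ m²≡)) ⟩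
        H * + 4 ≡⟨ lem₄ half (+ 2 * y * (t * (n * s + m))) ⟩
        + 2 * half * (+ 2 * half) * (+ 2 * y * (t * (n * s + m)))
          ≈⟨ ≋-*ʳ (+ 2 * y * (t * (n * s + m))) (≋-* 2half 2half) ⟩
        1ℤ * 1ℤ * (+ 2 * y * (t * (n * s + m))) ≡⟨ ℤ.*-identityˡ _ ⟩
        + 2 * y * (t * (n * s + m)) ≈⟨ 2gΓ ⟨
        + 2 * g * Γ ∎)
        where
        open SetoidReasoning (CommutativeRing.setoid (ℤ/ p))
        H : ℤ
        H = half * half * (+ 2 * y * (t * (n * s + m)))
        lem₁ : ∀ g e c → g * (e * c) ≡ e * (g * c)
        lem₁ = solve-∀
        lem₂ : ∀ m n s h y t → (m + n * s) * h * ((m + n * s) * h) * (+ 2 * y * (t * (n * s - m)))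
          ≡ h * h * (+ 2 * y * (t * (n * s + m))) * (n * n * (s * s) - m * m)
        lem₂ = solve-∀
        lem₃ : ∀ d n m → n * n * d - m * m ≡ - (m * m - d * (n * n))
        lem₃ = solve-∀
        lem₄ : ∀ h z → h * h * z * + 4 ≡ + 2 * h * (+ 2 * h) * z
        lem₄ = solve-∀

      ΓΓ̄ : ¬ (+ p ∣ Γ * Γ̄)
      ΓΓ̄ e = p∤N (∣-resp (lem (norm γ) r) (≋-∣ (≋-trans (≡⇒≋ (cong ρ (sym (⊗-conj γ)))) (ρ-⊗ γ (conj γ))) e))
        where
        lem : ∀ N r → N + 0ℤ * r ≡ N
        lem = solve-∀

      p∤Γ : ¬ (+ p ∣ Γ)
      p∤Γ e = ΓΓ̄ (∣m⇒∣m*n Γ̄ e)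

      p∤Γ̄ : ¬ (+ p ∣ Γ̄)
      p∤Γ̄ e = ΓΓ̄ (∣n⇒∣m*n Γ e)

      p∤ε : ¬ (+ p ∣ ε)
      p∤ε e = p∤Γ (≋-∣ (≋-sym ε²Γ̄) (∣m⇒∣m*n Γ̄ (∣m⇒∣m*n ε e)))

      E : ℤ
      E = proj₁ cubic-power-law

      P : ℤ
      P = ε ^ K

      P² : P * P ≋ ρ (W E) ⟨ p ⟩
      P² = ≋-cancelˡ p-prime (∤-^ p-prime p∤Γ̄ K) (begin
        Γ̄ ^ K * (P * P) ≡⟨ trans (cong (Γ̄ ^ K *_) (sym (*-^ ε ε K))) (trans (ℤ.*-comm (Γ̄ ^ K) ((ε * ε) ^ K)) (sym (*-^ (ε * ε) Γ̄ K))) ⟩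
        (ε * ε * Γ̄) ^ K ≈⟨ ≋-^ K ε²Γ̄ ⟩
        Γ ^ K ≈⟨ ρ-^ γ K ⟨
        ρ (γ ^ᴱ K) ≈⟨ ρ-cong (proj₁ (proj₂ cubic-power-law)) ⟩
        ρ (W E ⊗ conj γ ^ᴱ K) ≈⟨ ρ-⊗ (W E) (conj γ ^ᴱ K) ⟩
        ρ (W E) * ρ (conj γ ^ᴱ K) ≈⟨ ≋-*ˡ (ρ (W E)) (ρ-^ (conj γ) K) ⟩
        ρ (W E) * Γ̄ ^ K ≡⟨ ℤ.*-comm (ρ (W E)) (Γ̄ ^ K) ⟩
        Γ̄ ^ K * ρ (W E) ∎)
        where
        open SetoidReasoning (CommutativeRing.setoid (ℤ/ p))
        ρ-cong : ∀ {z z′} → z ≋ᴱ z′ ⟨ p ⟩ → ρ z ≋ ρ z′ ⟨ p ⟩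
        ρ-cong (modᴱ h k) = ≋-+ h (≋-*ʳ r k)

    -- ε^K is the inverse of its square because its cube is ε^(p-1).
    power-value : ε ^ K ≋ ρ (W (- E)) ⟨ p ⟩
    power-value = begin
      P ≡⟨ ℤ.*-identityʳ P ⟨
      P * 1ℤ ≈⟨ ≋-*ˡ P (≋-sym P³) ⟩
      P * (P * (P * (P * 1ℤ))) ≡⟨ lem P ⟩
      P * P * (P * P) ≈⟨ ≋-* P² P² ⟩
      ρ (W E) * ρ (W E) ≈⟨ ρ-⊗ (W E) (W E) ⟨
      ρ (W E ⊗ W E) ≡⟨ cong ρ (trans (W-square E) (sym (W-neg E))) ⟩
      ρ (W (- E)) ∎
      where
      open SetoidReasoning (CommutativeRing.setoid (ℤ/ p))
      lem : ∀ P → P * (P * (P * (P * 1ℤ))) ≡ P * P * (P * P)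
      lem = solve-∀
      P³ : P ^ 3 ≋ 1ℤ ⟨ p ⟩
      P³ = ≋-trans (≡⇒≋ (trans (ℤ.^-*-assoc ε K 3) (cong (ε ^_) (ℕ.*-comm K 3)))) (fermat-unit p-prime p≡1+3K p∤ε)

    exponent : + 3 * E ≋ m * n * (m * m - + 16) ⟨ 9 ⟩
    -- -8 ≡ 1 modulo 9, and the factor 8 lets every b be paired with a 2, so that only 2 b = m v
    -- remains.
    exponent = ≋-trans (mod (divides (+ 3 * E) (lem₀ E))) (≋-trans (≋-*ˡ (- + 8) (proj₂ (proj₂ cubic-power-law)))
      (≋-trans (≡⇒≋ rearranged) (mod (∣-resp (lem₅ m n (u * x * v * (v * v))) (3∣*3∣⇒9∣ (∣m⇒∣-m 3∣m³-16m) z+n)))))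
      where
      lem₀ : ∀ E → + 3 * E - (- + 8 * (+ 3 * E)) ≡ + 3 * E * + 9
      lem₀ = solve-∀
      rearranged : - + 8 * (a * b * (b * b - + 4 * (v * v))) ≡ - (m * (m * m - + 16)) * (u * x * v * (v * v))
      rearranged = trans (lem₁ (u * x) b v) (trans (cong (λ z → - (u * x * z * (z * z - + 16 * (v * v)))) 2b≡) (lem₂ u x m v))
        where
        lem₁ : ∀ a b v → - + 8 * (a * b * (b * b - + 4 * (v * v))) ≡ - (a * (b + b) * ((b + b) * (b + b) - + 16 * (v * v)))
        lem₁ = solve-∀
        lem₂ : ∀ u x m v → - (u * x * (m * v) * (m * v * (m * v) - + 16 * (v * v))) ≡ - (m * (m * m - + 16)) * (u * x * v * (v * v))
        lem₂ = solve-∀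
      3∣m³-16m : + 3 ∣ m * (m * m - + 16)
      3∣m³-16m = ∣-resp (lem m) (∣m∣n⇒∣m-n (unmod (fermat prime[3] m)) (∣m⇒∣m*n (+ 5 * m) ∣-refl))
        where
        lem : ∀ m → m * (m * (m * 1ℤ)) - m - + 3 * (+ 5 * m) ≡ m * (m * m - + 16)
        lem = solve-∀
      v² : + 3 ∣ 1ℤ - v * v
      v² = ≋0⇒∣ (square≋1 3∤v)
      -- Modulo 3, v² ≡ 1 and x ≡ y ≡ - 2 y = - v g, so u x v³ ≡ - u g = - n. This is where the
      -- normalisation x ≡ y enters.
      z+n : + 3 ∣ u * x * v * (v * v) + n
      z+n = subst (λ n → + 3 ∣ u * x * v * (v * v) + n) (sym n≡) (∣-resp (lem u x v g y)
        (∣m∣n⇒∣m+n (∣m∣n⇒∣m+n (∣n⇒∣m*n (g * u - u * x * v) v²) (∣m⇒∣m*n (u * v * x) ∣-refl))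
          (∣m∣n⇒∣m-n (∣n⇒∣m*n (- (+ 2 * u * v)) (unmod x≋y)) (∣n⇒∣m*n (u * v) 2y-vg))))
        where
        2y-vg : + 3 ∣ + 2 * y - v * g
        2y-vg = subst (λ z → + 3 ∣ + 2 * y - z) 2y≡ (divides 0ℤ (ℤ.+-inverseʳ (+ 2 * y)))
        lem : ∀ u x v g y → (g * u - u * x * v) * (1ℤ - v * v) + + 3 * (u * v * x) + (- (+ 2 * u * v) * (x - y) - u * v * (+ 2 * y - v * g))
          ≡ u * x * v * (v * v) + u * g
        lem = solve-∀
      lem₅ : ∀ m n z → - (m * (m * m - + 16)) * (z + n) ≡ - (m * (m * m - + 16)) * z - m * n * (m * m - + 16)
      lem₅ = solve-∀

    -- The cases differ by m² - 16 modulo 9: it is 0, 3, -3 for m ≡ ±4, ±1, ±2, while for m ≡ ±3 it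
    -- is 2 and m n = 3 z gives 6 z ≡ - 3 z.
    ε^K≋ : ∀ {z} → m * n * (m * m - + 16) ≋ + 3 * z ⟨ 9 ⟩ → ε ^ K ≋ ρ (W (- z)) ⟨ p ⟩
    ε^K≋ {z} h = ≋-trans power-value (≡⇒≋ (cong ρ (W-cong {y = - z} (≋-neg (*3-cancel (≋-trans exponent h))))))

    case-0-4 : (m ≋ 0ℤ ⟨ 9 ⟩) ⊎ (m ≋ + 4 ⟨ 9 ⟩) ⊎ (m ≋ - + 4 ⟨ 9 ⟩) → ε ^ K ≋ 1ℤ ⟨ p ⟩
    case-0-4 h = ≋-trans (ε^K≋ {0ℤ} (go h)) (≡⇒≋ (lem r))
      where
      lem : ∀ r → 1ℤ + 0ℤ * r ≡ 1ℤ
      lem = solve-∀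
      go : (m ≋ 0ℤ ⟨ 9 ⟩) ⊎ (m ≋ + 4 ⟨ 9 ⟩) ⊎ (m ≋ - + 4 ⟨ 9 ⟩) → m * n * (m * m - + 16) ≋ + 3 * 0ℤ ⟨ 9 ⟩
      go (inj₁ h) = ∣⇒≋0 (∣m⇒∣m*n (m * m - + 16) (∣m⇒∣m*n n (≋0⇒∣ h)))
      go (inj₂ h) = ∣⇒≋0 (∣n⇒∣m*n (m * n) (unmod (square-± h)))

    case-1 : (m ≋ 1ℤ ⟨ 9 ⟩) ⊎ (m ≋ - 1ℤ ⟨ 9 ⟩) → ε ^ K ≋ half * (-1ℤ - legendre (m * n) 3 * (x * w) * s) ⟨ p ⟩
    case-1 h = ≋-trans (ε^K≋ (mod (∣-resp (lem (m * n) (m * m)) (∣m∣n⇒∣m-n (∣n⇒∣m*n (m * n) (unmod (square-± h))) (∣m⇒∣m*n (+ 2 * (m * n)) ∣-refl)))))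
      (ρ-W-neg-legendre (∤-* prime[3] (±-∤ (prime∤1 prime[3]) h) 3∤n))
      where
      lem : ∀ k m² → k * (m² - 1ℤ * 1ℤ) - + 9 * (+ 2 * k) ≡ k * (m² - + 16) - + 3 * k
      lem = solve-∀

    case-2 : (m ≋ + 2 ⟨ 9 ⟩) ⊎ (m ≋ - + 2 ⟨ 9 ⟩) → ε ^ K ≋ half * (-1ℤ + legendre (m * n) 3 * (x * w) * s) ⟨ p ⟩
    case-2 h = ≋-trans (ε^K≋ { - (m * n)} (mod (∣-resp (lem (m * n) (m * m)) (∣m∣n⇒∣m-n (∣n⇒∣m*n (m * n) (unmod (square-± h))) (∣m⇒∣m*n (m * n) ∣-refl)))))
      (≋-trans (≡⇒≋ (cong (λ z → ρ (W z)) (ℤ.neg-involutive (m * n)))) (ρ-W-legendre (∤-* prime[3] (±-∤ 3∤2 h) 3∤n)))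
      where
      lem : ∀ k m² → k * (m² - + 2 * + 2) - + 9 * k ≡ k * (m² - + 16) - + 3 * - k
      lem = solve-∀

    case-3 : (m ≋ + 3 ⟨ 9 ⟩) ⊎ (m ≋ - + 3 ⟨ 9 ⟩) → ε ^ K ≋ half * (-1ℤ + legendre ((m * n) / + 3) 3 * (x * w) * s) ⟨ p ⟩
    case-3 h = ≋-trans (ε^K≋ { - z} (subst (λ k → k * (m * m - + 16) ≋ + 3 * - z ⟨ 9 ⟩) 3z≡mn
        (mod (∣-resp (lem z (m * m)) (∣m∣n⇒∣m-n (∣n⇒∣m*n (+ 3 * z) (unmod (square-± h))) (∣m⇒∣m*n (+ 2 * z) ∣-refl))))))
      (≋-trans (≡⇒≋ (cong (λ z → ρ (W z)) (ℤ.neg-involutive z))) (ρ-W-legendre 3∤z))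
      where
      z : ℤ
      z = (m * n) / + 3
      3∣m : + 3 ∣ m
      3∣m = go h
        where
        go : (m ≋ + 3 ⟨ 9 ⟩) ⊎ (m ≋ - + 3 ⟨ 9 ⟩) → + 3 ∣ m
        go (inj₁ h) = ≋-∣ (9⇒3 h) ∣-refl
        go (inj₂ h) = ≋-∣ (9⇒3 h) (divides -1ℤ refl)
      3z≡mn : + 3 * z ≡ m * n
      3z≡mn = exact-/3 (∣m⇒∣m*n n 3∣m)
      lem : ∀ z m² → + 3 * z * (m² - + 3 * + 3) - + 9 * (+ 2 * z) ≡ + 3 * z * (m² - + 16) - + 3 * - z
      lem = solve-∀
      -- If 3 ∣ z then 9 ∣ m n; as m ≡ ±3 modulo 9, this gives 9 ∣ 3 n, contrary to `3∤n`.
      3∤z : ¬ (+ 3 ∣ z)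
      3∤z (divides k eq) = 3∤n (*-cancelˡ-∣ (+ 3) (go h))
        where
        lem₁ : ∀ k → + 3 * (k * + 3) ≡ k * + 9
        lem₁ = solve-∀
        lem₂ : ∀ m n → m * n - (m - + 3) * n ≡ + 3 * n
        lem₂ = solve-∀
        lem₃ : ∀ m n → (m - - + 3) * n - m * n ≡ + 3 * n
        lem₃ = solve-∀
        9∣mn : + 9 ∣ m * n
        9∣mn = divides k (trans (sym 3z≡mn) (trans (cong (+ 3 *_) eq) (lem₁ k)))
        go : (m ≋ + 3 ⟨ 9 ⟩) ⊎ (m ≋ - + 3 ⟨ 9 ⟩) → + 9 ∣ + 3 * n
        go (inj₁ (mod h)) = ∣-resp (lem₂ m n) (∣m∣n⇒∣m-n 9∣mn (∣m⇒∣m*n n h))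
        go (inj₂ (mod h)) = ∣-resp (lem₃ m n) (∣m∣n⇒∣m-n (∣m⇒∣m*n n h) 9∣mn)

    conclusion : Conclusion
    conclusion = (λ h → at (case-0-4 (Sum.map mod (Sum.map mod mod) h)))
      , (λ h → at (case-3 (Sum.map mod mod h)))
      , (λ h → at (case-1 (Sum.map mod mod h)))
      , (λ h → at (case-2 (Sum.map mod mod h)))
      where
      K≡ : (p ∸ 1) ÷ 3 ≡ K
      K≡ = trans (cong (λ q → (q ∸ 1) ÷ 3) p≡1+3K) (trans (cong (_÷ 3) (ℕ.*-comm 3 K)) (ℕ.m*n/n≡m K 3))
      at : ∀ {z} → ε ^ K ≋ z ⟨ p ⟩ → ε ^ ((p ∸ 1) ÷ 3) ≡ z [mod p ]
      at {z} h = unmod (subst (λ k → ε ^ k ≋ z ⟨ p ⟩) (sym K≡) h)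

  private
    G : ℕ
    G = gcd ∣ n ∣ ∣ + 2 * y ∣

    G∣n : + G ∣ n
    G∣n = ∣ᵤ⇒∣ (gcd[m,n]∣m ∣ n ∣ ∣ + 2 * y ∣)

    G∣2y : + G ∣ + 2 * y
    G∣2y = ∣ᵤ⇒∣ (gcd[m,n]∣n ∣ n ∣ ∣ + 2 * y ∣)

    u v : ℤ
    u = _∣_.quotient G∣n
    v = _∣_.quotient G∣2y

    n≡uG : n ≡ u * + G
    n≡uG = _∣_.equality G∣n

    2y≡vG : + 2 * y ≡ v * + G
    2y≡vG = _∣_.equality G∣2y

    G≢0 : ℤ.NonZero (+ G)
    G≢0 = ℤ.≢-nonZero λ G≡0 → ∤-* prime[3] 3∤2 3∤y (subst (+ 3 ∣_) (sym (trans 2y≡vG (trans (cong (v *_) G≡0) (ℤ.*-zeroʳ v)))) (divides 0ℤ refl))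

    coprime-uv : ∀ {q} → Prime q → + q ∣ u → ¬ (+ q ∣ v)
    coprime-uv {q} pr (divides u′ u≡) (divides v′ v≡) = prime∤1 pr (*-cancelˡ-∣ (+ G) {{G≢0}} (∣-resp (sym (ℤ.*-identityʳ (+ G))) Gq∣G))
      where
      lem : ∀ a q G → a * q * G ≡ a * (G * q)
      lem = solve-∀
      Gq∣n : + G * + q ∣ n
      Gq∣n = divides u′ (trans n≡uG (trans (cong (_* + G) u≡) (lem u′ (+ q) (+ G))))
      Gq∣2y : + G * + q ∣ + 2 * y
      Gq∣2y = divides v′ (trans 2y≡vG (trans (cong (_* + G) v≡) (lem v′ (+ q) (+ G))))
      Gq∣G : + G * + q ∣ + G
      Gq∣G = ∣ᵤ⇒∣ (gcd-greatest (∣⇒∣ᵤ Gq∣n) (∣⇒∣ᵤ Gq∣2y))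

    -- Since v G = 2 y, either v or G is even. If G is even, so is n, and m² = d n² - 4 makes m
    -- even.
    2∣mv : + 2 ∣ m * v
    2∣mv = go (prime∣* prime[2] v (+ G) (subst (+ 2 ∣_) 2y≡vG (∣m⇒∣m*n y ∣-refl)))
      where
      2∣m² : + 2 ∣ + G → + 2 ∣ m * m
      2∣m² e = subst (+ 2 ∣_) (sym m²≡′) (∣m∣n⇒∣m+n (∣n⇒∣m*n d (∣m⇒∣m*n n (∣-trans e G∣n))) (divides (- + 2) refl))
      go : (+ 2 ∣ v) ⊎ (+ 2 ∣ + G) → + 2 ∣ m * v
      go (inj₁ e) = ∣n⇒∣m*n m e
      go (inj₂ e) = ∣m⇒∣m*n v (prime∣square prime[2] m (2∣m² e))

    b : ℤ
    b = _∣_.quotient 2∣mv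

    b+b≡mv : b + b ≡ m * v
    b+b≡mv = trans (lem b) (sym (_∣_.equality 2∣mv))
      where
      lem : ∀ b → b + b ≡ b * + 2
      lem = solve-∀

  result : Conclusion
  result = WithGCD.conclusion {+ G} {u} {v} {b} G≢0 n≡uG 2y≡vG coprime-uv b+b≡mv

theorem8p1 : ∀ (d : ℤ) → 1ℤ < d → Squarefree d →
    ∀ (m n : ℤ) → m * m - d * (n * n) ≡ - + 4 →
    ∀ (p : ℕ) → Prime p →
    ∀ (x y : ℤ) → + p ≡ x * x + + 3 * d * (y * y) →
    ¬ (+ 3 ∣ y) → x ≡ y [mod 3 ] →
    ∀ (s : ℤ) → s * s ≡ d [mod p ] →
    ∀ (half : ℤ) → half IsInverseOf (+ 2) [mod p ] →
    ∀ (w : ℤ) → w IsInverseOf (d * y) [mod p ] →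
    let power = ((m + n * s) * half) ^ ((p ∸ 1) ÷ 3) in
    ( (m ≡ + 0 [mod 9 ]) ⊎ (m ≡ + 4 [mod 9 ]) ⊎ (m ≡ - + 4 [mod 9 ]) →
    power ≡ 1ℤ [mod p ] )
    × ( (m ≡ + 3 [mod 9 ]) ⊎ (m ≡ - + 3 [mod 9 ]) →
    power ≡ half * (-1ℤ + legendre ((m * n) / + 3) 3 * (x * w) * s) [mod p ] )
    × ( (m ≡ + 1 [mod 9 ]) ⊎ (m ≡ - + 1 [mod 9 ]) →
    power ≡ half * (-1ℤ - legendre (m * n) 3 * (x * w) * s) [mod p ] )
    × ( (m ≡ + 2 [mod 9 ]) ⊎ (m ≡ - + 2 [mod 9 ]) →
    power ≡ half * (-1ℤ + legendre (m * n) 3 * (x * w) * s) [mod p ] )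
theorem8p1 d _ _ m n m²≡ p p-prime x y p≡ 3∤y x≡y s s² half 2half w dyw =
  Main.result {d} {m} {n} m²≡ p-prime {x} {y} p≡ 3∤y (mod x≡y) {s} (mod s²) {half} (mod 2half) {w} (mod dyw)
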